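{- Let $A$ and $B$ be 0-1 matrices of sizes $p\times q$ and $q\times r$, respectively. Given parameters $\ell\in[p]$ and $k\in[r]$, the matrices can be preprocessed by a randomized algorithm in time $O(p\log p\,(q+\ell)+r\log r\,(q+k)+\ell qk+pr)$ such that afterwards any query asking for the exact value of a single entry $C_{ij}$ of the arithmetic matrix product $C=AB$ can be answered in $O(\lambda(A,\ell,\mathrm{row})+\lambda(B,k,\mathrm{col}))$ time with high probability.
   Context: For a positive integer $r$, $[r]=\{1,\dots,r\}$. The arithmetic matrix product $C=AB$ has entries $C_{ij}=\sum_{h=1}^q A_{ih}B_{hj}$ (over the integers). The Hamming distance $\mathrm{ham}(a,b)$ between $a,b\in\{0,1\}^q$ is the number of coordinates in which they differ. For a 0-1 $p\times q$ matrix $A$, $\lambda(A,\ell,\mathrm{row})$ is the minimum, over all sets $T$ of $\ell$ points of $\{0,1\}^q$, of $\max_{i\in[p]}\min_{u\in T}\mathrm{ham}(A_{i*},u)$, where $A_{i*}$ is the $i$-th row of $A$. For a 0-1 $q\times r$ matrix $B$, $\lambda(B,k,\mathrm{col})$ is the analogous minimum over sets of $k$ points of $\{0,1\}^q$ of the maximum Hamming distance from a column of $B$ to its closest point in the set. An event holds with high probability if it holds with probability at least $1-1/N^{\alpha}$, where $N$ is a parameter related to the input size, for any constant $\alpha\ge1$. Running times are in the standard RAM model. -}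

module Defs where

open import Data.Bool using (Bool; true; false; if_then_else_; _xor_)
open import Data.Fin using (Fin; toℕ)
open import Data.Fin.Properties using (all?)
open import Data.Integer using (+_)
open import Data.List as List using (List; []; _∷_; _++_; length; filter)
open import Data.List.Extrema.Nat using (min; max)
open import Data.Maybe as Maybe using (Maybe; just; nothing; _>>=_)
open import Data.Maybe.Properties using (≡-dec)
open import Data.Maybe.Relation.Unary.Any as MaybeAny using (Any)
open import Data.Nat
open import Data.Nat.DivMod using (_/_; _%_)
open import Data.Nat.Logarithm using (⌈log₂_⌉)
open import Data.Nat.Properties using (m^n≢0)
open import Data.Product using (∃-syntax; _×_)
open import Data.Rational as ℚ using (ℚ; 0ℚ; 1ℚ)
open import Data.Vec as Vec using (Vec; lookup; zipWith; transpose)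
open import Relation.Binary.PropositionalEquality using (_≡_)
open import Relation.Nullary using (Dec)
open import Relation.Unary using (Pred; Decidable)
open import Level using (0ℓ)

------------------------------------------------------------------------
-- 0-1 matrices and their arithmetic product

bit : Bool → ℕ
bit b = if b then 1 else 0

Matrix01 : ℕ → ℕ → Set
Matrix01 p q = Vec (Vec Bool q) p

entry : ∀ {p q} → Matrix01 p q → Fin p → Fin q → ℕ
entry A i h = bit (lookup (lookup A i) h)

productEntry : ∀ {p q r} → Matrix01 p q → Matrix01 q r → Fin p → Fin r → ℕ
productEntry A B i j = Vec.sum (Vec.tabulate λ h → entry A i h * entry B h j)

------------------------------------------------------------------------
-- Covering radii in Hamming space

ham : ∀ {q} → Vec Bool q → Vec Bool q → ℕ
ham a b = Vec.sum (zipWith (λ x y → bit (x xor y)) a b)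

bitVectors : ∀ n → List (Vec Bool n)
bitVectors zero    = Vec.[] ∷ []
bitVectors (suc n) = List.map (false Vec.∷_) (bitVectors n)
                  ++ List.map (true Vec.∷_) (bitVectors n)

-- For a list without repetitions: its subsets with exactly m elements.
subsetsOfSize : ∀ {A : Set} → ℕ → List A → List (List A)
subsetsOfSize zero    xs       = [] ∷ []
subsetsOfSize (suc m) []       = []
subsetsOfSize (suc m) (x ∷ xs) = List.map (x ∷_) (subsetsOfSize m xs)
                              ++ subsetsOfSize (suc m) xs

-- The default value q of the minimum is an upper bound on ham, so it has
-- no influence when T is nonempty.
distanceTo : ∀ {q} → List (Vec Bool q) → Vec Bool q → ℕ
distanceTo {q} T x = min q (List.map (ham x) T)

radius : ∀ {n q} → Vec (Vec Bool q) n → List (Vec Bool q) → ℕ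
radius X T = max 0 (List.map (distanceTo T) (Vec.toList X))

-- Minimum of the radius over all sets T of ℓ points of {0,1}^q.  The cube
-- has only 2^q points; for ℓ > 2^q, T is the whole cube (and the minimum
-- is 0).  Thus the family of candidate sets is never empty.
coveringRadius : ∀ {n q} → ℕ → Vec (Vec Bool q) n → ℕ
coveringRadius {q = q} ℓ X =
  min q (List.map (radius X) (subsetsOfSize (ℓ ⊓ 2 ^ q) (bitVectors q)))

Λrow : ∀ {p q} → Matrix01 p q → ℕ → ℕ
Λrow A ℓ = coveringRadius ℓ A

Λcol : ∀ {q r} → Matrix01 q r → ℕ → ℕ
Λcol B k = coveringRadius k (transpose B)

------------------------------------------------------------------------
-- Probability with respect to m independent fair coin flips

Pr : ∀ {m} {E : Pred (Vec Bool m) 0ℓ} → Decidable E → ℚ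
Pr {m} E? =
  ℚ._/_ (+ length (filter E? (bitVectors m))) (2 ^ m) {{m^n≢0 2 m}}

recip : ℕ → ℚ
recip zero    = 0ℚ
recip (suc n) = + 1 ℚ./ suc n

------------------------------------------------------------------------
-- Unit-cost RAM with w-bit words and fair coin flips
--
-- A fixed program names finitely many registers; memory is reached only
-- indirectly, through an address held in a register.  All words are
-- nonnegative; subtraction is truncated, and division by 0 gives 0.

data Op : Set where
  add sub mul div : Op

data Instr : Set where
  const : (d c : ℕ) → Instr              -- R[d] ← c
  arith : Op → (d a b : ℕ) → Instr       -- R[d] ← R[a] op R[b]
  load  : (d a : ℕ) → Instr              -- R[d] ← M[R[a]]
  store : (a s : ℕ) → Instr              -- M[R[a]] ← R[s]
  flip  : (d : ℕ) → Instr                -- R[d] ← random bit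
  jump  : (target : ℕ) → Instr
  jzero : (a target : ℕ) → Instr         -- jump if R[a] = 0

Program : Set
Program = List Instr

record State : Set where
  constructor mkState
  field
    pc    : ℕ
    reg   : ℕ → ℕ
    mem   : ℕ → ℕ
    coins : List Bool

open State public

wrap : ℕ → ℕ → ℕ
wrap w n = _%_ n (2 ^ w) {{m^n≢0 2 w}}

evalOp : ℕ → Op → ℕ → ℕ → ℕ
evalOp w add x y       = wrap w (x + y)
evalOp w sub x y       = x ∸ y
evalOp w mul x y       = wrap w (x * y)
evalOp w div x zero    = 0
evalOp w div x (suc y) = x / suc y

_[_≔_] : (ℕ → ℕ) → ℕ → ℕ → (ℕ → ℕ)
(f [ a ≔ v ]) x = if x ≡ᵇ a then v else f x

-- A coin flip with no coins left has no successor state.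
step : ℕ → Instr → State → Maybe State
step w (const d c) (mkState n R M ω) =
  just (mkState (suc n) (R [ d ≔ wrap w c ]) M ω)
step w (arith o d a b) (mkState n R M ω) =
  just (mkState (suc n) (R [ d ≔ evalOp w o (R a) (R b) ]) M ω)
step w (load d a) (mkState n R M ω) =
  just (mkState (suc n) (R [ d ≔ M (R a) ]) M ω)
step w (store a s) (mkState n R M ω) =
  just (mkState (suc n) R (M [ R a ≔ R s ]) ω)
step w (flip d) (mkState n R M []) = nothing
step w (flip d) (mkState n R M (b ∷ ω)) =
  just (mkState (suc n) (R [ d ≔ bit b ]) M ω)
step w (jump t) (mkState n R M ω) = just (mkState t R M ω)
step w (jzero a t) (mkState n R M ω) =
  just (mkState (if R a ≡ᵇ 0 then t else suc n) R M ω)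

-- The machine halts when pc leaves the program.  exec w P t s is the final
-- state if this happens after at most t instructions, and nothing otherwise.
exec : ℕ → Program → ℕ → State → Maybe State
exec w P t s with List.head (List.drop (pc s) P)
exec w P t       s | nothing = just s
exec w P zero    s | just i  = nothing
exec w P (suc t) s | just i  = step w i s >>= exec w P t

cells : List ℕ → ℕ → ℕ
cells []       _       = 0
cells (x ∷ xs) zero    = x
cells (x ∷ xs) (suc a) = cells xs a

-- The parameters are in registers 0-4; the memory holds A and then B,
-- each in row-major order, one entry per word.
inputState : ∀ {p q r} → (ℓ k : ℕ) → Matrix01 p q → Matrix01 q r →
             List Bool → State
inputState {p} {q} {r} ℓ k A B ω = mkState 0
  (cells (p ∷ q ∷ r ∷ ℓ ∷ k ∷ []))
  (cells (List.map bit (Vec.toList (Vec.concat A) ++ Vec.toList (Vec.concat B))))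
  ω

-- A query sees only the preprocessed memory M and the (0-based) indices of
-- the requested entry; it has no coins.
queryState : ∀ {p r} → (ℕ → ℕ) → Fin p → Fin r → State
queryState M i j = mkState 0 (cells (toℕ i ∷ toℕ j ∷ [])) M []

------------------------------------------------------------------------
-- Answering queries; the answer is returned in register 0

AnswersAll : ∀ {p q r} → ℕ → Program → Matrix01 p q → Matrix01 q r →
             (ℕ → ℕ) → Set
AnswersAll w Q A B M = ∀ i j →
  ∃[ t ] ∃[ s ] exec w Q t (queryState M i j) ≡ just s
              × reg s 0 ≡ productEntry A B i j
              × (∀ a → mem s a ≡ M a)

AnswersAllWithin : ∀ {p q r} → ℕ → Program → ℕ → Matrix01 p q →
                   Matrix01 q r → (ℕ → ℕ) → Set
AnswersAllWithin w Q t A B M = ∀ i j →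
  Maybe.map (λ s → reg s 0) (exec w Q t (queryState M i j))
    ≡ just (productEntry A B i j)

answersAllWithin? : ∀ {p q r} w Q t (A : Matrix01 p q) (B : Matrix01 q r) M →
                    Dec (AnswersAllWithin w Q t A B M)
answersAllWithin? w Q t A B M = all? λ i → all? λ j → ≡-dec _≟_ _ _

-- The coin sequences for which preprocessing (by P, in at most T steps)
-- leaves a memory from which every query is answered in at most t steps.
FastQueries : ∀ {p q r} → ℕ → Program → Program → (T t ℓ k : ℕ) →
              Matrix01 p q → Matrix01 q r → Pred (Vec Bool T) 0ℓ
FastQueries w P Q T t ℓ k A B ω =
  Any (λ s → AnswersAllWithin w Q t A B (mem s))
      (exec w P T (inputState ℓ k A B (Vec.toList ω)))

fastQueries? : ∀ {p q r} w P Q T t ℓ k (A : Matrix01 p q) (B : Matrix01 q r) →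
               Decidable (FastQueries w P Q T t ℓ k A B)
fastQueries? w P Q T t ℓ k A B ω =
  MaybeAny.dec (λ s → answersAllWithin? w Q t A B (mem s))
               (exec w P T (inputState ℓ k A B (Vec.toList ω)))

preprocessingCost : (p q r ℓ k : ℕ) → ℕ
preprocessingCost p q r ℓ k =
  p * ⌈log₂ p ⌉ * (q + ℓ) + r * ⌈log₂ r ⌉ * (q + k) + ℓ * q * k + p * r

{-# OPTIONS --safe #-}
module Submission where

-- Round each row of A and each column of B to a nearby center.  If u and v are
-- the centers of x = A_i* and y = B_*j, then
--   x · y = u · v + (x - u) · v + x · (y - v),
-- so with a table of the products u · v and with lists of the coordinates where
-- x, u and y, v differ, a query takes time O(1 + ham(x, u) + ham(y, v)).
--
-- Centers within a constant factor of the optimal radius come from Gonzalez'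
-- farthest-first traversal, run on sketches of O(log (p + r)) random signed sums
-- instead of on the points.  The ℓ₁ distance of two sketches is, with high
-- probability, of the order of the square root of the Hamming distance: an
-- exponential moment bounds it from above (needed for each point and its optimal
-- center) and a fourth-moment argument from below (needed for all pairs of
-- points).  Sketches of that length for both sides fit the time bound even if p
-- and r differ widely: if p² ≤ r then p ℓ ≤ r, and otherwise log r ≤ 2 log p.
--
-- The RAM program is compiled from a small language of counted loops whose
-- semantics is a total function on unbounded numbers.  A typing discipline
-- bounds all values by a polynomial, so that no operation overflows.

open import Defs
open import Data.Bool as Bool using (Bool; true; false; if_then_else_; T; _xor_; _∨_; _∧_; not)
open import Data.Bool.Properties using (T-≡; T-∧)
open import Data.Empty using (⊥; ⊥-elim)
open import Data.Fin as Fin using (Fin; toℕ)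
import Data.Fin.Properties as Fin
import Data.Integer as ℤ
import Data.Integer.Properties as ℤ
open import Data.List as List using (List; []; _∷_; _++_; length)
import Data.List.Properties as List
open import Data.List.Extrema.Nat using (argmin-sel; xs≤max)
open import Data.List.Membership.Propositional using (_∈_)
open import Data.List.Membership.Propositional.Properties using (∈-map⁻; ∈-++⁻)
open import Data.List.Relation.Unary.All as All using (All; []; _∷_)
import Data.List.Relation.Unary.All.Properties as All
open import Data.List.Relation.Unary.Any using (here; there)
open import Data.Maybe as Maybe using (Maybe; just; nothing; _>>=_; from-just)
import Data.Maybe.Relation.Unary.Any as MaybeAny
open import Data.Nat
open import Data.Nat.DivMod using (_/_; _%_; m/n≤m; m≡m%n+[m/n]*n; m%n<n; m<n⇒m%n≡m; [m+kn]%n≡m%n)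
open import Data.Nat.Logarithm using (⌈log₂_⌉; ⌈log₂⌉-mono-≤; ⌈log₂⌈n/2⌉⌉≡⌈log₂n⌉∸1; ⌈log₂2*n⌉≡1+⌈log₂n⌉; ⌈log₂2^n⌉≡n)
open import Data.Nat.Properties
open import Data.Nat.Tactic.RingSolver using (solve-∀)
open import Data.Product using (Σ; Σ-syntax; ∃-syntax; _×_; _,_; proj₁; proj₂)
open import Data.Rational as ℚ using (1ℚ)
import Data.Rational.Properties as ℚ
open import Data.Rational.Unnormalised as ℚᵘ using (mkℚᵘ; *≤*)
import Data.Rational.Unnormalised.Properties as ℚᵘ
open import Data.Sum using (_⊎_; inj₁; inj₂)
open import Data.Unit using (tt)
open import Data.Vec as Vec using (Vec; []; _∷_; lookup; toList; transpose; concat)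
import Data.Vec.Properties as Vec
open import Function using (_∘_; case_of_; Equivalence)
open import Relation.Binary.PropositionalEquality hiding ([_]; J)
open import Relation.Nullary using (Dec; yes; no; does)
open import Relation.Nullary.Decidable using (toWitness; dec-true)

bit≤1 : ∀ b → bit b ≤ 1
bit≤1 true  = ≤-refl
bit≤1 false = z≤n

≡ᵇ-refl : ∀ n → (n ≡ᵇ n) ≡ true
≡ᵇ-refl zero    = refl
≡ᵇ-refl (suc n) = ≡ᵇ-refl n

≢⇒≡ᵇ : ∀ {m n} → m ≢ n → (m ≡ᵇ n) ≡ false
≢⇒≡ᵇ {zero}  {zero}  m≢n = ⊥-elim (m≢n refl)
≢⇒≡ᵇ {zero}  {suc n} m≢n = refl
≢⇒≡ᵇ {suc m} {zero}  m≢n = refl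
≢⇒≡ᵇ {suc m} {suc n} m≢n = ≢⇒≡ᵇ (m≢n ∘ cong suc)

≔-same : ∀ f a {v} → (f [ a ≔ v ]) a ≡ v
≔-same f a rewrite ≡ᵇ-refl a = refl

≔-other : ∀ f {a b} {v} → b ≢ a → (f [ a ≔ v ]) b ≡ f b
≔-other f b≢a rewrite ≢⇒≡ᵇ b≢a = refl

-- A loop language over unbounded natural numbers

-- Index y of array a < 16 is the memory word at address 16 y + a; raw reads the
-- word at a given address.
data Expr : Set where
  var : ℕ → Expr
  lit : ℕ → Expr
  op  : Op → Expr → Expr → Expr
  rd  : ℕ → Expr → Expr
  raw : Expr → Expr

infixl 6 _⊕_ _⊖_
infixl 7 _⊛_
pattern _⊕_ a b = op add a b
pattern _⊖_ a b = op sub a b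
pattern _⊛_ a b = op mul a b

infix  4 _:=_
infixr 3 _⨾_

data Cmd : Set where
  skip : Cmd
  _:=_ : ℕ → Expr → Cmd
  wr   : ℕ → Expr → Expr → Cmd
  flp  : ℕ → Cmd
  _⨾_  : Cmd → Cmd → Cmd
  ifz  : Expr → Cmd → Cmd → Cmd
  for  : ℕ → Expr → Cmd → Cmd

record Env : Set where
  constructor env
  field
    V  : ℕ → ℕ
    A  : ℕ → ℕ → ℕ
    ωs : List Bool

open Env public

setA : (ℕ → ℕ → ℕ) → ℕ → ℕ → ℕ → (ℕ → ℕ → ℕ)
setA f a i v b = if b ≡ᵇ a then f a [ i ≔ v ] else f b

evalOpℕ : Op → ℕ → ℕ → ℕ
evalOpℕ add x y       = x + y
evalOpℕ sub x y       = x ∸ y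
evalOpℕ mul x y       = x * y
evalOpℕ div x zero    = 0
evalOpℕ div x (suc y) = x / suc y

evalE : Expr → Env → ℕ
evalE (var x)    σ = V σ x
evalE (lit c)    σ = c
evalE (op o a b) σ = evalOpℕ o (evalE a σ) (evalE b σ)
evalE (rd a e)   σ = A σ a (evalE e σ)
evalE (raw e)    σ = A σ (evalE e σ % 16) (evalE e σ / 16)

setV : ℕ → ℕ → Env → Env
setV x v (env R M ω) = env (R [ x ≔ v ]) M ω

headBit : List Bool → ℕ
headBit []      = 0
headBit (b ∷ _) = bit b

loop : (Env → Env) → ℕ → ℕ → ℕ → Env → Env
loop f x i zero    σ = σ
loop f x i (suc n) σ = loop f x (suc i) n (f (setV x i σ))

run : Cmd → Env → Env
run skip        σ = σ
run (x := e)    σ = setV x (evalE e σ) σ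
run (wr a i e)  σ = env (V σ) (setA (A σ) a (evalE i σ) (evalE e σ)) (ωs σ)
run (flp x)     σ = env (V σ [ x ≔ headBit (ωs σ) ]) (A σ) (List.drop 1 (ωs σ))
run (c ⨾ d)     σ = run d (run c σ)
run (ifz e c d) σ = if evalE e σ ≡ᵇ 0 then run c σ else run d σ
run (for x e c) σ = loop (run c) x 0 (evalE e σ) σ

lenE : Expr → ℕ
lenE (var x)    = 2
lenE (lit c)    = 1
lenE (op o a b) = lenE a + lenE b + 1
lenE (rd a e)   = lenE e + 5
lenE (raw e)    = lenE e + 1

loopCost : (Env → Env) → (Env → ℕ) → ℕ → ℕ → ℕ → Env → ℕ
loopCost f g x i zero    σ = 0
loopCost f g x i (suc n) σ = g (setV x i σ) + 7 + loopCost f g x (suc i) n (f (setV x i σ))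

cost : Cmd → Env → ℕ
cost skip        σ = 0
cost (x := e)    σ = lenE e + 2
cost (wr a i e)  σ = lenE i + lenE e + 5
cost (flp x)     σ = 1
cost (c ⨾ d)     σ = cost c σ + cost d (run c σ)
cost (ifz e c d) σ = lenE e + 2 + (if evalE e σ ≡ᵇ 0 then cost c σ else cost d σ)
cost (for x e c) σ = lenE e + 2 + loopCost (run c) (cost c) x 0 (evalE e σ) σ

-- A size discipline that rules out overflow

-- "small d" stands for values at most B ^ d, and "large n" for values at
-- most W + n * G, where W bounds all words of the current state.
data Size : Set where
  small large : ℕ → Size

record Ctx : Set where
  field
    varSize arrSize : ℕ → Size
    maxDeg          : ℕ
    coinFlips       : Bool

data _⊑_ : Size → Size → Set where
  s⊑s : ∀ {d e} → d ≤ e → small d ⊑ small e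
  s⊑l : ∀ {d n} → small d ⊑ large n
  l⊑l : ∀ {m n} → large m ⊑ large n

_⊑?_ : ∀ s t → Maybe (s ⊑ t)
small d ⊑? small e with d ≤? e
... | yes p = just (s⊑s p)
... | no  _ = nothing
small d ⊑? large n = just s⊑l
large m ⊑? small e = nothing
large m ⊑? large n = just l⊑l

module Typing (Γ : Ctx) where
  open Ctx Γ

  data ⊢ₑ_∶_ : Expr → Size → Set where
    tvar  : ∀ {x} → x < 32 → ⊢ₑ var x ∶ varSize x
    tlit  : ∀ {c} → c ≤ 16 → 1 ≤ maxDeg → ⊢ₑ lit c ∶ small 1
    tadd  : ∀ {a b i j} → ⊢ₑ a ∶ small i → ⊢ₑ b ∶ small j → suc (i ⊔ j) ≤ maxDeg →
            ⊢ₑ a ⊕ b ∶ small (suc (i ⊔ j))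
    taddL : ∀ {a b n j} → ⊢ₑ a ∶ large n → ⊢ₑ b ∶ small j → ⊢ₑ a ⊕ b ∶ large (suc n)
    tmul  : ∀ {a b i j} → ⊢ₑ a ∶ small i → ⊢ₑ b ∶ small j → i + j ≤ maxDeg →
            ⊢ₑ a ⊛ b ∶ small (i + j)
    tsub  : ∀ {a b s t} → ⊢ₑ a ∶ s → ⊢ₑ b ∶ t → ⊢ₑ a ⊖ b ∶ s
    tdiv  : ∀ {a b s t} → ⊢ₑ a ∶ s → ⊢ₑ b ∶ t → ⊢ₑ op div a b ∶ s
    trd   : ∀ {a e i} → a < 16 → ⊢ₑ e ∶ small i → ⊢ₑ rd a e ∶ arrSize a
    traw  : ∀ {e i} → ⊢ₑ e ∶ small i → ⊢ₑ raw e ∶ large 0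

  data ⊢_ : Cmd → Set where
    tskip : ⊢ skip
    tset  : ∀ {x e s} → x < 32 → ⊢ₑ e ∶ s → s ⊑ varSize x → ⊢ (x := e)
    twr   : ∀ {a i e d s} → a < 16 → ⊢ₑ i ∶ small d → ⊢ₑ e ∶ s → s ⊑ arrSize a →
            ⊢ wr a i e
    tflp  : ∀ {x} → x < 32 → coinFlips ≡ true → ⊢ flp x
    tseq  : ∀ {c d} → ⊢ c → ⊢ d → ⊢ (c ⨾ d)
    tifz  : ∀ {e s c d} → ⊢ₑ e ∶ s → ⊢ c → ⊢ d → ⊢ ifz e c d
    tfor  : ∀ {x e d c} → x < 32 → ⊢ₑ e ∶ small d → small d ⊑ varSize x → ⊢ c →
            ⊢ for x e c

  dec : ∀ {P : Set} → Dec P → Maybe P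
  dec (yes p) = just p
  dec (no  _) = nothing

  inferE : ∀ e → Maybe (Σ Size (⊢ₑ e ∶_))
  inferE (var x) = dec (x <? 32) >>= λ p → just (_ , tvar p)
  inferE (lit c) = dec (c ≤? 16) >>= λ p → dec (1 ≤? maxDeg) >>= λ q → just (_ , tlit p q)
  inferE (a ⊕ b) with inferE a | inferE b
  ... | just (small i , p) | just (small j , q) =
        dec (suc (i ⊔ j) ≤? maxDeg) >>= λ r → just (_ , tadd p q r)
  ... | just (large n , p) | just (small j , q) = just (_ , taddL p q)
  ... | _                  | _                  = nothing
  inferE (a ⊛ b) with inferE a | inferE b
  ... | just (small i , p) | just (small j , q) =
        dec (i + j ≤? maxDeg) >>= λ r → just (_ , tmul p q r)
  ... | _                  | _                  = nothing
  inferE (a ⊖ b) = inferE a >>= λ (_ , p) → inferE b >>= λ (_ , q) → just (_ , tsub p q)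
  inferE (op div a b) = inferE a >>= λ (_ , p) → inferE b >>= λ (_ , q) → just (_ , tdiv p q)
  inferE (rd a e) with inferE e
  ... | just (small i , p) = dec (a <? 16) >>= λ q → just (_ , trd q p)
  ... | _                  = nothing
  inferE (raw e) with inferE e
  ... | just (small i , p) = just (_ , traw p)
  ... | _                  = nothing

  infer : ∀ c → Maybe (⊢ c)
  infer skip       = just tskip
  infer (x := e)    = dec (x <? 32) >>= λ p → inferE e >>= λ (s , q) →
                     (s ⊑? varSize x) >>= λ r → just (tset p q r)
  infer (wr a i e) with inferE i | inferE e
  ... | just (small d , p) | just (s , q) =
        dec (a <? 16) >>= λ r → (s ⊑? arrSize a) >>= λ t → just (twr r p q t)
  ... | _                  | _            = nothing
  infer (flp x)    with coinFlips in eq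
  ... | true  = dec (x <? 32) >>= λ p → just (tflp p eq)
  ... | false = nothing
  infer (c ⨾ d)    = infer c >>= λ p → infer d >>= λ q → just (tseq p q)
  infer (ifz e c d) = inferE e >>= λ (_ , p) → infer c >>= λ q → infer d >>= λ r →
                      just (tifz p q r)
  infer (for x e c) with inferE e
  ... | just (small d , p) = dec (x <? 32) >>= λ q → (small d ⊑? varSize x) >>= λ r →
                             infer c >>= λ s → just (tfor q p r s)
  ... | _                  = nothing

  module Bounds (B : ℕ) (16≤B : 16 ≤ B) where

    G : ℕ
    G = B ^ maxDeg

    Fits : ℕ → Size → ℕ → Set
    Fits W (small d) v = v ≤ B ^ d × d ≤ maxDeg
    Fits W (large n) v = v ≤ W + n * G

    record Bounded (W : ℕ) (σ : Env) : Set where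
      field
        var-fits : ∀ x → Fits W (varSize x) (V σ x)
        arr-fits : ∀ a y → Fits W (arrSize a) (A σ a y)
        32G≤W    : 32 * G ≤ W

    open Bounded public

    instance
      B≢0 : NonZero B
      B≢0 = >-nonZero (≤-trans (s≤s z≤n) 16≤B)

    1≤B^ : ∀ d → 1 ≤ B ^ d
    1≤B^ d = >-nonZero⁻¹ (B ^ d) {{m^n≢0 B d}}

    count : Size → ℕ
    count (small _) = 0
    count (large n) = n

    declared : Size → Set
    declared s = count s ≡ 0

    fits-grow : ∀ {W s v} → Fits W s v → ∀ W' → W ≤ W' → Fits W' s v
    fits-grow {s = small d} f W' _ = f
    fits-grow {s = large n} f W' p = ≤-trans f (+-monoˡ-≤ (n * G) p)

    fits-⊑ : ∀ {W s t v} k → 32 * G ≤ W → s ⊑ t → declared t → count s ≤ k →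
             Fits W t 0 → Fits W s v → Fits (W + k * G) t v
    fits-⊑ k _ (s⊑s d≤e) _ _ (_ , e≤) (v≤ , _) = ≤-trans v≤ (^-monoʳ-≤ B d≤e) , e≤
    fits-⊑ {W} k 32G≤W s⊑l dt _ _ (v≤ , d≤) rewrite dt | +-identityʳ (W + k * G) =
      ≤-trans v≤ (≤-trans (^-monoʳ-≤ B d≤) (≤-trans (m≤n*m G 32)
        (≤-trans 32G≤W (m≤m+n W (k * G)))))
    fits-⊑ {W} k _ l⊑l dt n≤k _ v≤ rewrite dt | +-identityʳ (W + k * G) =
      ≤-trans v≤ (+-monoʳ-≤ W (*-monoˡ-≤ G n≤k))

    word : ∀ {W s v} → 32 * G ≤ W → Fits W s v → v ≤ W + count s * G
    word {W} {small d} 32G≤W (v≤ , d≤) = ≤-trans v≤ (≤-trans (^-monoʳ-≤ B d≤)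
      (≤-trans (m≤n*m G 32) (≤-trans 32G≤W (m≤m+n W 0))))
    word {W} {large n} _ v≤ = v≤

    evalOpℕ-div≤ : ∀ x y → evalOpℕ div x y ≤ x
    evalOpℕ-div≤ x zero    = z≤n
    evalOpℕ-div≤ x (suc y) = m/n≤m x (suc y)

    fits-≤ : ∀ {W s v u} → u ≤ v → Fits W s v → Fits W s u
    fits-≤ {s = small d} p (v≤ , d≤) = ≤-trans p v≤ , d≤
    fits-≤ {s = large n} p v≤        = ≤-trans p v≤

    Declared : Set
    Declared = (∀ x → declared (varSize x)) × (∀ a → declared (arrSize a))

    module _ (decl : Declared) where

      m+m≤B*m : ∀ m → m + m ≤ B * m
      m+m≤B*m m = ≤-trans (≤-reflexive (cong (m +_) (sym (+-identityʳ m))))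
                          (*-monoˡ-≤ m (≤-trans (s≤s (s≤s z≤n)) 16≤B))

      evalE-fits : ∀ {W σ e s} → Bounded W σ → ⊢ₑ e ∶ s → Fits W s (evalE e σ)
      evalE-fits bd (tvar {x} _) = var-fits bd x
      evalE-fits bd (tlit c≤16 1≤D) =
        ≤-trans c≤16 (≤-trans 16≤B (≤-reflexive (sym (*-identityʳ B)))) , 1≤D
      evalE-fits bd (tadd {i = i} {j} p q r) =
        ≤-trans (+-mono-≤
          (≤-trans (proj₁ (evalE-fits bd p)) (^-monoʳ-≤ B (m≤m⊔n i j)))
          (≤-trans (proj₁ (evalE-fits bd q)) (^-monoʳ-≤ B (m≤n⊔m i j))))
          (m+m≤B*m (B ^ (i ⊔ j))) , r
      evalE-fits {W} bd (taddL {n = n} p q) =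
        ≤-trans (+-mono-≤ (evalE-fits bd p)
          (≤-trans (proj₁ (evalE-fits bd q)) (^-monoʳ-≤ B (proj₂ (evalE-fits bd q)))))
          (≤-reflexive (trans (+-assoc W (n * G) G) (cong (W +_) (+-comm (n * G) G))))
      evalE-fits bd (tmul {i = i} {j} p q r) =
        ≤-trans (*-mono-≤ (proj₁ (evalE-fits bd p)) (proj₁ (evalE-fits bd q)))
          (≤-reflexive (sym (^-distribˡ-+-* B i j))) , r
      evalE-fits {σ = σ} bd (tsub {a} {b} p q) = fits-≤ (m∸n≤m _ (evalE b σ)) (evalE-fits bd p)
      evalE-fits {σ = σ} bd (tdiv {a} {b} p q) =
        fits-≤ (evalOpℕ-div≤ _ (evalE b σ)) (evalE-fits bd p)
      evalE-fits {σ = σ} bd (trd {a} {e} _ p) = arr-fits bd a (evalE e σ)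
      evalE-fits {W} {σ} bd (traw {e} p) = ≤-trans
        (word (32G≤W bd) (arr-fits bd (evalE e σ % 16) (evalE e σ / 16)))
        (≤-reflexive (cong (λ n → W + n * G) (proj₂ decl _)))

      count≤lenE : ∀ {e s} → ⊢ₑ e ∶ s → count s ≤ lenE e
      count≤lenE (tvar {x} _)    = subst (_≤ 2) (sym (proj₁ decl x)) z≤n
      count≤lenE (tlit _ _)      = z≤n
      count≤lenE (tadd _ _ _)    = z≤n
      count≤lenE (taddL {a} {b} p q) = ≤-trans (s≤s (≤-trans (count≤lenE p) (m≤m+n (lenE a) (lenE b))))
                                       (≤-reflexive (+-comm 1 _))
      count≤lenE (tmul _ _ _)    = z≤n
      count≤lenE (tsub {a} {b} p q) = ≤-trans (count≤lenE p) (≤-trans (m≤m+n (lenE a) (lenE b)) (m≤m+n _ 1))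
      count≤lenE (tdiv {a} {b} p q) = ≤-trans (count≤lenE p) (≤-trans (m≤m+n (lenE a) (lenE b)) (m≤m+n _ 1))
      count≤lenE (trd {a} _ _)   = subst (_≤ _) (sym (proj₂ decl a)) z≤n
      count≤lenE (traw _)        = z≤n

      evalE-word : ∀ {W σ e s} → Bounded W σ → ⊢ₑ e ∶ s → evalE e σ ≤ W + lenE e * G
      evalE-word {W} bd p = ≤-trans (word (32G≤W bd) (evalE-fits bd p))
        (+-monoʳ-≤ W (*-monoˡ-≤ G (count≤lenE p)))

      fits-0 : ∀ {W s v} → Fits W s v → Fits W s 0
      fits-0 = fits-≤ z≤n

      set-bounded : ∀ {W σ x v} W' → W ≤ W' → Bounded W σ → Fits W' (varSize x) v →
                    Bounded W' (setV x v σ)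
      set-bounded {σ = env R M ω} {x} {v} W' W≤ bd f = record
        { var-fits = vf ; arr-fits = λ a y → fits-grow (arr-fits bd a y) W' W≤
        ; 32G≤W = ≤-trans (32G≤W bd) W≤ }
        where
        vf : ∀ y → Fits W' (varSize y) ((R [ x ≔ v ]) y)
        vf y with y ≟ x
        ... | yes refl rewrite ≡ᵇ-refl x = f
        ... | no y≢x rewrite ≢⇒≡ᵇ y≢x = fits-grow (var-fits bd y) W' W≤

      coins-bounded : ∀ {W R M ω ω'} → Bounded W (env R M ω) → Bounded W (env R M ω')
      coins-bounded bd = record { var-fits = var-fits bd ; arr-fits = arr-fits bd ; 32G≤W = 32G≤W bd }

      grow : ∀ {W W' σ} → W ≤ W' → Bounded W σ → Bounded W' σ
      grow {W' = W'} W≤ bd = record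
        { var-fits = λ x → fits-grow (var-fits bd x) W' W≤
        ; arr-fits = λ a y → fits-grow (arr-fits bd a y) W' W≤
        ; 32G≤W = ≤-trans (32G≤W bd) W≤ }

      split-cost : ∀ {W} m n → W + m * G + n * G ≡ W + (m + n) * G
      split-cost {W} m n = trans (+-assoc W _ _) (cong (W +_) (sym (*-distribʳ-+ G m n)))

      fits-1 : ∀ {W s v} → declared s → 32 * G ≤ W → Fits W s v → ∀ b → Fits W s (bit b)
      fits-1 {s = small d} _ _ (_ , d≤) b = ≤-trans (bit≤1 b) (1≤B^ d) , d≤
      fits-1 {W} {large n} _ 32G≤W _ b = ≤-trans (bit≤1 b)
        (≤-trans (≤-trans (1≤B^ maxDeg) (m≤n*m G 32)) (≤-trans 32G≤W (m≤m+n W (n * G))))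

      headBit-fits : ∀ {W s v} → declared s → 32 * G ≤ W → Fits W s v → ∀ ω → Fits W s (headBit ω)
      headBit-fits ds g f []      = fits-0 f
      headBit-fits ds g f (b ∷ ω) = fits-1 ds g f b

      counter-fits : ∀ {W σ x e d i} → Bounded W σ → ⊢ₑ e ∶ small d → small d ⊑ varSize x →
                     i ≤ evalE e σ → Fits W (varSize x) i
      counter-fits {W} {σ} {x} bd te s i≤ =
        subst (λ U → Fits U (varSize x) _) (+-identityʳ W)
          (fits-⊑ {s = small _} 0 (32G≤W bd) s (proj₁ decl x) z≤n (fits-0 {W} {varSize x} (var-fits bd x))
            (fits-≤ {W} {small _} i≤ (evalE-fits bd te)))

      run-bounded  : ∀ {W σ c} → ⊢ c → Bounded W σ → Bounded (W + cost c σ * G) (run c σ)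
      loop-bounded : ∀ {W σ c x} → ⊢ c → ∀ i n → Bounded W σ →
                     (∀ {U} j → j ≤ i + n → W ≤ U → Fits U (varSize x) j) →
                     Bounded (W + loopCost (run c) (cost c) x i n σ * G) (loop (run c) x i n σ)
      run-bounded {W} {σ} tskip bd = grow (m≤m+n W 0) bd
      run-bounded {W} {σ} (tset {x} {e} _ te s) bd =
        set-bounded _ (m≤m+n W _) bd
          (fits-⊑ (lenE e + 2) (32G≤W bd) s (proj₁ decl x)
            (≤-trans (count≤lenE te) (m≤m+n (lenE e) 2)) (fits-0 (var-fits bd x)) (evalE-fits bd te))
      run-bounded {W} {σ@(env R M ω)} (twr {a} {i} {e} {s = s} _ ti te st) bd = record
        { var-fits = λ x → fits-grow (var-fits bd x) _ (m≤m+n W _)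
        ; arr-fits = af
        ; 32G≤W = ≤-trans (32G≤W bd) (m≤m+n W _) }
        where
        af : ∀ b y → Fits (W + (lenE i + lenE e + 5) * G) (arrSize b) (setA M a (evalE i σ) (evalE e σ) b y)
        af b y with b ≟ a
        ... | no b≢a rewrite ≢⇒≡ᵇ b≢a = fits-grow (arr-fits bd b y) _ (m≤m+n W _)
        ... | yes refl rewrite ≡ᵇ-refl b with y ≟ evalE i σ
        ...   | no y≢i rewrite ≢⇒≡ᵇ y≢i = fits-grow (arr-fits bd b y) _ (m≤m+n W _)
        ...   | yes refl rewrite ≡ᵇ-refl y =
                fits-⊑ (lenE i + lenE e + 5) (32G≤W bd) st (proj₂ decl b)
                  (≤-trans (count≤lenE te) (≤-trans (m≤n+m (lenE e) (lenE i)) (m≤m+n _ 5)))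
                  (fits-0 (arr-fits bd b 0)) (evalE-fits bd te)
      run-bounded {W} {σ@(env R M ω)} (tflp {x} _ _) bd =
        grow (m≤m+n W _) (set-bounded {σ = env R M (List.drop 1 ω)} W ≤-refl (coins-bounded bd)
          (headBit-fits (proj₁ decl x) (32G≤W bd) (var-fits bd x) ω))
      run-bounded {W} {σ} (tseq {c} {d} tc td) bd =
        subst (λ U → Bounded U (run d (run c σ))) (split-cost {W} (cost c σ) (cost d (run c σ)))
          (run-bounded td (run-bounded tc bd))
      run-bounded {W} {σ} (tifz {e} {_} {c} {d} te tc td) bd with evalE e σ ≡ᵇ 0
      ... | true  = grow (+-monoʳ-≤ W (*-monoˡ-≤ G (m≤n+m (cost c σ) (lenE e + 2)))) (run-bounded tc bd)
      ... | false = grow (+-monoʳ-≤ W (*-monoˡ-≤ G (m≤n+m (cost d σ) (lenE e + 2)))) (run-bounded td bd)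
      run-bounded {W} {σ} (tfor {x} {e} {d} {c} _ te s tc) bd =
        grow (+-monoʳ-≤ W (*-monoˡ-≤ G (m≤n+m _ (lenE e + 2))))
          (loop-bounded tc 0 (evalE e σ) bd
            (λ {U} j j≤ W≤ → fits-grow {W} {varSize x} (counter-fits {σ = σ} {e = e} bd te s j≤) U W≤))
      loop-bounded {W} tc i zero bd f = grow (m≤m+n W 0) bd
      loop-bounded {W} {σ} {c} {x} tc i (suc n) bd f =
        subst (λ U → Bounded U (loop (run c) x i (suc n) σ)) (split-cost (cost c σ' + 7) _)
          (loop-bounded tc (suc i) n
            (grow (+-monoʳ-≤ W (*-monoˡ-≤ G (m≤m+n (cost c σ') 7)))
              (run-bounded tc (set-bounded W ≤-refl bd (f i (m≤m+n i (suc n)) ≤-refl))))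
            (λ j j≤ W≤ → f j (≤-trans j≤ (≤-reflexive (sym (+-suc i n)))) (≤-trans (m≤m+n W _) W≤)))
        where σ' = setV x i σ

-- Compilation to the RAM

-- Registers below 32 hold the variables; expression temporaries and loop
-- counters live in the registers from 32 on, allocated as a stack whose
-- height is the argument k below.
H : ℕ → ℕ
H k = 32 + k

addrCode : ℕ → ℕ → List Instr
addrCode k a = const (H (suc k)) 16 ∷ arith mul (H k) (H k) (H (suc k))
             ∷ const (H (suc k)) a ∷ arith add (H k) (H k) (H (suc k)) ∷ []

compE : ℕ → Expr → List Instr
compE k (var x)    = const (H (suc k)) 0 ∷ arith add (H k) x (H (suc k)) ∷ []
compE k (lit c)    = const (H k) c ∷ []
compE k (op o a b) = (compE k a ++ compE (suc k) b) ++ arith o (H k) (H k) (H (suc k)) ∷ []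
compE k (rd a e)   = compE k e ++ (addrCode k a ++ load (H k) (H k) ∷ [])
compE k (raw e)    = compE k e ++ load (H k) (H k) ∷ []

lenC : Cmd → ℕ
lenC skip        = 0
lenC (x := e)    = lenE e + 2
lenC (wr a i e)  = (lenE i + 4) + (lenE e + 1)
lenC (flp x)     = 1
lenC (c ⨾ d)     = lenC c + lenC d
lenC (ifz e c d) = lenE e + suc (lenC d + suc (lenC c))
lenC (for x e c) = lenE e + (1 + (3 + (lenC c + 4)))

compC : ℕ → ℕ → Cmd → List Instr
compC b k skip        = []
compC b k (x := e)    = compE k e ++ const (H (suc k)) 0 ∷ arith add x (H k) (H (suc k)) ∷ []
compC b k (wr a i e)  = (compE k i ++ addrCode k a) ++ (compE (suc k) e ++ store (H k) (H (suc k)) ∷ [])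
compC b k (flp x)     = flip x ∷ []
compC b k (c ⨾ d)     = compC b k c ++ compC (b + lenC c) k d
compC b k (ifz e c d) =
  compE k e ++ jzero (H k) (suc else' + lenC d)
  ∷ (compC else' k d ++ jump (suc (else' + lenC d) + lenC c) ∷ compC (suc (else' + lenC d)) k c)
  where else' = suc (b + lenE e)
compC b k (for x e c) =
  compE k e ++ const (H (suc k)) 0 ∷ jzero (H k) (3 + top + lenC c + 4)
  ∷ const (H (2 + k)) 0 ∷ arith add x (H (suc k)) (H (2 + k))
  ∷ (compC (3 + top) (2 + k) c ++
     const (H (2 + k)) 1 ∷ arith add (H (suc k)) (H (suc k)) (H (2 + k))
     ∷ arith sub (H k) (H k) (H (2 + k)) ∷ jump top ∷ [])
  where top = suc (b + lenE e)

length-compE : ∀ k e → length (compE k e) ≡ lenE e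
length-compE k (var x)    = refl
length-compE k (lit c)    = refl
length-compE k (op o a b) = trans (List.length-++ (compE k a ++ compE (suc k) b))
  (cong (_+ 1) (trans (List.length-++ (compE k a)) (cong₂ _+_ (length-compE k a) (length-compE (suc k) b))))
length-compE k (rd a e)   = trans (List.length-++ (compE k e)) (cong (_+ 5) (length-compE k e))
length-compE k (raw e)    = trans (List.length-++ (compE k e)) (cong (_+ 1) (length-compE k e))

length-compC : ∀ b k c → length (compC b k c) ≡ lenC c
length-compC b k skip        = refl
length-compC b k (x := e)    = trans (List.length-++ (compE k e)) (cong (_+ 2) (length-compE k e))
length-compC b k (wr a i e)  = trans (List.length-++ (compE k i ++ addrCode k a))
  (cong₂ _+_ (trans (List.length-++ (compE k i)) (cong (_+ 4) (length-compE k i)))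
             (trans (List.length-++ (compE (suc k) e)) (cong (_+ 1) (length-compE (suc k) e))))
length-compC b k (flp x)     = refl
length-compC b k (c ⨾ d)     = trans (List.length-++ (compC b k c))
  (cong₂ _+_ (length-compC b k c) (length-compC (b + lenC c) k d))
length-compC b k (ifz e c d) = trans (List.length-++ (compE k e))
  (cong₂ (λ m n → m + suc n) (length-compE k e)
    (trans (List.length-++ (compC _ k d))
      (cong₂ (λ m n → m + suc n) (length-compC _ k d) (length-compC _ k c))))
length-compC b k (for x e c) = trans (List.length-++ (compE k e))
  (cong₂ (λ m n → m + (4 + n)) (length-compE k e)
    (trans (List.length-++ (compC _ (2 + k) c)) (cong (_+ 4) (length-compC _ (2 + k) c))))

fetch : Program → ℕ → Maybe Instr
fetch P n = List.head (List.drop n P)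

data At (P : Program) : ℕ → List Instr → Set where
  []  : ∀ {b} → At P b []
  _∷_ : ∀ {b i is} → fetch P b ≡ just i → At P (suc b) is → At P b (i ∷ is)

At-++ˡ : ∀ {P b} xs {ys} → At P b (xs ++ ys) → At P b xs
At-++ˡ []       a       = []
At-++ˡ (x ∷ xs) (f ∷ a) = f ∷ At-++ˡ xs a

At-++ʳ : ∀ {P b} xs {ys n} → length xs ≡ n → At P b (xs ++ ys) → At P (b + n) ys
At-++ʳ {P} {b} []       {ys} refl a  = subst (λ c → At P c ys) (sym (+-identityʳ b)) a
At-++ʳ {P} {b} (x ∷ xs) {ys} refl (f ∷ a) =
  subst (λ c → At P c ys) (sym (+-suc b (length xs))) (At-++ʳ xs refl a)

drop-++ : ∀ {A : Set} (xs ys : List A) → List.drop (length xs) (xs ++ ys) ≡ ys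
drop-++ []       ys = refl
drop-++ (x ∷ xs) ys = drop-++ xs ys

At-suffix : ∀ xs ys → At (xs ++ ys) (length xs) ys
At-suffix xs []       = []
At-suffix xs (y ∷ ys) = cong List.head (drop-++ xs (y ∷ ys))
  ∷ subst₂ (λ P n → At P n ys) (List.++-assoc xs (y ∷ []) ys)
      (trans (List.length-++ xs) (+-comm (length xs) 1)) (At-suffix (xs ++ y ∷ []) ys)

module Exec (w : ℕ) (P : Program) where

  infixr 5 _∙_ _++ₛ_

  data Steps : ℕ → State → State → Set where
    done : ∀ {s} → Steps 0 s s
    _∙_  : ∀ {n s s' s'' i} → (fetch P (pc s) ≡ just i) × (step w i s ≡ just s') →
           Steps n s' s'' → Steps (suc n) s s''

  _++ₛ_ : ∀ {m n s s' s''} → Steps m s s' → Steps n s' s'' → Steps (m + n) s s''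
  done     ++ₛ y = y
  (f ∙ x) ++ₛ y = f ∙ (x ++ₛ y)

  exec-halt : ∀ t s → fetch P (pc s) ≡ nothing → exec w P t s ≡ just s
  exec-halt t s eq with List.head (List.drop (pc s) P)
  exec-halt t s refl | nothing = refl

  exec-step : ∀ t s i → fetch P (pc s) ≡ just i → exec w P (suc t) s ≡ (step w i s >>= exec w P t)
  exec-step t s i eq with List.head (List.drop (pc s) P)
  exec-step t s i refl | just i = refl

  exec-steps : ∀ {n t s s'} → Steps n s s' → fetch P (pc s') ≡ nothing → n ≤ t →
               exec w P t s ≡ just s'
  exec-steps {s = s} done h _ = exec-halt _ s h
  exec-steps {s = s} (_∙_ {i = i} (f , e) x) h (s≤s n≤t) =
    trans (exec-step _ s i f) (trans (cong (_>>= exec w P _) e) (exec-steps x h n≤t))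

wrap-id : ∀ w {n} → n < 2 ^ w → wrap w n ≡ n
wrap-id w n< = m<n⇒m%n≡m {{m^n≢0 2 w}} n<

evalOp-id : ∀ w o x y → evalOpℕ o x y < 2 ^ w → evalOp w o x y ≡ evalOpℕ o x y
evalOp-id w add x y       b = wrap-id w b
evalOp-id w sub x y       b = refl
evalOp-id w mul x y       b = wrap-id w b
evalOp-id w div x zero    b = refl
evalOp-id w div x (suc y) b = refl

H≢ : ∀ {x} k → x < 32 → x ≢ H k
H≢ k x<32 refl = <⇒≱ x<32 (m≤m+n 32 k)

H-suc≢ : ∀ k → H k ≢ H (suc k)
H-suc≢ k eq = <⇒≢ ≤-refl (+-cancelˡ-≡ 32 k (suc k) eq)

addr-inj : ∀ {a b x y} → a < 16 → b < 16 → x * 16 + a ≡ y * 16 + b → x ≡ y × a ≡ b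
addr-inj {a} {b} {x} {y} a< b< eq = x≡y , a≡b
  where
  rem : ∀ x a → a < 16 → (x * 16 + a) % 16 ≡ a
  rem x a a< = trans (cong (_% 16) (+-comm (x * 16) a)) (trans ([m+kn]%n≡m%n a x 16) (m<n⇒m%n≡m a<))
  a≡b : a ≡ b
  a≡b = trans (sym (rem x a a<)) (trans (cong (_% 16) eq) (rem y b b<))
  x≡y : x ≡ y
  x≡y = *-cancelʳ-≡ x y 16 (+-cancelʳ-≡ b (x * 16) (y * 16) (trans (cong (x * 16 +_) (sym a≡b)) eq))

module Simulation (Γ : Ctx) (B : ℕ) (16≤B : 16 ≤ B)
                  (decl : Typing.Bounds.Declared Γ B 16≤B)
                  (w : ℕ) (P : Program) where
  open Ctx Γ
  open Typing Γ
  open Bounds B 16≤B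
  open Exec w P

  RelV : (ℕ → ℕ) → Env → Set
  RelV R σ = ∀ x → x < 32 → R x ≡ V σ x

  RelM : (ℕ → ℕ) → Env → Set
  RelM M σ = ∀ a y → a < 16 → M (y * 16 + a) ≡ A σ a y

  record Keeps (k : ℕ) (R R' : ℕ → ℕ) : Set where
    constructor keeps
    field kept : ∀ x → x < H k → R' x ≡ R x

  open Keeps

  keeps-set : ∀ {k R R' v} j → k ≤ j → Keeps k R R' → Keeps k R (R' [ H j ≔ v ])
  keeps-set {R' = R'} j k≤j kp = keeps λ x x< →
    trans (≔-other R' (<⇒≢ (<-≤-trans x< (+-monoʳ-≤ 32 k≤j)))) (kept kp x x<)

  keeps-V : ∀ {k R R' σ} → Keeps k R R' → RelV R σ → RelV R' σ
  keeps-V {k} kp rv x x< = trans (kept kp x (≤-trans x< (m≤m+n 32 k))) (rv x x<)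

  small-word : ∀ {W U} → 32 * G ≤ W → W + U < 2 ^ w → ∀ {n} → n ≤ 32 → n < 2 ^ w
  small-word {W} {U} g b {n} n≤ =
    ≤-<-trans n≤ (≤-<-trans (≤-trans (≤-trans (≤-reflexive (sym (*-identityʳ 32)))
      (*-monoʳ-≤ 32 (1≤B^ maxDeg))) g) (≤-<-trans (m≤m+n W U) b))

  addr-word : ∀ {W U} → 32 * G ≤ W → W + U < 2 ^ w → ∀ {y a} → y ≤ G → a < 16 →
              y * 16 + a < 2 ^ w
  addr-word {W} {U} g b {y} {a} y≤ a< = ≤-<-trans
    (≤-trans (+-mono-≤ (*-monoˡ-≤ 16 y≤) (≤-trans (<⇒≤ a<) (≤-trans (≤-reflexive (sym (*-identityʳ 16)))
      (*-monoʳ-≤ 16 (1≤B^ maxDeg)))))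
      (≤-trans (≤-reflexive (solve32 G)) g)) (≤-<-trans (m≤m+n W U) b)
    where solve32 : ∀ g → g * 16 + 16 * g ≡ 32 * g
          solve32 = solve-∀

  small-G : ∀ {W σ e d} → Bounded W σ → ⊢ₑ e ∶ small d → evalE e σ ≤ G
  small-G bd te = ≤-trans (proj₁ f) (^-monoʳ-≤ B (proj₂ f))
    where f = evalE-fits decl bd te

  pc-eq : ∀ {n s b b' R M ω} → b ≡ b' → Steps n s (mkState b R M ω) → Steps n s (mkState b' R M ω)
  pc-eq refl x = x

  steps-eq : ∀ {m n s s'} → m ≡ n → Steps m s s' → Steps n s s'
  steps-eq refl x = x

  SimE : ℕ → ℕ → ℕ → ℕ → (ℕ → ℕ) → (ℕ → ℕ) → List Bool → ℕ → Set
  SimE n b b' k R M ω v = Σ[ R' ∈ (ℕ → ℕ) ] Steps n (mkState b R M ω) (mkState b' R' M ω)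
                        × R' (H k) ≡ v × Keeps k R R'

  sim-addr : ∀ {W U a y b k R M ω} → 32 * G ≤ W → W + U < 2 ^ w → y ≤ G → a < 16 →
             At P b (addrCode k a) → R (H k) ≡ y →
             SimE 4 b (b + 4) k R M ω (y * 16 + a)
  sim-addr {W} {U} {a} {y} {b} {k} {R} {M} {ω} g bnd y≤ a< (f1 ∷ f2 ∷ f3 ∷ f4 ∷ []) Rk =
    R4 , pc-eq (trans (+-comm 4 b) refl) ((f1 , refl) ∙ (f2 , refl) ∙ (f3 , refl) ∙ (f4 , refl) ∙ done) , val
    , keeps-set k ≤-refl (keeps-set (suc k) (n≤1+n k) (keeps-set k ≤-refl (keeps-set (suc k) (n≤1+n k) (keeps λ _ _ → refl))))
    where
    R1 = R [ H (suc k) ≔ wrap w 16 ]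
    R2 = R1 [ H k ≔ wrap w (R1 (H k) * R1 (H (suc k))) ]
    R3 = R2 [ H (suc k) ≔ wrap w a ]
    R4 = R3 [ H k ≔ wrap w (R3 (H k) + R3 (H (suc k))) ]
    e2 : R2 (H k) ≡ y * 16
    e2 = trans (≔-same R1 (H k)) (trans (cong (wrap w)
           (cong₂ _*_ (trans (≔-other R {H (suc k)} {H k} (H-suc≢ k)) Rk)
             (trans (≔-same R (H (suc k))) (wrap-id w (small-word g bnd (m≤m+n 16 16))))))
           (wrap-id w (≤-<-trans (m≤m+n _ a) (addr-word g bnd y≤ a<))))
    val : R4 (H k) ≡ y * 16 + a
    val = trans (≔-same R3 (H k)) (trans (cong (wrap w)
            (cong₂ _+_ (trans (≔-other R2 {H (suc k)} {H k} (H-suc≢ k)) e2)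
              (trans (≔-same R2 (H (suc k))) (wrap-id w (small-word g bnd (≤-trans (<⇒≤ a<) (m≤m+n 16 16)))))))
            (wrap-id w (addr-word g bnd y≤ a<)))

  fewer : ∀ {W m n} → m ≤ n → W + n * G < 2 ^ w → W + m * G < 2 ^ w
  fewer {W} m≤n = ≤-<-trans (+-monoʳ-≤ W (*-monoˡ-≤ G m≤n))

  sim-op : ∀ {W σ o a a' s s' t k b R M} → ⊢ₑ a ∶ s → ⊢ₑ a' ∶ s' → ⊢ₑ op o a a' ∶ t → Bounded W σ →
           W + lenE (op o a a') * G < 2 ^ w → RelV R σ → RelM M σ → At P b (compE k (op o a a')) →
           SimE (lenE (op o a a')) b (b + lenE (op o a a')) k R M (ωs σ) (evalE (op o a a') σ)

  sim-E : ∀ {W σ e s b k R M} → ⊢ₑ e ∶ s → Bounded W σ → W + lenE e * G < 2 ^ w →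
          RelV R σ → RelM M σ → At P b (compE k e) →
          SimE (lenE e) b (b + lenE e) k R M (ωs σ) (evalE e σ)
  sim-E {σ = σ} {e} {b = b} {k} {R} (tvar {x} x<) bd W< rv rm (f1 ∷ f2 ∷ []) =
    _ , pc-eq (+-comm 2 b) ((f1 , refl) ∙ (f2 , refl) ∙ done)
    , trans (≔-same (R [ H (suc k) ≔ wrap w 0 ]) (H k)) (trans (cong (wrap w) (trans (cong₂ _+_
        (trans (≔-other R (H≢ (suc k) x<)) (rv x x<))
        (trans (≔-same R (H (suc k))) (wrap-id w (small-word (32G≤W bd) W< z≤n)))) (+-identityʳ _)))
        (wrap-id w (≤-<-trans (evalE-word decl bd (tvar x<)) W<)))
    , keeps-set k ≤-refl (keeps-set (suc k) (n≤1+n k) (keeps λ _ _ → refl))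
  sim-E {b = b} {k} {R} (tlit c≤ _) bd W< rv rm (f1 ∷ []) =
    _ , pc-eq (+-comm 1 b) ((f1 , refl) ∙ done)
    , trans (≔-same R (H k)) (wrap-id w (small-word (32G≤W bd) W< (≤-trans c≤ (m≤m+n 16 16))))
    , keeps-set k ≤-refl (keeps λ _ _ → refl)
  sim-E (tadd p q r)  bd W< rv rm at = sim-op p q (tadd p q r) bd W< rv rm at
  sim-E (taddL p q)   bd W< rv rm at = sim-op p q (taddL p q) bd W< rv rm at
  sim-E (tmul p q r)  bd W< rv rm at = sim-op p q (tmul p q r) bd W< rv rm at
  sim-E (tsub p q)    bd W< rv rm at = sim-op p q (tsub p q) bd W< rv rm at
  sim-E (tdiv p q)    bd W< rv rm at = sim-op p q (tdiv p q) bd W< rv rm at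
  sim-E {W} {σ} {b = b} {k} {M = M} (trd {a} {e} a< p) bd W< rv rm at
    with sim-E {M = M} p bd (fewer (m≤m+n (lenE e) 5) W<) rv rm (At-++ˡ (compE k e) at)
  ... | R₁ , st₁ , v₁ , kp₁
    with At-++ʳ (compE k e) (length-compE k e) at
  ... | at₂
    with sim-addr {M = M} (32G≤W bd) W< (small-G bd p) a< (At-++ˡ (addrCode k a) at₂) v₁ | At-++ʳ (addrCode k a) refl at₂
  ... | R₂ , st₂ , v₂ , kp₂ | f ∷ [] =
    _ , pc-eq (trans (+-comm 1 (b + lenE e + 4)) (trans (+-assoc (b + lenE e) 4 1) (+-assoc b (lenE e) 5)))
          (steps-eq (+-assoc (lenE e) 4 1) ((st₁ ++ₛ st₂) ++ₛ ((f , refl) ∙ done)))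
    , trans (≔-same R₂ (H k)) (trans (cong M v₂) (rm a (evalE e σ) a<))
    , keeps-set k ≤-refl (keeps λ x x< → trans (kept kp₂ x x<) (kept kp₁ x x<))
  sim-E {W} {σ} {b = b} {k} {M = M} (traw {e} p) bd W< rv rm at
    with sim-E {M = M} p bd (fewer (m≤m+n (lenE e) 1) W<) rv rm (At-++ˡ (compE k e) at)
  ... | R₁ , st₁ , v₁ , kp₁
    with At-++ʳ (compE k e) (length-compE k e) at
  ... | f ∷ [] =
    _ , pc-eq (trans (+-comm 1 (b + lenE e)) (+-assoc b (lenE e) 1)) (st₁ ++ₛ ((f , refl) ∙ done))
    , trans (≔-same R₁ (H k)) (trans (cong M (trans v₁ div-eq)) (rm (v % 16) (v / 16) (m%n<n v 16)))
    , keeps-set k ≤-refl kp₁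
    where
    v = evalE e σ
    div-eq : v ≡ v / 16 * 16 + v % 16
    div-eq = trans (m≡m%n+[m/n]*n v 16) (+-comm (v % 16) _)

  sim-op {W} {σ} {o} {a} {a'} {k = k} {b} {R} {M} p q pq bd W< rv rm at
    with sim-E {M = M} p bd (fewer (≤-trans (m≤m+n (lenE a) (lenE a')) (m≤m+n _ 1)) W<) rv rm
               (At-++ˡ (compE k a) (At-++ˡ (compE k a ++ compE (suc k) a') at))
  ... | R₁ , st₁ , v₁ , kp₁
    with sim-E {M = M} q bd (fewer (≤-trans (m≤n+m (lenE a') (lenE a)) (m≤m+n _ 1)) W<) (keeps-V {k = k} {σ = σ} kp₁ rv) rm
               (At-++ʳ (compE k a) (length-compE k a) (At-++ˡ (compE k a ++ compE (suc k) a') at))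
       | At-++ʳ (compE k a ++ compE (suc k) a') (trans (List.length-++ (compE k a))
           (cong₂ _+_ (length-compE k a) (length-compE (suc k) a'))) at
  ... | R₂ , st₂ , v₂ , kp₂ | f ∷ [] =
    _ , pc-eq (trans (+-comm 1 _) (+-assoc b (lenE a + lenE a') 1))
          ((pc-eq (+-assoc b (lenE a) (lenE a')) (st₁ ++ₛ st₂)) ++ₛ ((f , refl) ∙ done))
    , trans (≔-same R₂ (H k)) (trans (cong₂ (evalOp w o) (trans (kept kp₂ (H k) (≤-reflexive (sym (+-suc 32 k)))) v₁) v₂)
        (evalOp-id w o (evalE a σ) (evalE a' σ) (≤-<-trans (evalE-word decl bd pq) W<)))
    , keeps-set k ≤-refl (keeps λ x x< → trans (kept kp₂ x (≤-trans x< (+-monoʳ-≤ 32 (n≤1+n k)))) (kept kp₁ x x<))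

  record KeepsH (k : ℕ) (R R' : ℕ → ℕ) : Set where
    constructor keepsᴴ
    field keptH : ∀ j → j < k → R' (H j) ≡ R (H j)

  open KeepsH

  keepsH-refl : ∀ {k R} → KeepsH k R R
  keepsH-refl = keepsᴴ λ _ _ → refl

  keepsH : ∀ {k R R'} → Keeps k R R' → KeepsH k R R'
  keepsH kp = keepsᴴ λ j j< → kept kp (H j) (+-monoʳ-< 32 j<)

  keepsH-var : ∀ {k R R' x v} → x < 32 → KeepsH k R R' → KeepsH k R (R' [ x ≔ v ])
  keepsH-var {R' = R'} {x} x< kp = keepsᴴ λ j j< → trans (≔-other R' {x} {H j} (λ eq → H≢ j x< (sym eq))) (keptH kp j j<)

  keepsH-set : ∀ {k R R' v} j → k ≤ j → KeepsH k R R' → KeepsH k R (R' [ H j ≔ v ])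
  keepsH-set {R' = R'} j k≤j kp = keepsᴴ λ i i< →
    trans (≔-other R' (<⇒≢ (+-monoʳ-< 32 (<-≤-trans i< k≤j)))) (keptH kp i i<)

  keepsH-trans : ∀ {k R R' R''} → KeepsH k R R' → KeepsH k R' R'' → KeepsH k R R''
  keepsH-trans f g = keepsᴴ λ j j< → trans (keptH g j j<) (keptH f j j<)

  keepsH-≤ : ∀ {k l R R'} → k ≤ l → KeepsH l R R' → KeepsH k R R'
  keepsH-≤ k≤l f = keepsᴴ λ j j< → keptH f j (<-≤-trans j< k≤l)

  SimC : ℕ → ℕ → ℕ → ℕ → (ℕ → ℕ) → (ℕ → ℕ) → List Bool → Env → Set
  SimC c b b' k R M ω σ' = Σ[ n ∈ ℕ ] Σ[ R' ∈ (ℕ → ℕ) ] Σ[ M' ∈ (ℕ → ℕ) ]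
    n ≤ c × Steps n (mkState b R M ω) (mkState b' R' M' (ωs σ'))
    × RelV R' σ' × RelM M' σ' × KeepsH k R R'

  relV-set : ∀ {R σ x v} → RelV R σ → RelV (R [ x ≔ v ]) (setV x v σ)
  relV-set {x = x} rv y y< with y ≡ᵇ x
  ... | true  = refl
  ... | false = rv y y<

  relV-hid : ∀ {R σ j v} → RelV R σ → RelV (R [ H j ≔ v ]) σ
  relV-hid {R} {j = j} rv y y< = trans (≔-other R (H≢ j y<)) (rv y y<)

  relM-set : ∀ {M σ a y v} → a < 16 → RelM M σ →
             RelM (M [ y * 16 + a ≔ v ]) (env (V σ) (setA (A σ) a y v) (ωs σ))
  relM-set {M} {σ} {a} {y} {v} a< rm c z c< with c ≟ a
  ... | no c≢a rewrite ≢⇒≡ᵇ c≢a =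
        trans (≔-other M (c≢a ∘ proj₂ ∘ addr-inj {c} {a} {z} {y} c< a<)) (rm c z c<)
  ... | yes refl rewrite ≡ᵇ-refl c with z ≟ y
  ...   | yes refl rewrite ≡ᵇ-refl z = ≔-same M (z * 16 + c)
  ...   | no z≢y rewrite ≢⇒≡ᵇ z≢y =
          trans (≔-other M (z≢y ∘ proj₁ ∘ addr-inj {c} {c} {z} {y} c< c<)) (rm c z c<)

  FlipsOK : ℕ → Env → Set
  FlipsOK n σ = coinFlips ≡ true → n ≤ length (ωs σ)

  length-tail : ∀ (ω : List Bool) → length ω ≤ length (List.drop 1 ω) + 1
  length-tail []      = z≤n
  length-tail (b ∷ ω) = ≤-reflexive (+-comm 1 (length ω))

  run-coins  : ∀ c σ → length (ωs σ) ≤ length (ωs (run c σ)) + cost c σ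
  loop-coins : ∀ c x i n σ →
               length (ωs σ) ≤ length (ωs (loop (run c) x i n σ)) + loopCost (run c) (cost c) x i n σ
  run-coins skip        σ = m≤m+n _ 0
  run-coins (x := e)    σ = m≤m+n _ (lenE e + 2)
  run-coins (wr a i e)  σ = m≤m+n _ (lenE i + lenE e + 5)
  run-coins (flp x)     σ = length-tail (ωs σ)
  run-coins (c ⨾ d)     σ = ≤-trans (run-coins c σ) (≤-trans (+-monoˡ-≤ (cost c σ) (run-coins d (run c σ)))
    (≤-reflexive (trans (+-assoc (length (ωs (run d (run c σ)))) (cost d (run c σ)) (cost c σ)) (cong (length (ωs (run d (run c σ))) +_) (+-comm (cost d (run c σ)) _)))))
  run-coins (ifz e c d) σ with evalE e σ ≡ᵇ 0
  ... | true  = ≤-trans (run-coins c σ) (+-monoʳ-≤ (length (ωs (run c σ))) (m≤n+m _ (lenE e + 2)))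
  ... | false = ≤-trans (run-coins d σ) (+-monoʳ-≤ (length (ωs (run d σ))) (m≤n+m _ (lenE e + 2)))
  run-coins (for x e c) σ = ≤-trans (loop-coins c x 0 (evalE e σ) σ) (+-monoʳ-≤ (length (ωs (run (for x e c) σ))) (m≤n+m _ (lenE e + 2)))
  loop-coins c x i zero    σ = m≤m+n _ 0
  loop-coins c x i (suc n) σ =
    ≤-trans (run-coins c σ') (≤-trans (+-monoˡ-≤ (cost c σ') (loop-coins c x (suc i) n (run c σ')))
      (≤-trans (≤-reflexive (trans (+-assoc (length (ωs (loop (run c) x (suc i) n (run c σ')))) l (cost c σ')) (cong (length (ωs (loop (run c) x (suc i) n (run c σ'))) +_) (+-comm l _))))
        (+-monoʳ-≤ (length (ωs (loop (run c) x (suc i) n (run c σ')))) (+-monoˡ-≤ l (m≤m+n (cost c σ') 7)))))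
    where
    σ' = setV x i σ
    l = loopCost (run c) (cost c) x (suc i) n (run c σ')

  flips-after : ∀ {m n c σ} → cost c σ + n ≤ m → FlipsOK m σ → FlipsOK n (run c σ)
  flips-after {m} {n} {c} {σ} le fl eq = +-cancelˡ-≤ (cost c σ) _ _
    (≤-trans le (≤-trans (fl eq) (≤-trans (run-coins c σ) (≤-reflexive (+-comm _ (cost c σ))))))

  flips-≤ : ∀ {m n σ} → n ≤ m → FlipsOK m σ → FlipsOK n σ
  flips-≤ le fl eq = ≤-trans le (fl eq)

  jzero-step : ∀ {b k t v R M ω} → fetch P b ≡ just (jzero (H k) t) → R (H k) ≡ v →
               Steps 1 (mkState b R M ω) (mkState (if v ≡ᵇ 0 then t else suc b) R M ω)
  jzero-step {b} {k} {t} {R = R} {M} {ω} f eq =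
    (f , cong (λ z → just (mkState (if z ≡ᵇ 0 then t else suc b) R M ω)) eq) ∙ done

  later : ∀ {W m n l} → m + n ≤ l → W + l * G < 2 ^ w → (W + m * G) + n * G < 2 ^ w
  later {W} {m} {n} le = ≤-<-trans (≤-trans (≤-reflexive (split-cost decl m n)) (+-monoʳ-≤ W (*-monoˡ-≤ G le)))

  seq-steps : ∀ {m n c c' b b' k R M R' M' ω ω' σ} → m ≤ c → Steps m (mkState b R M ω) (mkState b' R' M' ω') →
              KeepsH k R R' → ∀ {b''} → SimC c' b' b'' k R' M' ω' σ → c + c' ≤ n →
              SimC n b b'' k R M ω σ
  seq-steps m≤ st kp (n' , R'' , M'' , n'≤ , st' , rv , rm , kp') le =
    _ , R'' , M'' , ≤-trans (+-mono-≤ m≤ n'≤) le , st ++ₛ st' , rv , rm , keepsH-trans kp kp'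

  sim-C : ∀ {W σ c b k R M} → ⊢ c → Bounded W σ → W + cost c σ * G < 2 ^ w → FlipsOK (cost c σ) σ →
          RelV R σ → RelM M σ → At P b (compC b k c) →
          SimC (cost c σ) b (b + lenC c) k R M (ωs σ) (run c σ)
  sim-loop : ∀ {W σ c x k R M} top i n → ⊢ c → x < 32 → Bounded W σ →
             (∀ {U} j → j ≤ i + n → W ≤ U → Fits U (varSize x) j) → i + n < 2 ^ w →
             W + loopCost (run c) (cost c) x i n σ * G < 2 ^ w →
             FlipsOK (loopCost (run c) (cost c) x i n σ) σ →
             RelV R σ → RelM M σ → R (H k) ≡ n → R (H (suc k)) ≡ i →
             At P top (jzero (H k) (3 + top + lenC c + 4)
               ∷ const (H (2 + k)) 0 ∷ arith add x (H (suc k)) (H (2 + k))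
               ∷ (compC (3 + top) (2 + k) c ++
                  const (H (2 + k)) 1 ∷ arith add (H (suc k)) (H (suc k)) (H (2 + k))
                  ∷ arith sub (H k) (H k) (H (2 + k)) ∷ jump top ∷ [])) →
             SimC (loopCost (run c) (cost c) x i n σ + 1) top (3 + top + lenC c + 4) k R M (ωs σ)
                  (loop (run c) x i n σ)
  sim-C {b = b} {R = R} {M} tskip bd W< fl rv rm at =
    0 , R , M , z≤n , pc-eq (sym (+-identityʳ b)) done , rv , rm , keepsH-refl
  sim-C {W} {σ} {b = b} {k} {R} {M} (tset {x} {e} x< te _) bd W< fl rv rm at
    with sim-E {M = M} te bd (fewer (m≤m+n (lenE e) 2) W<) rv rm (At-++ˡ (compE k e) at)
  ... | R₁ , st₁ , v₁ , kp₁
    with At-++ʳ (compE k e) (length-compE k e) at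
  ... | f ∷ f' ∷ [] =
    _ , _ , _ , ≤-refl
    , pc-eq (trans (+-comm 2 (b + lenE e)) (+-assoc b (lenE e) 2)) (st₁ ++ₛ ((f , refl) ∙ (f' , refl) ∙ done))
    , (λ y y< → trans (cong (λ v → (R₂ [ x ≔ v ]) y) val) (relV-set {R₂} {σ} rv₂ y y<))
    , rm , keepsH-var x< (keepsH-set (suc k) (n≤1+n k) (keepsH kp₁))
    where
    R₂ = R₁ [ H (suc k) ≔ wrap w 0 ]
    rv₂ : RelV R₂ σ
    rv₂ = relV-hid {σ = σ} (keeps-V {k = k} {σ = σ} kp₁ rv)
    val : wrap w (R₂ (H k) + R₂ (H (suc k))) ≡ evalE e σ
    val = trans (cong (wrap w) (trans (cong₂ _+_ (trans (≔-other R₁ {H (suc k)} {H k} (H-suc≢ k)) v₁)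
            (trans (≔-same R₁ (H (suc k))) (wrap-id w (small-word (32G≤W bd) W< z≤n)))) (+-identityʳ _)))
          (wrap-id w (≤-<-trans (evalE-word decl bd te) (fewer (m≤m+n (lenE e) 2) W<)))
  sim-C {W} {σ} {b = b} {k} {R} {M} (twr {a} {i} {e} a< ti te _) bd W< fl rv rm at
    with sim-E {M = M} ti bd (fewer (≤-trans (m≤m+n (lenE i) (lenE e)) (m≤m+n _ 5)) W<) rv rm
           (At-++ˡ (compE k i) (At-++ˡ (compE k i ++ addrCode k a) at))
  ... | R₁ , st₁ , v₁ , kp₁
    with sim-addr {M = M} (32G≤W bd) W< (small-G bd ti) a<
           (At-++ʳ (compE k i) (length-compE k i) (At-++ˡ (compE k i ++ addrCode k a) at)) v₁
       | At-++ʳ (compE k i ++ addrCode k a) (trans (List.length-++ (compE k i)) (cong (_+ 4) (length-compE k i))) at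
  ... | R₂ , st₂ , v₂ , kp₂ | at₃
    with sim-E {M = M} te bd (fewer (≤-trans (m≤n+m (lenE e) (lenE i)) (m≤m+n _ 5)) W<)
           (keeps-V {k = k} {σ = σ} kp₂ (keeps-V {k = k} {σ = σ} kp₁ rv)) rm (At-++ˡ (compE (suc k) e) at₃)
       | At-++ʳ (compE (suc k) e) (length-compE (suc k) e) at₃
  ... | R₃ , st₃ , v₃ , kp₃ | f ∷ [] =
    _ , _ , _ , ≤-reflexive (count-eq (lenE i) (lenE e))
    , pc-eq (pc-arith b (lenE i) (lenE e))
        ((pc-eq (+-assoc b (lenE i) 4) (st₁ ++ₛ st₂)) ++ₛ (st₃ ++ₛ ((f , refl) ∙ done)))
    , keeps-V {k = suc k} {σ = σ} kp₃ (keeps-V {k = k} {σ = σ} kp₂ (keeps-V {k = k} {σ = σ} kp₁ rv))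
    , subst₂ (λ y v → RelM (M [ y ≔ v ]) (run (wr a i e) σ)) (sym (trans (kept kp₃ (H k) (≤-reflexive (sym (+-suc 32 k)))) v₂)) (sym v₃)
        (relM-set {M} {σ} a< rm)
    , keepsH-trans (keepsH kp₁) (keepsH-trans (keepsH kp₂) (keepsH-≤ (n≤1+n k) (keepsH kp₃)))
    where
    count-eq : ∀ i e → (i + 4) + (e + 1) ≡ i + e + 5
    count-eq = solve-∀
    pc-arith : ∀ b i e → suc (b + (i + 4) + e) ≡ b + ((i + 4) + (e + 1))
    pc-arith = solve-∀
  sim-C {W} {σ@(env V₀ A₀ [])} {b = b} {R = R} {M} (tflp {x} x< fs) bd W< fl rv rm (f ∷ [])
    with fl fs
  ... | ()
  sim-C {W} {σ@(env V₀ A₀ (ω₀ ∷ ω))} {b = b} {R = R} {M} (tflp {x} x< fs) bd W< fl rv rm (f ∷ []) =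
    1 , _ , M , ≤-refl , pc-eq (+-comm 1 b) ((f , refl) ∙ done)
    , relV-set {R} {σ} rv , rm , keepsH-var x< keepsH-refl
  sim-C {W} {σ} {b = b} {k} (tseq {c} {d} tc td) bd W< fl rv rm at
    with sim-C tc bd (fewer (m≤m+n (cost c σ) _) W<) (flips-≤ {σ = σ} (m≤m+n (cost c σ) _) fl) rv rm (At-++ˡ (compC b k c) at)
  ... | n₁ , R₁ , M₁ , n≤ , st₁ , rv₁ , rm₁ , kp₁ =
    seq-steps n≤ st₁ kp₁
      (subst (λ b' → SimC (cost d (run c σ)) (b + lenC c) b' k R₁ M₁ (ωs (run c σ)) (run d (run c σ))) (+-assoc b (lenC c) (lenC d))
        (sim-C td (run-bounded decl tc bd) (later {W} {cost c σ} ≤-refl W<) (flips-after {c = c} {σ = σ} ≤-refl fl) rv₁ rm₁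
          (At-++ʳ (compC b k c) (length-compC b k c) at))) ≤-refl
  sim-C {W} {σ} {b = b} {k} {R} {M} (tifz {e} {c = c} {d} te tc td) bd W< fl rv rm at
    with sim-E {M = M} te bd (fewer (≤-trans (m≤m+n (lenE e) 2) (m≤m+n _ _)) W<) rv rm (At-++ˡ (compE k e) at)
       | At-++ʳ (compE k e) (length-compE k e) at
  ... | R₁ , st₁ , v₁ , kp₁ | f ∷ at₂
    with At-++ˡ (compC (suc (b + lenE e)) k d) at₂
       | At-++ʳ (compC (suc (b + lenE e)) k d) (length-compC _ k d) at₂
       | jzero-step {b + lenE e} {R = R₁} {M} {ωs σ} f v₁
  ... | atd | fj ∷ atc | st₂
    with evalE e σ ≡ᵇ 0
  ... | true  = seq-steps ≤-refl (st₁ ++ₛ st₂) (keepsH kp₁)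
        (subst (λ b' → SimC (cost c σ) (suc (suc (b + lenE e) + lenC d)) b' k R₁ M (ωs σ) (run c σ)) (pc-arith b (lenE e) (lenC d) (lenC c))
          (sim-C tc bd (fewer (m≤n+m (cost c σ) (lenE e + 2)) W<)
            (flips-≤ {σ = σ} (m≤n+m (cost c σ) (lenE e + 2)) fl) (keeps-V {k = k} {σ = σ} kp₁ rv) rm atc))
        (+-monoˡ-≤ (cost c σ) (+-monoʳ-≤ (lenE e) (s≤s z≤n)))
    where
    pc-arith : ∀ b e d c → suc (suc (b + e) + d) + c ≡ b + (e + suc (d + suc c))
    pc-arith = solve-∀
  ... | false
    with sim-C td bd (fewer (m≤n+m (cost d σ) (lenE e + 2)) W<)
            (flips-≤ {σ = σ} (m≤n+m (cost d σ) (lenE e + 2)) fl) (keeps-V {k = k} {σ = σ} kp₁ rv) rm atd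
  ... | n₃ , R₃ , M₃ , n≤ , st₃ , rv₃ , rm₃ , kp₃ =
    _ , R₃ , M₃ , ≤-trans (+-monoʳ-≤ (lenE e + 1) (+-monoˡ-≤ 1 n≤)) (≤-reflexive (count-eq (lenE e) (cost d σ)))
    , pc-eq (pc-arith b (lenE e) (lenC d) (lenC c)) ((st₁ ++ₛ st₂) ++ₛ (st₃ ++ₛ ((fj , refl) ∙ done)))
    , rv₃ , rm₃ , keepsH-trans (keepsH kp₁) kp₃
    where
    count-eq : ∀ e d → e + 1 + (d + 1) ≡ e + 2 + d
    count-eq = solve-∀
    pc-arith : ∀ b e d c → suc (suc (b + e) + d) + c ≡ b + (e + suc (d + suc c))
    pc-arith = solve-∀
  sim-C {W} {σ} {b = b} {k} {R} {M} (tfor {x} {e} {d} {c} x< te s tc) bd W< fl rv rm at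
    with sim-E {M = M} te bd (fewer (≤-trans (m≤m+n (lenE e) 2) (m≤m+n _ _)) W<) rv rm (At-++ˡ (compE k e) at)
       | At-++ʳ (compE k e) (length-compE k e) at
  ... | R₁ , st₁ , v₁ , kp₁ | f ∷ at₂ =
    seq-steps ≤-refl (st₁ ++ₛ ((f , refl) ∙ done)) (keepsH-set (suc k) (n≤1+n k) (keepsH kp₁))
      (subst (λ b' → SimC (loopCost (run c) (cost c) x 0 (evalE e σ) σ + 1) (suc (b + lenE e)) b' k R₂ M (ωs σ) (run (for x e c) σ)) (pc-arith b (lenE e) (lenC c))
        (sim-loop (suc (b + lenE e)) 0 (evalE e σ) tc x< bd
          (λ {U} j j≤ W≤ → fits-grow {W} {varSize x} (counter-fits decl {σ = σ} {e = e} bd te s j≤) U W≤)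
          (≤-<-trans (evalE-word decl bd te) (fewer (≤-trans (m≤m+n (lenE e) 2) (m≤m+n _ _)) W<))
          (fewer (m≤n+m _ (lenE e + 2)) W<) (flips-≤ {σ = σ} (m≤n+m _ (lenE e + 2)) fl)
          (relV-hid {σ = σ} (keeps-V {k = k} {σ = σ} kp₁ rv)) rm
          (trans (≔-other R₁ {H (suc k)} {H k} (H-suc≢ k)) v₁)
          (trans (≔-same R₁ (H (suc k))) (wrap-id w (small-word (32G≤W bd) W< z≤n))) at₂))
      (≤-reflexive (count-eq (lenE e) (loopCost (run c) (cost c) x 0 (evalE e σ) σ)))
    where
    R₂ = R₁ [ H (suc k) ≔ wrap w 0 ]
    pc-arith : ∀ b e c → 3 + suc (b + e) + c + 4 ≡ b + (e + (1 + (3 + (c + 4))))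
    pc-arith = solve-∀
    count-eq : ∀ e l → e + 1 + (l + 1) ≡ e + 2 + l
    count-eq = solve-∀
  sim-loop {σ = σ} {k = k} {R} {M} top i zero tc x< bd fit i< W< fl rv rm Rk Rk' (f ∷ _) =
    1 , R , M , ≤-refl , jzero-step f Rk , rv , rm , keepsH-refl
  sim-loop {W} {σ} {c} {x} {k} {R} {M} top i (suc n) tc x< bd fit i< W< fl rv rm Rk Rk' at@(f₁ ∷ f₂ ∷ f₃ ∷ at₂)
    with sim-C {R = R₂} {M = M} tc bd' (fewer (≤-trans (m≤m+n (cost c σ') 7) (m≤m+n _ _)) W<)
           (flips-≤ {σ = σ'} (≤-trans (m≤m+n (cost c σ') 7) (m≤m+n _ _)) fl) rv₂ rm
           (At-++ˡ (compC (3 + top) (2 + k) c) at₂)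
       | At-++ʳ (compC (3 + top) (2 + k) c) (length-compC (3 + top) (2 + k) c) at₂
    where
    σ' = setV x i σ
    bd' : Bounded W σ'
    bd' = set-bounded decl W ≤-refl bd (fit i (m≤m+n i (suc n)) ≤-refl)
    R₁ = R [ H (2 + k) ≔ wrap w 0 ]
    R₂ = R₁ [ x ≔ wrap w (R₁ (H (suc k)) + R₁ (H (2 + k))) ]
    val : wrap w (R₁ (H (suc k)) + R₁ (H (2 + k))) ≡ i
    val = trans (cong (wrap w) (trans (cong₂ _+_ (trans (≔-other R {H (2 + k)} {H (suc k)} (H-suc≢ (suc k))) Rk')
            (trans (≔-same R (H (2 + k))) (wrap-id w (small-word (32G≤W bd) W< z≤n)))) (+-identityʳ i)))
            (wrap-id w (≤-<-trans (m≤m+n i (suc n)) i<))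
    rv₂ : RelV R₂ σ'
    rv₂ y y< = trans (cong (λ v → (R₁ [ x ≔ v ]) y) val) (relV-set {R₁} {σ} (relV-hid {σ = σ} rv) y y<)
  ... | n₃ , R₃ , M₃ , n≤ , st₃ , rv₃ , rm₃ , kp₃ | g₁ ∷ g₂ ∷ g₃ ∷ g₄ ∷ [] =
    seq-steps {m = 3 + (n₃ + 4)} {c = cost c σ' + 7} {σ = loop (run c) x i (suc n) σ}
      (≤-trans (≤-reflexive (shift n₃)) (+-monoˡ-≤ 7 n≤))
      (jzero-step f₁ Rk ++ₛ ((f₂ , refl) ∙ (f₃ , refl) ∙ (st₃ ++ₛ ((g₁ , refl) ∙ (g₂ , refl) ∙ (g₃ , refl) ∙ (g₄ , refl) ∙ done))))
      (keepsH-set k ≤-refl (keepsH-set (suc k) (n≤1+n k) (keepsH-set (2 + k) (≤-trans (n≤1+n k) (n≤1+n (suc k)))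
        (keepsH-trans (keepsH-var x< (keepsH-set (2 + k) (≤-trans (n≤1+n k) (n≤1+n (suc k))) keepsH-refl))
          (keepsH-≤ (≤-trans (n≤1+n k) (n≤1+n (suc k))) kp₃)))))
      (sim-loop top (suc i) n tc x< bd₆ fit' i<' (later {W} {cost c σ' + 7} ≤-refl W<)
        (flips-after {c = c} {σ = σ'} (+-monoˡ-≤ _ (m≤m+n (cost c σ') 7)) fl)
        (relV-hid {σ = σ''} {j = k} (relV-hid {σ = σ''} {j = suc k} (relV-hid {σ = σ''} {j = 2 + k} rv₃))) rm₃
        rk rk' at)
      (≤-reflexive (sym (+-assoc (cost c σ' + 7) _ 1)))
    where
    σ' = setV x i σ
    σ'' = run c σ'
    i<' : suc i + n < 2 ^ w
    i<' = subst (_< 2 ^ w) (+-suc i n) i<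
    bd₆ : Bounded (W + (cost c σ' + 7) * G) σ''
    bd₆ = grow decl (+-monoʳ-≤ W (*-monoˡ-≤ G (m≤m+n (cost c σ') 7)))
            (run-bounded decl tc (set-bounded decl W ≤-refl bd (fit i (m≤m+n i (suc n)) ≤-refl)))
    fit' : ∀ {U} j → j ≤ suc i + n → W + (cost c σ' + 7) * G ≤ U → Fits U (varSize x) j
    fit' j j≤ W≤ = fit j (≤-trans j≤ (≤-reflexive (sym (+-suc i n)))) (≤-trans (m≤m+n W _) W≤)
    shift : ∀ n → 3 + (n + 4) ≡ n + 7
    shift = solve-∀
    R₁ = R [ H (2 + k) ≔ wrap w 0 ]
    R₂ = R₁ [ x ≔ wrap w (R₁ (H (suc k)) + R₁ (H (2 + k))) ]
    R₄ = R₃ [ H (2 + k) ≔ wrap w 1 ]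
    R₅ = R₄ [ H (suc k) ≔ wrap w (R₄ (H (suc k)) + R₄ (H (2 + k))) ]
    R₆ = R₅ [ H k ≔ R₅ (H k) ∸ R₅ (H (2 + k)) ]
    hid-other : ∀ R i j {v} → i ≢ j → (R [ H j ≔ v ]) (H i) ≡ R (H i)
    hid-other R i j ne = ≔-other R {H j} {H i} (λ eq → ne (+-cancelˡ-≡ 32 i j eq))
    down : ∀ j → j < 2 + k → R₃ (H j) ≡ R (H j)
    down j j< = trans (keptH kp₃ j j<) (trans (≔-other R₁ {x} {H j} (λ eq → H≢ j x< (sym eq))) (hid-other R j (2 + k) (<⇒≢ j<)))
    one : R₄ (H (2 + k)) ≡ 1
    one = trans (≔-same R₃ (H (2 + k))) (wrap-id w (small-word (32G≤W bd) W< (s≤s z≤n)))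
    rk' : R₆ (H (suc k)) ≡ suc i
    rk' = trans (hid-other R₅ (suc k) k (λ ())) (trans (≔-same R₄ (H (suc k)))
            (trans (cong (wrap w) (trans (cong₂ _+_
              (trans (hid-other R₃ (suc k) (2 + k) (λ ())) (trans (down (suc k) ≤-refl) Rk')) one) (+-comm i 1)))
              (wrap-id w (≤-<-trans (m≤m+n (suc i) n) i<'))))
    rk : R₆ (H k) ≡ n
    rk = trans (≔-same R₅ (H k)) (cong₂ _∸_
           (trans (hid-other R₄ k (suc k) (λ ())) (trans (hid-other R₃ k (2 + k) (λ ())) (trans (down k (n≤1+n (suc k))) Rk)))
           (trans (hid-other R₄ (2 + k) (suc k) (λ ())) one))

modV : Cmd → ℕ → Bool
modV skip        y = false
modV (x := e)    y = y ≡ᵇ x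
modV (wr a i e)  y = false
modV (flp x)     y = y ≡ᵇ x
modV (c ⨾ d)     y = modV c y ∨ modV d y
modV (ifz e c d) y = modV c y ∨ modV d y
modV (for x e c) y = (y ≡ᵇ x) ∨ modV c y

modA : Cmd → ℕ → Bool
modA skip        y = false
modA (x := e)    y = false
modA (wr a i e)  y = y ≡ᵇ a
modA (flp x)     y = false
modA (c ⨾ d)     y = modA c y ∨ modA d y
modA (ifz e c d) y = modA c y ∨ modA d y
modA (for x e c) y = modA c y

usesCoins : Cmd → Bool
usesCoins (flp x)     = true
usesCoins (c ⨾ d)     = usesCoins c ∨ usesCoins d
usesCoins (ifz e c d) = usesCoins c ∨ usesCoins d
usesCoins (for x e c) = usesCoins c
usesCoins _           = false

∨-falseˡ : ∀ a {b} → a ∨ b ≡ false → a ≡ false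
∨-falseˡ false _ = refl

∨-falseʳ : ∀ a {b} → a ∨ b ≡ false → b ≡ false
∨-falseʳ false eq = eq

record Frame (c : Cmd) (σ σ' : Env) : Set where
  constructor frame
  field
    sameV : ∀ x → modV c x ≡ false → V σ' x ≡ V σ x
    sameA : ∀ a → modA c a ≡ false → A σ' a ≡ A σ a
    sameω : usesCoins c ≡ false → ωs σ' ≡ ωs σ

open Frame public

frame-refl : ∀ {c σ} → Frame c σ σ
frame-refl = frame (λ _ _ → refl) (λ _ _ → refl) (λ _ → refl)

frame-trans : ∀ {c σ σ' σ''} → Frame c σ σ' → Frame c σ' σ'' → Frame c σ σ''
frame-trans f g = frame (λ x e → trans (sameV g x e) (sameV f x e))
  (λ a e → trans (sameA g a e) (sameA f a e)) (λ e → trans (sameω g e) (sameω f e))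

false⇒set-same : ∀ {x y v} R → (y ≡ᵇ x) ≡ false → (R [ x ≔ v ]) y ≡ R y
false⇒set-same R eq rewrite eq = refl

iter-frame : ∀ {x e c} → (∀ σ → Frame c σ (run c σ)) → ∀ i σ →
             Frame (for x e c) σ (run c (setV x i σ))
iter-frame {x} {e} {c} f i σ = frame
  (λ y eq → trans (sameV fc y (∨-falseʳ (y ≡ᵇ x) eq)) (false⇒set-same (V σ) (∨-falseˡ (y ≡ᵇ x) eq)))
  (λ a eq → sameA fc a eq) (λ eq → sameω fc eq)
  where fc = f (setV x i σ)

run-frame : ∀ c σ → Frame c σ (run c σ)
loop-frame : ∀ x e c i n σ → Frame (for x e c) σ (loop (run c) x i n σ)
run-frame skip        σ = frame-refl
run-frame (x := e)    σ = frame (λ y eq → false⇒set-same (V σ) eq) (λ _ _ → refl) (λ _ → refl)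
run-frame (wr a i e)  σ = frame (λ _ _ → refl) fa (λ _ → refl)
  where
  fa : ∀ b → (b ≡ᵇ a) ≡ false → setA (A σ) a (evalE i σ) (evalE e σ) b ≡ A σ b
  fa b eq rewrite eq = refl
run-frame (flp x)     σ = frame (λ y eq → false⇒set-same (V σ) eq) (λ _ _ → refl) (λ ())
run-frame (c ⨾ d)     σ = frame
  (λ x eq → trans (sameV g x (∨-falseʳ (modV c x) eq)) (sameV f x (∨-falseˡ (modV c x) eq)))
  (λ a eq → trans (sameA g a (∨-falseʳ (modA c a) eq)) (sameA f a (∨-falseˡ (modA c a) eq)))
  (λ eq → trans (sameω g (∨-falseʳ (usesCoins c) eq)) (sameω f (∨-falseˡ (usesCoins c) eq)))
  where
  f = run-frame c σ
  g = run-frame d (run c σ)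
run-frame (ifz e c d) σ with evalE e σ ≡ᵇ 0
... | true  = frame (λ x eq → sameV f x (∨-falseˡ (modV c x) eq)) (λ a eq → sameA f a (∨-falseˡ (modA c a) eq))
                    (λ eq → sameω f (∨-falseˡ (usesCoins c) eq))
  where f = run-frame c σ
... | false = frame (λ x eq → sameV f x (∨-falseʳ (modV c x) eq)) (λ a eq → sameA f a (∨-falseʳ (modA c a) eq))
                    (λ eq → sameω f (∨-falseʳ (usesCoins c) eq))
  where f = run-frame d σ
run-frame (for x e c) σ = loop-frame x e c 0 (evalE e σ) σ
loop-frame x e c i zero    σ = frame-refl
loop-frame x e c i (suc n) σ = frame-trans (iter-frame {x} {e} {c} (run-frame c) i σ)
  (loop-frame x e c (suc i) n (run c (setV x i σ)))

record Outcome (c : Cmd) (σ : Env) (K : ℕ) (Q : Env → Set) : Set where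
  constructor outcome
  field
    holds  : Q (run c σ)
    within : cost c σ ≤ K

open Outcome public

loop-rule : ∀ {x e c σ} (I : ℕ → Env → Set) (K n : ℕ) → evalE e σ ≡ n → I 0 σ →
            (∀ i σ' → i < n → Frame (for x e c) σ σ' → I i σ' → Outcome c (setV x i σ') K (I (suc i))) →
            Outcome (for x e c) σ (lenE e + 2 + n * (K + 7)) (I n)
loop-rule {x} {e} {c} {σ} I K n refl I₀ body = outcome (proj₁ (go 0 n σ refl frame-refl I₀))
  (+-monoʳ-≤ (lenE e + 2) (proj₂ (go 0 n σ refl frame-refl I₀)))
  where
  go : ∀ i m σ' → i + m ≡ n → Frame (for x e c) σ σ' → I i σ' →
       I n (loop (run c) x i m σ') × loopCost (run c) (cost c) x i m σ' ≤ m * (K + 7)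
  go i zero σ' eq fr Ii = subst (λ j → I j σ') (trans (sym (+-identityʳ i)) eq) Ii , z≤n
  go i (suc m) σ' eq fr Ii =
    let o = body i σ' (subst (suc i ≤_) eq (≤-trans (s≤s (m≤m+n i m)) (≤-reflexive (sym (+-suc i m))))) fr Ii
        r = go (suc i) m (run c (setV x i σ')) (trans (sym (+-suc i m)) eq)
               (frame-trans fr (iter-frame {x} {e} {c} (run-frame c) i σ')) (holds o)
    in proj₁ r , +-mono-≤ (+-monoˡ-≤ 7 (within o)) (proj₂ r)

-- The continuation sees the intermediate state only through its properties,
-- which keeps the normal forms of program states small.
seq-rule : ∀ {c d σ K L Q R} → Outcome c σ K Q →
           (∀ σ' → Frame c σ σ' → Q σ' → Outcome d σ' L R) → Outcome (c ⨾ d) σ (K + L) R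
seq-rule {c} {d} {σ} oc od = outcome (holds o) (+-mono-≤ (within oc) (within o))
  where o = od (run c σ) (run-frame c σ) (holds oc)

weaken : ∀ {c σ K L Q R} → K ≤ L → (∀ σ' → Q σ' → R σ') → Outcome c σ K Q → Outcome c σ L R
weaken {c} {σ} K≤L f o = outcome (f (run c σ) (holds o)) (≤-trans (within o) K≤L)

conseq : ∀ {c σ K Q R} → (∀ σ' → Frame c σ σ' → Q σ' → R σ') → Outcome c σ K Q → Outcome c σ K R
conseq {c} {σ} f o = outcome (f (run c σ) (run-frame c σ) (holds o)) (within o)

sumTo : ℕ → (ℕ → ℕ) → ℕ
sumTo zero    f = 0
sumTo (suc n) f = f 0 + sumTo n (f ∘ suc)

sumTo-cong : ∀ n {f g} → (∀ i → i < n → f i ≡ g i) → sumTo n f ≡ sumTo n g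
sumTo-cong zero    eq = refl
sumTo-cong (suc n) eq = cong₂ _+_ (eq 0 (s≤s z≤n)) (sumTo-cong n (λ i i<n → eq (suc i) (s≤s i<n)))

sumTo-snoc : ∀ n f → sumTo (suc n) f ≡ sumTo n f + f n
sumTo-snoc zero    f = +-identityʳ (f 0)
sumTo-snoc (suc n) f = trans (cong (f 0 +_) (sumTo-snoc n (f ∘ suc))) (sym (+-assoc (f 0) _ _))

sumTo-mono : ∀ n {f g} → (∀ i → i < n → f i ≤ g i) → sumTo n f ≤ sumTo n g
sumTo-mono zero    le = z≤n
sumTo-mono (suc n) le = +-mono-≤ (le 0 (s≤s z≤n)) (sumTo-mono n (λ i i<n → le (suc i) (s≤s i<n)))

sumTo-+ : ∀ n f g → sumTo n (λ i → f i + g i) ≡ sumTo n f + sumTo n g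
sumTo-+ zero    f g = refl
sumTo-+ (suc n) f g = trans (cong (f 0 + g 0 +_) (sumTo-+ n (f ∘ suc) (g ∘ suc)))
  (interchange (f 0) (g 0) (sumTo n (f ∘ suc)) (sumTo n (g ∘ suc)))
  where
  interchange : ∀ a b c d → a + b + (c + d) ≡ a + c + (b + d)
  interchange = solve-∀

sumTo-const : ∀ n c → sumTo n (λ _ → c) ≡ n * c
sumTo-const zero    c = refl
sumTo-const (suc n) c = cong (c +_) (sumTo-const n c)

∑ : ℕ → (List Bool → ℕ) → ℕ
∑ zero    f = f []
∑ (suc n) f = ∑ n (f ∘ (false ∷_)) + ∑ n (f ∘ (true ∷_))

∑-mono : ∀ n {f g} → (∀ l → length l ≡ n → f l ≤ g l) → ∑ n f ≤ ∑ n g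
∑-mono zero    le = le [] refl
∑-mono (suc n) le = +-mono-≤ (∑-mono n (λ l eq → le (false ∷ l) (cong suc eq)))
                             (∑-mono n (λ l eq → le (true ∷ l) (cong suc eq)))

∑-cong : ∀ n {f g} → (∀ l → length l ≡ n → f l ≡ g l) → ∑ n f ≡ ∑ n g
∑-cong n eq = ≤-antisym (∑-mono n (λ l e → ≤-reflexive (eq l e)))
                        (∑-mono n (λ l e → ≤-reflexive (sym (eq l e))))

∑-+ : ∀ n f g → ∑ n (λ l → f l + g l) ≡ ∑ n f + ∑ n g
∑-+ zero    f g = refl
∑-+ (suc n) f g = trans
  (cong₂ _+_ (∑-+ n (f ∘ (false ∷_)) (g ∘ (false ∷_))) (∑-+ n (f ∘ (true ∷_)) (g ∘ (true ∷_))))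
  (interchange (∑ n (f ∘ (false ∷_))) (∑ n (g ∘ (false ∷_))) (∑ n (f ∘ (true ∷_))) (∑ n (g ∘ (true ∷_))))
  where
  interchange : ∀ a b c d → a + b + (c + d) ≡ a + c + (b + d)
  interchange = solve-∀

∑-* : ∀ n c f → ∑ n (λ l → c * f l) ≡ c * ∑ n f
∑-* zero    c f = refl
∑-* (suc n) c f = trans (cong₂ _+_ (∑-* n c (f ∘ (false ∷_))) (∑-* n c (f ∘ (true ∷_))))
  (sym (*-distribˡ-+ c (∑ n (f ∘ (false ∷_))) (∑ n (f ∘ (true ∷_)))))

∑-const : ∀ n c → ∑ n (λ _ → c) ≡ 2 ^ n * c
∑-const zero    c = sym (+-identityʳ c)
∑-const (suc n) c = trans (cong₂ _+_ (∑-const n c) (∑-const n c)) (double (2 ^ n) c)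
  where
  double : ∀ a c → a * c + a * c ≡ 2 * a * c
  double = solve-∀

∑-++ : ∀ m n f → ∑ (m + n) f ≡ ∑ m (λ l → ∑ n (λ l' → f (l ++ l')))
∑-++ zero    n f = refl
∑-++ (suc m) n f = cong₂ _+_ (∑-++ m n (f ∘ (false ∷_))) (∑-++ m n (f ∘ (true ∷_)))

-- Random signs

nth : List Bool → ℕ → Bool
nth []      _       = false
nth (b ∷ l) zero    = b
nth (b ∷ l) (suc n) = nth l n

nth-++ : ∀ l l' {h} → h < length l → nth (l ++ l') h ≡ nth l h
nth-++ (b ∷ l) l' {zero}  h<       = refl
nth-++ (b ∷ l) l' {suc h} (s≤s h<) = nth-++ l l' h<

nth-drop : ∀ n l h → nth (List.drop n l) h ≡ nth l (n + h)
nth-drop zero    l       h = refl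
nth-drop (suc n) []      h = refl
nth-drop (suc n) (b ∷ l) h = nth-drop n l h

Point : Set
Point = ℕ → Bool

dist : ℕ → Point → Point → ℕ
dist q x y = sumTo q (λ h → bit (x h xor y h))

-- The summand 1 + (±1) x_h of the sketch of x; the shift by 1 keeps it
-- nonnegative and cancels in differences.
signed : Bool → Bool → ℕ
signed x s = bit x * (bit s + bit s) + (1 ∸ bit x)

sketch : ℕ → Point → List Bool → ℕ
sketch q x l = sumTo q (λ h → signed (x h) (nth l h))

gap : ℕ → Point → Point → List Bool → ℕ
gap q x y l = ∣ sketch q x l - sketch q y l ∣

gap-++ : ∀ q x y l l' → length l ≡ q → gap q x y (l ++ l') ≡ gap q x y l
gap-++ q x y l l' refl = cong₂ ∣_-_∣ (same x) (same y)
  where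
  same : ∀ x → sketch q x (l ++ l') ≡ sketch q x l
  same x = sumTo-cong q (λ h h< → cong (signed (x h)) (nth-++ l l' h<))

walk : ∀ (f : ℕ → ℕ) u v → f ∣ suc u - v ∣ + f ∣ u - suc v ∣ ≡ f (suc ∣ u - v ∣) + f ∣ ∣ u - v ∣ - 1 ∣
walk f zero    zero    = refl
walk f zero    (suc v) = trans (+-comm (f v) (f (suc (suc v))))
  (cong (λ z → f (suc (suc v)) + f z) (sym (∣-∣-identityʳ v)))
walk f (suc u) zero    = refl
walk f (suc u) (suc v) = walk f u v

shift-gap : ∀ c u v → ∣ c + u - (c + v) ∣ ≡ ∣ u - v ∣
shift-gap c u v = ∣m+n-m+o∣≡∣n-o∣ c u v

-- Conditioned on the remaining signs, a coordinate where x and y differ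
-- moves the gap one step up or down (reflected at 0).
∑-gap : ∀ (f : ℕ → ℕ) q x y →
  ∑ (suc q) (f ∘ gap (suc q) x y) ≡
  (if x 0 xor y 0
   then ∑ q (λ l → f (suc (gap q (x ∘ suc) (y ∘ suc) l)) + f ∣ gap q (x ∘ suc) (y ∘ suc) l - 1 ∣)
   else 2 * ∑ q (f ∘ gap q (x ∘ suc) (y ∘ suc)))
∑-gap f q x y with x 0 | y 0
... | false | false = cong (∑ q (λ l → f (gap q (x ∘ suc) (y ∘ suc) l)) +_) (sym (+-identityʳ _))
... | true  | true  = trans
  (cong₂ _+_ (∑-cong q (λ l _ → cong f (shift-gap 0 (sketch q (x ∘ suc) l) (sketch q (y ∘ suc) l))))
             (∑-cong q (λ l _ → cong f (shift-gap 2 (sketch q (x ∘ suc) l) (sketch q (y ∘ suc) l)))))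
  (cong (∑ q (λ l → f (gap q (x ∘ suc) (y ∘ suc) l)) +_) (sym (+-identityʳ _)))
... | true  | false = trans
  (sym (∑-+ q (λ l → f ∣ sketch q (x ∘ suc) l - suc (sketch q (y ∘ suc) l) ∣)
              (λ l → f ∣ suc (sketch q (x ∘ suc) l) - sketch q (y ∘ suc) l ∣)))
  (∑-cong q (λ l _ → trans (+-comm (f ∣ sketch q (x ∘ suc) l - suc (sketch q (y ∘ suc) l) ∣) _)
    (walk f (sketch q (x ∘ suc) l) (sketch q (y ∘ suc) l))))
... | false | true  = trans
  (sym (∑-+ q (λ l → f ∣ suc (sketch q (x ∘ suc) l) - sketch q (y ∘ suc) l ∣)
              (λ l → f ∣ sketch q (x ∘ suc) l - suc (sketch q (y ∘ suc) l) ∣)))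
  (∑-cong q (λ l _ → walk f (sketch q (x ∘ suc) l) (sketch q (y ∘ suc) l)))

second-moment : ∀ q x y → ∑ q (λ l → gap q x y l * gap q x y l) ≡ dist q x y * 2 ^ q
second-moment zero    x y = refl
second-moment (suc q) x y = trans (∑-gap (λ z → z * z) q x y) (go (x 0 xor y 0))
  where
  d = dist q (x ∘ suc) (y ∘ suc)
  g = gap q (x ∘ suc) (y ∘ suc)
  sq : ∀ z → suc z * suc z + ∣ z - 1 ∣ * ∣ z - 1 ∣ ≡ 2 * (z * z) + 2
  sq zero          = refl
  sq (suc zero)    = refl
  sq (suc (suc z)) = lem z
    where lem : ∀ z → (3 + z) * (3 + z) + (1 + z) * (1 + z) ≡ 2 * ((2 + z) * (2 + z)) + 2
          lem = solve-∀
  go : ∀ b → (if b then ∑ q (λ l → suc (g l) * suc (g l) + ∣ g l - 1 ∣ * ∣ g l - 1 ∣)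
              else 2 * ∑ q (λ l → g l * g l)) ≡ (bit b + d) * 2 ^ suc q
  go false = trans (cong (2 *_) (second-moment q (x ∘ suc) (y ∘ suc))) (lem d (2 ^ q))
    where lem : ∀ d t → 2 * (d * t) ≡ (0 + d) * (2 * t)
          lem = solve-∀
  go true  = trans (∑-cong q (λ l _ → sq (g l)))
    (trans (∑-+ q (λ l → 2 * (g l * g l)) (λ _ → 2))
    (trans (cong₂ _+_ (trans (∑-* q 2 (λ l → g l * g l)) (cong (2 *_) (second-moment q (x ∘ suc) (y ∘ suc))))
                      (∑-const q 2)) (lem d (2 ^ q))))
    where lem : ∀ d t → 2 * (d * t) + t * 2 ≡ (1 + d) * (2 * t)
          lem = solve-∀

fourth-moment : ∀ q x y →
  ∑ q (λ l → gap q x y l * gap q x y l * (gap q x y l * gap q x y l)) + 2 * dist q x y * 2 ^ q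
  ≡ 3 * (dist q x y * dist q x y) * 2 ^ q
fourth-moment zero    x y = refl
fourth-moment (suc q) x y =
  trans (cong (_+ 2 * dist (suc q) x y * 2 ^ suc q) (∑-gap (λ z → z * z * (z * z)) q x y)) (go (x 0 xor y 0))
  where
  d = dist q (x ∘ suc) (y ∘ suc)
  g = gap q (x ∘ suc) (y ∘ suc)
  four : ℕ → ℕ
  four z = z * z * (z * z)
  qu : ∀ z → four (suc z) + four ∣ z - 1 ∣ ≡ 2 * four z + (12 * (z * z) + 2)
  qu zero          = refl
  qu (suc zero)    = refl
  qu (suc (suc z)) = lem z
    where lem : ∀ z → (3 + z) * (3 + z) * ((3 + z) * (3 + z)) + (1 + z) * (1 + z) * ((1 + z) * (1 + z))
                ≡ 2 * ((2 + z) * (2 + z) * ((2 + z) * (2 + z))) + (12 * ((2 + z) * (2 + z)) + 2)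
          lem = solve-∀
  go : ∀ b → (if b then ∑ q (λ l → four (suc (g l)) + four ∣ g l - 1 ∣) else 2 * ∑ q (four ∘ g))
             + 2 * (bit b + d) * 2 ^ suc q ≡ 3 * ((bit b + d) * (bit b + d)) * 2 ^ suc q
  go false = trans (lem₁ (∑ q (four ∘ g)) d (2 ^ q))
    (trans (cong (2 *_) (fourth-moment q (x ∘ suc) (y ∘ suc))) (lem₂ d (2 ^ q)))
    where
    lem₁ : ∀ s d t → 2 * s + 2 * d * (2 * t) ≡ 2 * (s + 2 * d * t)
    lem₁ = solve-∀
    lem₂ : ∀ d t → 2 * (3 * (d * d) * t) ≡ 3 * (d * d) * (2 * t)
    lem₂ = solve-∀
  go true  = trans (cong (_+ 2 * (1 + d) * 2 ^ suc q)
      (trans (∑-cong q (λ l _ → qu (g l)))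
      (trans (∑-+ q (λ l → 2 * four (g l)) (λ l → 12 * (g l * g l) + 2))
      (cong₂ _+_ (∑-* q 2 (four ∘ g))
        (trans (∑-+ q (λ l → 12 * (g l * g l)) (λ _ → 2))
          (cong₂ _+_ (trans (∑-* q 12 (λ l → g l * g l)) (cong (12 *_) (second-moment q (x ∘ suc) (y ∘ suc))))
                     (∑-const q 2)))))))
    (trans (lem₁ (∑ q (four ∘ g)) d (2 ^ q))
    (trans (cong (λ z → 2 * z + (12 * (d * 2 ^ q) + 2 ^ q * 6)) (fourth-moment q (x ∘ suc) (y ∘ suc)))
      (lem₂ d (2 ^ q))))
    where
    lem₁ : ∀ s d t → 2 * s + (12 * (d * t) + t * 2) + 2 * (1 + d) * (2 * t)
                     ≡ 2 * (s + 2 * d * t) + (12 * (d * t) + t * 6)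
    lem₁ = solve-∀
    lem₂ : ∀ d t → 2 * (3 * (d * d) * t) + (12 * (d * t) + t * 6) ≡ 3 * ((1 + d) * (1 + d)) * (2 * t)
    lem₂ = solve-∀

drop-+ : ∀ {A : Set} m n (l : List A) → List.drop (m + n) l ≡ List.drop n (List.drop m l)
drop-+ m n l = sym (List.drop-drop m n l)

^-distribʳ-* : ∀ k a b → (a * b) ^ k ≡ a ^ k * b ^ k
^-distribʳ-* zero    a b = refl
^-distribʳ-* (suc k) a b = trans (cong (a * b *_) (^-distribʳ-* k a b)) (lem a b (a ^ k) (b ^ k))
  where lem : ∀ a b c d → a * b * (c * d) ≡ a * c * (b * d)
        lem = solve-∀

rowSum : ℕ → ℕ → (List Bool → ℕ) → List Bool → ℕ
rowSum zero    q g l = 0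
rowSum (suc m) q g l = g l + rowSum m q g (List.drop q l)

rowProd : ℕ → ℕ → (List Bool → ℕ) → List Bool → ℕ
rowProd zero    q g l = 1
rowProd (suc m) q g l = g l * rowProd m q g (List.drop q l)

rowSum-sumTo : ∀ m q g l → rowSum m q g l ≡ sumTo m (λ t → g (List.drop (t * q) l))
rowSum-sumTo zero    q g l = refl
rowSum-sumTo (suc m) q g l = cong (g l +_) (trans (rowSum-sumTo m q g (List.drop q l))
  (sumTo-cong m (λ t _ → cong g (sym (drop-+ q (t * q) l)))))

∑-rowProd : ∀ m q g → (∀ l l' → length l ≡ q → g (l ++ l') ≡ g l) →
            ∑ (m * q) (rowProd m q g) ≡ ∑ q g ^ m
∑-rowProd zero    q g loc = refl
∑-rowProd (suc m) q g loc = trans (∑-++ q (m * q) (rowProd (suc m) q g))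
  (trans (∑-cong q (λ l eq → trans (∑-cong (m * q) (λ l' _ → cong₂ _*_ (loc l l' eq)
      (cong (rowProd m q g) (trans (cong (λ n → List.drop n (l ++ l')) (sym eq)) (drop-++ l l')))))
    (trans (∑-* (m * q) (g l) (rowProd m q g)) (trans (cong (g l *_) (∑-rowProd m q g loc)) (*-comm (g l) _)))))
  (trans (∑-* q (∑ q g ^ m) g) (*-comm (∑ q g ^ m) (∑ q g))))

markov : ∀ m q g (E : List Bool → Bool) U L → (∀ l l' → length l ≡ q → g (l ++ l') ≡ g l) →
         ∑ q g ≤ U → (∀ l → E l ≡ true → L ≤ rowProd m q g l) →
         ∑ (m * q) (bit ∘ E) * L ≤ U ^ m
markov m q g E U L loc ≤U le = ≤-trans (≤-reflexive (trans (*-comm _ L) (sym (∑-* (m * q) L (bit ∘ E)))))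
  (≤-trans (∑-mono (m * q) (λ l _ → pointwise l (E l) refl))
  (≤-trans (≤-reflexive (∑-rowProd m q g loc)) (^-monoˡ-≤ m ≤U)))
  where
  pointwise : ∀ l b → E l ≡ b → L * bit b ≤ rowProd m q g l
  pointwise l true  eq = ≤-trans (≤-reflexive (*-identityʳ L)) (le l eq)
  pointwise l false eq = ≤-trans (≤-reflexive (*-zeroʳ L)) z≤n

gap≤dist : ∀ q x y l → gap q x y l ≤ dist q x y
gap≤dist q x y l = go q x y (nth l)
  where
  step-up : ∀ u v → ∣ suc u - v ∣ ≤ suc ∣ u - v ∣
  step-up u       zero    = s≤s (≤-reflexive (sym (∣-∣-identityʳ u)))
  step-up zero    (suc v) = ≤-trans (n≤1+n v) (n≤1+n (suc v))
  step-up (suc u) (suc v) = step-up u v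
  step-down : ∀ u v → ∣ u - suc v ∣ ≤ suc ∣ u - v ∣
  step-down u v = ≤-trans (≤-reflexive (∣-∣-comm u (suc v)))
    (≤-trans (step-up v u) (s≤s (≤-reflexive (∣-∣-comm v u))))
  go : ∀ q (x y : Point) (s : ℕ → Bool) → ∣ sumTo q (λ h → signed (x h) (s h)) - sumTo q (λ h → signed (y h) (s h)) ∣
       ≤ sumTo q (λ h → bit (x h xor y h))
  go zero    x y s = z≤n
  go (suc q) x y s = first (x 0) (y 0) (s 0) (sumTo q (λ h → signed (x (suc h)) (s (suc h))))
      (sumTo q (λ h → signed (y (suc h)) (s (suc h)))) (go q (x ∘ suc) (y ∘ suc) (s ∘ suc))
    where
    first : ∀ a b s u v {d : ℕ} → ∣ u - v ∣ ≤ d → ∣ signed a s + u - (signed b s + v) ∣ ≤ bit (a xor b) + d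
    first false false s u v le = le
    first true  true  s u v le = ≤-trans (≤-reflexive (shift-gap (signed true s) u v)) le
    first true  false true  u v le = ≤-trans (step-up u v) (s≤s le)
    first true  false false u v le = ≤-trans (step-down u v) (s≤s le)
    first false true  true  u v le = ≤-trans (step-down u v) (s≤s le)
    first false true  false u v le = ≤-trans (step-up u v) (s≤s le)

-- Lower tail.  By the fourth moment a single gap is at least √d / 2 with
-- probability at least 10/46, so a row has expected weight at most 29/16,
-- where it weighs 1 if its gap is that large and 2 otherwise.

module Lower (q : ℕ) (x y : Point) (1≤d : 1 ≤ dist q x y) where
  d = dist q x y

  large? : List Bool → Bool
  large? l = d ≤ᵇ 4 * (gap q x y l * gap q x y l)

  weight : List Bool → ℕ
  weight l = 2 ∸ bit (large? l)

  two-squares : ∀ a b → 2 * (a * b) ≤ a * a + b * b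
  two-squares a b with ≤-total a b
  ... | inj₁ a≤b = subst (λ b → 2 * (a * b) ≤ a * a + b * b) (m+[n∸m]≡n a≤b)
    (≤-trans (m≤m+n _ ((b ∸ a) * (b ∸ a))) (≤-reflexive (lem a (b ∸ a))))
    where lem : ∀ a k → 2 * (a * (a + k)) + k * k ≡ a * a + (a + k) * (a + k)
          lem = solve-∀
  ... | inj₂ b≤a = subst (λ a → 2 * (a * b) ≤ a * a + b * b) (m+[n∸m]≡n b≤a)
    (≤-trans (m≤m+n _ ((a ∸ b) * (a ∸ b))) (≤-reflexive (lem b (a ∸ b))))
    where lem : ∀ b k → 2 * ((b + k) * b) + k * k ≡ (b + k) * (b + k) + b * b
          lem = solve-∀

  pointwise : ∀ v b → (d ≤ᵇ 4 * v) ≡ b → 29 * d * v ≤ 4 * (v * v) + (7 * (d * d) + 46 * (d * d) * bit b)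
  pointwise v true  eq = *-cancelˡ-≤ 16 (≤-trans (≤-reflexive (lem₁ v d))
    (≤-trans (two-squares (8 * v) (29 * d)) (≤-trans (m≤m+n _ (7 * (d * d))) (≤-reflexive (lem₂ v d)))))
    where
    lem₁ : ∀ v d → 16 * (29 * d * v) ≡ 2 * ((8 * v) * (29 * d))
    lem₁ = solve-∀
    lem₂ : ∀ v d → (8 * v) * (8 * v) + (29 * d) * (29 * d) + 7 * (d * d)
                   ≡ 16 * (4 * (v * v) + (7 * (d * d) + 46 * (d * d) * 1))
    lem₂ = solve-∀
  pointwise v false eq = subst (λ d → 29 * d * v ≤ 4 * (v * v) + (7 * (d * d) + 46 * (d * d) * 0)) (m+[n∸m]≡n 4v≤d)
    (≤-trans (m≤m+n _ (27 * (k * v) + 7 * (k * k))) (≤-reflexive (lem v k)))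
    where
    4v≤d : 4 * v ≤ d
    4v≤d = <⇒≤ (≰⇒> λ le → subst T eq (≤⇒≤ᵇ le))
    k = d ∸ 4 * v
    lem : ∀ v k → 29 * (4 * v + k) * v + (27 * (k * v) + 7 * (k * k))
                  ≡ 4 * (v * v) + (7 * ((4 * v + k) * (4 * v + k)) + 46 * ((4 * v + k) * (4 * v + k)) * 0)
    lem = solve-∀

  goods : ℕ
  goods = ∑ q (λ l → bit (large? l))

  goods-bound : 10 * 2 ^ q ≤ 46 * goods
  goods-bound = *-cancelˡ-≤ (d * d) {{>-nonZero (*-mono-≤ 1≤d 1≤d)}}
    (+-cancelˡ-≤ (19 * (d * d) * 2 ^ q) _ _ (begin
      19 * (d * d) * K + d * d * (10 * K)                    ≡⟨ lem₁ d K ⟩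
      29 * d * (d * K)                                       ≡⟨ cong (29 * d *_) (second-moment q x y) ⟨
      29 * d * ∑ q v                                         ≡⟨ ∑-* q (29 * d) v ⟨
      ∑ q (λ l → 29 * d * v l)                               ≤⟨ ∑-mono q (λ l _ → pointwise (v l) (large? l) refl) ⟩
      ∑ q (λ l → 4 * (v l * v l) + (7 * (d * d) + 46 * (d * d) * bit (large? l)))
        ≡⟨ trans (∑-+ q (λ l → 4 * (v l * v l)) _) (cong₂ _+_ (∑-* q 4 (λ l → v l * v l))
             (trans (∑-+ q (λ _ → 7 * (d * d)) _) (cong₂ _+_ (∑-const q _) (∑-* q (46 * (d * d)) _)))) ⟩
      4 * ∑ q (λ l → v l * v l) + (K * (7 * (d * d)) + 46 * (d * d) * goods)
        ≤⟨ +-monoˡ-≤ _ (*-monoʳ-≤ 4 (≤-trans (m≤m+n _ (2 * d * K)) (≤-reflexive (fourth-moment q x y)))) ⟩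
      4 * (3 * (d * d) * K) + (K * (7 * (d * d)) + 46 * (d * d) * goods) ≡⟨ lem₂ d K goods ⟩
      19 * (d * d) * K + d * d * (46 * goods) ∎))
    where
    open ≤-Reasoning
    K = 2 ^ q
    v : List Bool → ℕ
    v l = gap q x y l * gap q x y l
    lem₁ : ∀ d t → 19 * (d * d) * t + d * d * (10 * t) ≡ 29 * d * (d * t)
    lem₁ = solve-∀
    lem₂ : ∀ d t g → 4 * (3 * (d * d) * t) + (t * (7 * (d * d)) + 46 * (d * d) * g) ≡ 19 * (d * d) * t + d * d * (46 * g)
    lem₂ = solve-∀

  ∑-weight : ∑ q (λ l → 16 * weight l) ≤ 29 * 2 ^ q
  ∑-weight = *-cancelˡ-≤ 46 (+-cancelʳ-≤ (16 * (10 * K)) _ _ (begin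
    46 * ∑ q (λ l → 16 * weight l) + 16 * (10 * K) ≤⟨ +-monoʳ-≤ (46 * ∑ q (λ l → 16 * weight l)) (*-monoʳ-≤ 16 goods-bound) ⟩
    46 * ∑ q (λ l → 16 * weight l) + 16 * (46 * goods) ≡⟨ lem₁ (∑ q (λ l → 16 * weight l)) goods ⟩
    46 * (∑ q (λ l → 16 * weight l) + 16 * goods) ≡⟨ cong (λ z → 46 * (∑ q (λ l → 16 * weight l) + z)) (∑-* q 16 (λ l → bit (large? l))) ⟨
    46 * (∑ q (λ l → 16 * weight l) + ∑ q (λ l → 16 * bit (large? l))) ≡⟨ cong (46 *_) (∑-+ q (λ l → 16 * weight l) _) ⟨
    46 * ∑ q (λ l → 16 * weight l + 16 * bit (large? l)) ≡⟨ cong (46 *_) (trans (∑-cong q (λ l _ → total (large? l))) (∑-const q 32)) ⟩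
    46 * (K * 32) ≤⟨ m≤m+n _ (22 * K) ⟩
    46 * (K * 32) + 22 * K ≡⟨ lem₂ K ⟩
    46 * (29 * K) + 16 * (10 * K) ∎))
    where
    open ≤-Reasoning
    K = 2 ^ q
    total : ∀ b → 16 * (2 ∸ bit b) + 16 * bit b ≡ 32
    total true  = refl
    total false = refl
    lem₁ : ∀ w g → 46 * w + 16 * (46 * g) ≡ 46 * (w + 16 * g)
    lem₁ = solve-∀
    lem₂ : ∀ t → 46 * (t * 32) + 22 * t ≡ 46 * (29 * t) + 16 * (10 * t)
    lem₂ = solve-∀

  weight-prod : ∀ m l → rowProd m q (λ l → 16 * weight l) l * 2 ^ rowSum m q (λ l → bit (large? l)) l ≡ 32 ^ m
  weight-prod zero    l = refl
  weight-prod (suc m) l = trans (cong (16 * weight l * P *_) (^-distribˡ-+-* 2 (bit (large? l)) S))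
    (trans (lem (16 * weight l) P (2 ^ bit (large? l)) (2 ^ S))
      (cong₂ _*_ (one (large? l)) (weight-prod m (List.drop q l))))
    where
    P = rowProd m q (λ l → 16 * weight l) (List.drop q l)
    S = rowSum m q (λ l → bit (large? l)) (List.drop q l)
    lem : ∀ a b c d → a * b * (c * d) ≡ a * c * (b * d)
    lem = solve-∀
    one : ∀ b → 16 * (2 ∸ bit b) * 2 ^ bit b ≡ 32
    one true  = refl
    one false = refl

  tail : ∀ m n → n * n ≤ d →
         ∑ (16 * m * q) (λ l → bit (2 * rowSum (16 * m) q (gap q x y) l <ᵇ m * n)) * 2 ^ m ≤ 2 ^ (16 * m * q)
  tail m n n²≤d = *-cancelʳ-≤ _ _ (2 ^ (78 * m)) {{m^n≢0 2 (78 * m)}} (begin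
    N * 2 ^ m * 2 ^ (78 * m)          ≡⟨ *-assoc N (2 ^ m) _ ⟩
    N * (2 ^ m * 2 ^ (78 * m))        ≡⟨ cong (N *_) (^-distribˡ-+-* 2 m (78 * m)) ⟨
    N * 2 ^ (79 * m)                  ≤⟨ markov (16 * m) q (λ l → 16 * weight l) few (29 * 2 ^ q) (2 ^ (79 * m)) local ∑-weight heavy ⟩
    (29 * 2 ^ q) ^ (16 * m)           ≡⟨ ^-distribʳ-* (16 * m) 29 (2 ^ q) ⟩
    29 ^ (16 * m) * (2 ^ q) ^ (16 * m) ≡⟨ cong₂ _*_ (sym (^-*-assoc 29 16 m)) (trans (^-*-assoc 2 q (16 * m)) (cong (2 ^_) (*-comm q (16 * m)))) ⟩
    (29 ^ 16) ^ m * 2 ^ (16 * m * q)  ≤⟨ *-monoˡ-≤ (2 ^ (16 * m * q)) (^-monoˡ-≤ m 29^16≤2^78) ⟩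
    (2 ^ 78) ^ m * 2 ^ (16 * m * q)   ≡⟨ cong (_* 2 ^ (16 * m * q)) (^-*-assoc 2 78 m) ⟩
    2 ^ (78 * m) * 2 ^ (16 * m * q)   ≡⟨ *-comm (2 ^ (78 * m)) _ ⟩
    2 ^ (16 * m * q) * 2 ^ (78 * m)   ∎)
    where
    open ≤-Reasoning
    few : List Bool → Bool
    few l = 2 * rowSum (16 * m) q (gap q x y) l <ᵇ m * n
    N = ∑ (16 * m * q) (λ l → bit (few l))
    29^16≤2^78 : 29 ^ 16 ≤ 2 ^ 78
    29^16≤2^78 = toWitness {a? = 29 ^ 16 ≤? 2 ^ 78} tt
    local : ∀ l l' → length l ≡ q → 16 * weight (l ++ l') ≡ 16 * weight l
    local l l' eq = cong (λ g → 16 * (2 ∸ bit (d ≤ᵇ 4 * (g * g)))) (gap-++ q x y l l' eq)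
    one-row : ∀ l b → large? l ≡ b → n * bit b ≤ 2 * gap q x y l
    one-row l false eq = ≤-trans (≤-reflexive (*-zeroʳ n)) z≤n
    one-row l true  eq = ≤-trans (≤-reflexive (*-identityʳ n)) (≮⇒≥ λ lt → <⇒≱ (*-mono-< lt lt)
      (≤-trans n²≤d (≤-trans (≤ᵇ⇒≤ d _ (subst T (sym eq) tt)) (≤-reflexive (lem (gap q x y l))))))
      where lem : ∀ g → 4 * (g * g) ≡ 2 * g * (2 * g)
            lem = solve-∀
    all-rows : ∀ k l → n * rowSum k q (λ l → bit (large? l)) l ≤ 2 * rowSum k q (gap q x y) l
    all-rows zero    l = ≤-reflexive (*-zeroʳ n)
    all-rows (suc k) l = ≤-trans (≤-reflexive (*-distribˡ-+ n (bit (large? l)) _))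
      (≤-trans (+-mono-≤ (one-row l (large? l) refl) (all-rows k (List.drop q l)))
        (≤-reflexive (sym (*-distribˡ-+ 2 (gap q x y l) _))))
    heavy : ∀ l → few l ≡ true → 2 ^ (79 * m) ≤ rowProd (16 * m) q (λ l → 16 * weight l) l
    heavy l eq = *-cancelʳ-≤ _ _ (2 ^ m) {{m^n≢0 2 m}} (begin
      2 ^ (79 * m) * 2 ^ m  ≡⟨ ^-distribˡ-+-* 2 (79 * m) m ⟨
      2 ^ (79 * m + m)      ≡⟨ cong (2 ^_) (lem m) ⟩
      2 ^ (5 * (16 * m))    ≡⟨ ^-*-assoc 2 5 (16 * m) ⟨
      32 ^ (16 * m)         ≡⟨ weight-prod (16 * m) l ⟨
      P * 2 ^ S             ≤⟨ *-monoʳ-≤ P (^-monoʳ-≤ 2 (<⇒≤ S<m)) ⟩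
      P * 2 ^ m             ∎)
      where
      P = rowProd (16 * m) q (λ l → 16 * weight l) l
      S = rowSum (16 * m) q (λ l → bit (large? l)) l
      lem : ∀ m → 79 * m + m ≡ 5 * (16 * m)
      lem = solve-∀
      S<m : S < m
      S<m = *-cancelˡ-< n S m (≤-<-trans (all-rows (16 * m) l)
        (subst (2 * rowSum (16 * m) q (gap q x y) l <_) (*-comm m n) (<ᵇ⇒< _ _ (subst T (sym eq) tt))))

-- Upper tail: exponential moments with base (n + 1) / n, where n² ≥ d.

bernoulli : ∀ x d → suc x ^ d * suc x ≤ x ^ d * suc x + d * suc x ^ d
bernoulli x zero    = m≤m+n _ 0
bernoulli x (suc d) = begin
  suc x * suc x ^ d * suc x                          ≡⟨ *-assoc (suc x) (suc x ^ d) (suc x) ⟩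
  suc x * (suc x ^ d * suc x)                        ≤⟨ *-monoʳ-≤ (suc x) (bernoulli x d) ⟩
  suc x * (x ^ d * suc x + d * suc x ^ d)            ≡⟨ lem₁ x (x ^ d) d (suc x ^ d) ⟩
  x * x ^ d * suc x + d * (suc x * suc x ^ d) + x ^ d * suc x
    ≤⟨ +-monoʳ-≤ (x * x ^ d * suc x + d * (suc x * suc x ^ d)) (*-monoˡ-≤ (suc x) (^-monoˡ-≤ d (n≤1+n x))) ⟩
  x * x ^ d * suc x + d * (suc x * suc x ^ d) + suc x ^ d * suc x
    ≡⟨ lem₂ (x * x ^ d * suc x) d (suc x) (suc x ^ d) ⟩
  x * x ^ d * suc x + suc d * (suc x * suc x ^ d)    ∎
  where
  open ≤-Reasoning
  lem₁ : ∀ x a d b → suc x * (a * suc x + d * b) ≡ x * a * suc x + d * (suc x * b) + a * suc x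
  lem₁ = solve-∀
  lem₂ : ∀ a d s b → a + d * (s * b) + b * s ≡ a + suc d * (s * b)
  lem₂ = solve-∀

half-bernoulli : ∀ x d → 2 * d ≤ suc x → suc x ^ d ≤ 2 * x ^ d
half-bernoulli x d 2d≤ = *-cancelʳ-≤ _ _ (suc x) (+-cancelˡ-≤ (suc x ^ d * suc x) _ _ (begin
  suc x ^ d * suc x + suc x ^ d * suc x       ≡⟨ lem₁ (suc x ^ d * suc x) ⟩
  2 * (suc x ^ d * suc x)                     ≤⟨ *-monoʳ-≤ 2 (bernoulli x d) ⟩
  2 * (x ^ d * suc x + d * suc x ^ d)         ≡⟨ lem₂ (x ^ d) (suc x) d (suc x ^ d) ⟩
  suc x ^ d * (2 * d) + 2 * x ^ d * suc x     ≤⟨ +-monoˡ-≤ _ (*-monoʳ-≤ (suc x ^ d) 2d≤) ⟩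
  suc x ^ d * suc x + 2 * x ^ d * suc x       ∎))
  where
  open ≤-Reasoning
  lem₁ : ∀ a → a + a ≡ 2 * a
  lem₁ = solve-∀
  lem₂ : ∀ a s d b → 2 * (a * s + d * b) ≡ b * (2 * d) + 2 * a * s
  lem₂ = solve-∀

lin-bernoulli : ∀ n k → n ^ k * (n + k) ≤ n * suc n ^ k
lin-bernoulli n zero    = ≤-reflexive (lem n)
  where lem : ∀ n → 1 * (n + 0) ≡ n * 1
        lem = solve-∀
lin-bernoulli n (suc k) = begin
  n * n ^ k * (n + suc k)             ≤⟨ m≤m+n _ (n ^ k * k) ⟩
  n * n ^ k * (n + suc k) + n ^ k * k ≡⟨ lem n k (n ^ k) ⟩
  suc n * (n ^ k * (n + k))           ≤⟨ *-monoʳ-≤ (suc n) (lin-bernoulli n k) ⟩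
  suc n * (n * suc n ^ k)             ≡⟨ lem₂ n (suc n) (suc n ^ k) ⟩
  n * (suc n * suc n ^ k)             ∎
  where
  open ≤-Reasoning
  lem : ∀ n k a → n * a * (n + suc k) + a * k ≡ suc n * (a * (n + k))
  lem = solve-∀
  lem₂ : ∀ n s a → s * (n * a) ≡ n * (s * a)
  lem₂ = solve-∀

module Upper (q : ℕ) (x y : Point) (n : ℕ) (1≤n : 1 ≤ n) (d≤n² : dist q x y ≤ n * n) where
  d = dist q x y

  instance
    n≢0 : NonZero n
    n≢0 = >-nonZero 1≤n

  ψ : ℕ → ℕ → ℕ
  ψ e z = suc n ^ (e + z) * n ^ (e ∸ z) + suc n ^ (e ∸ z) * n ^ (e + z)

  c c₀ : ℕ
  c  = suc n * suc n + n * n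
  c₀ = n * suc n

  ψ-walk : ∀ e z → z ≤ e → ψ (suc e) (suc z) + ψ (suc e) ∣ z - 1 ∣ ≡ c * ψ e z
  ψ-walk e zero z≤n rewrite +-identityʳ e | +-comm e 1 = lem (suc n) n (suc n ^ e) (n ^ e)
    where
    lem : ∀ a b p r → a * (a * p) * r + p * (b * (b * r)) + (a * (a * p) * r + p * (b * (b * r)))
                      ≡ (a * a + b * b) * (p * r + p * r)
    lem = solve-∀
  ψ-walk (suc e) (suc z) (s≤s z≤e) rewrite ∣-∣-identityʳ z | +-∸-assoc 2 z≤e | +-suc e (suc z) | +-suc e z =
    lem (suc n) n (suc n ^ (e + z)) (n ^ (e ∸ z)) (suc n ^ (e ∸ z)) (n ^ (e + z))
    where
    lem : ∀ a b p r p' r' →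
      a * (a * (a * (a * p))) * r + p' * (b * (b * (b * (b * r')))) + (a * (a * p) * (b * (b * r)) + a * (a * p') * (b * (b * r')))
      ≡ (a * a + b * b) * (a * (a * p) * r + p' * (b * (b * r')))
    lem = solve-∀

  ∑-ψ : ∀ q x y → ∑ q (λ l → ψ (dist q x y) (gap q x y l)) * 2 ^ dist q x y ≡ 2 * c ^ dist q x y * 2 ^ q
  ∑-ψ zero    x y = refl
  ∑-ψ (suc q) x y = trans (cong (_* 2 ^ dist (suc q) x y) (∑-gap (ψ (dist (suc q) x y)) q x y)) (go (x 0 xor y 0))
    where
    e = dist q (x ∘ suc) (y ∘ suc)
    g = gap q (x ∘ suc) (y ∘ suc)
    go : ∀ b → (if b then ∑ q (λ l → ψ (bit b + e) (suc (g l)) + ψ (bit b + e) ∣ g l - 1 ∣)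
                else 2 * ∑ q (λ l → ψ (bit b + e) (g l))) * 2 ^ (bit b + e) ≡ 2 * c ^ (bit b + e) * 2 ^ suc q
    go false = trans (*-assoc 2 (∑ q (λ l → ψ e (g l))) (2 ^ e))
      (trans (cong (2 *_) (∑-ψ q (x ∘ suc) (y ∘ suc))) (lem (c ^ e) (2 ^ q)))
      where lem : ∀ a t → 2 * (2 * a * t) ≡ 2 * a * (2 * t)
            lem = solve-∀
    go true = trans (cong (_* (2 * 2 ^ e)) (trans (∑-cong q (λ l _ → ψ-walk e (g l) (gap≤dist q (x ∘ suc) (y ∘ suc) l)))
                (∑-* q c (λ l → ψ e (g l)))))
      (trans (lem₁ c (∑ q (λ l → ψ e (g l))) (2 ^ e))
      (trans (cong (λ z → 2 * (c * z)) (∑-ψ q (x ∘ suc) (y ∘ suc))) (lem₂ c (c ^ e) (2 ^ q))))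
      where
      lem₁ : ∀ c s t → c * s * (2 * t) ≡ 2 * (c * (s * t))
      lem₁ = solve-∀
      lem₂ : ∀ c a t → 2 * (c * (2 * a * t)) ≡ 2 * (c * a) * (2 * t)
      lem₂ = solve-∀

  ∑-ψ≤ : ∑ q (λ l → ψ d (gap q x y l)) ≤ 4 * c₀ ^ d * 2 ^ q
  ∑-ψ≤ = *-cancelʳ-≤ _ _ (2 ^ d) {{m^n≢0 2 d}} (begin
    ∑ q (λ l → ψ d (gap q x y l)) * 2 ^ d ≡⟨ ∑-ψ q x y ⟩
    2 * c ^ d * 2 ^ q                     ≡⟨ cong (λ z → 2 * z ^ d * 2 ^ q) (c-eq n) ⟩
    2 * suc (2 * c₀) ^ d * 2 ^ q          ≤⟨ *-monoˡ-≤ (2 ^ q) (*-monoʳ-≤ 2 (half-bernoulli (2 * c₀) d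
                                               (≤-trans (*-monoʳ-≤ 2 (≤-trans d≤n² (*-monoʳ-≤ n (n≤1+n n)))) (n≤1+n (2 * c₀))))) ⟩
    2 * (2 * (2 * c₀) ^ d) * 2 ^ q        ≡⟨ cong (λ z → 2 * (2 * z) * 2 ^ q) (^-distribʳ-* d 2 c₀) ⟩
    2 * (2 * (2 ^ d * c₀ ^ d)) * 2 ^ q    ≡⟨ lem (2 ^ d) (c₀ ^ d) (2 ^ q) ⟩
    4 * c₀ ^ d * 2 ^ q * 2 ^ d            ∎)
    where
    open ≤-Reasoning
    c-eq : ∀ n → suc n * suc n + n * n ≡ suc (2 * (n * suc n))
    c-eq = solve-∀
    lem : ∀ a b t → 2 * (2 * (a * b)) * t ≡ 4 * b * t * a
    lem = solve-∀

  ψ-large : ∀ z → z ≤ d → c₀ ^ d * suc n ^ z ≤ ψ d z * n ^ z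
  ψ-large z z≤d = ≤-trans (≤-reflexive (begin-equality
    c₀ ^ d * suc n ^ z                              ≡⟨ cong (_* suc n ^ z) (^-distribʳ-* d n (suc n)) ⟩
    n ^ d * suc n ^ d * suc n ^ z                   ≡⟨ *-assoc (n ^ d) _ _ ⟩
    n ^ d * (suc n ^ d * suc n ^ z)                 ≡⟨ cong₂ _*_ (cong (n ^_) (sym (m∸n+n≡m z≤d))) (sym (^-distribˡ-+-* (suc n) d z)) ⟩
    n ^ (d ∸ z + z) * suc n ^ (d + z)               ≡⟨ cong (_* suc n ^ (d + z)) (^-distribˡ-+-* n (d ∸ z) z) ⟩
    n ^ (d ∸ z) * n ^ z * suc n ^ (d + z)           ≡⟨ lem (n ^ (d ∸ z)) (n ^ z) (suc n ^ (d + z)) ⟩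
    suc n ^ (d + z) * n ^ (d ∸ z) * n ^ z           ∎))
    (*-monoˡ-≤ (n ^ z) (m≤m+n (suc n ^ (d + z) * n ^ (d ∸ z)) _))
    where
    open ≤-Reasoning
    lem : ∀ a b c → a * b * c ≡ c * a * b
    lem = solve-∀

  prod-large : ∀ m l → (c₀ ^ d) ^ m * suc n ^ rowSum m q (gap q x y) l
                       ≤ rowProd m q (λ l → ψ d (gap q x y l)) l * n ^ rowSum m q (gap q x y) l
  prod-large zero    l = ≤-refl
  prod-large (suc m) l = begin
    c₀ ^ d * (c₀ ^ d) ^ m * suc n ^ (g + S)        ≡⟨ cong (c₀ ^ d * (c₀ ^ d) ^ m *_) (^-distribˡ-+-* (suc n) g S) ⟩
    c₀ ^ d * (c₀ ^ d) ^ m * (suc n ^ g * suc n ^ S) ≡⟨ lem (c₀ ^ d) ((c₀ ^ d) ^ m) (suc n ^ g) (suc n ^ S) ⟩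
    c₀ ^ d * suc n ^ g * ((c₀ ^ d) ^ m * suc n ^ S) ≤⟨ *-mono-≤ (ψ-large g (gap≤dist q x y l)) (prod-large m (List.drop q l)) ⟩
    ψ d g * n ^ g * (P * n ^ S)                    ≡⟨ lem (ψ d g) (n ^ g) P (n ^ S) ⟩
    ψ d g * P * (n ^ g * n ^ S)                    ≡⟨ cong (ψ d g * P *_) (^-distribˡ-+-* n g S) ⟨
    ψ d g * P * n ^ (g + S)                        ∎
    where
    open ≤-Reasoning
    g = gap q x y l
    S = rowSum m q (gap q x y) (List.drop q l)
    P = rowProd m q (λ l → ψ d (gap q x y l)) (List.drop q l)
    lem : ∀ a b c d → a * b * (c * d) ≡ a * c * (b * d)
    lem = solve-∀

  2n^n≤ : 2 * n ^ n ≤ suc n ^ n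
  2n^n≤ = *-cancelˡ-≤ n (≤-trans (≤-reflexive (lem n (n ^ n))) (lin-bernoulli n n))
    where lem : ∀ n a → n * (2 * a) ≡ a * (n + n)
          lem = solve-∀

  exp-growth : ∀ k S → n * k ≤ S → 2 ^ k * n ^ S ≤ suc n ^ S
  exp-growth k S le = subst (λ S → 2 ^ k * n ^ S ≤ suc n ^ S) (m+[n∸m]≡n le) (begin
    2 ^ k * n ^ (n * k + r)           ≡⟨ cong (2 ^ k *_) (trans (^-distribˡ-+-* n (n * k) r) (cong (_* n ^ r) (sym (^-*-assoc n n k)))) ⟩
    2 ^ k * ((n ^ n) ^ k * n ^ r)     ≡⟨ *-assoc (2 ^ k) _ _ ⟨
    2 ^ k * (n ^ n) ^ k * n ^ r       ≡⟨ cong (_* n ^ r) (^-distribʳ-* k 2 (n ^ n)) ⟨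
    (2 * n ^ n) ^ k * n ^ r           ≤⟨ *-mono-≤ (^-monoˡ-≤ k 2n^n≤) (^-monoˡ-≤ r (n≤1+n n)) ⟩
    (suc n ^ n) ^ k * suc n ^ r       ≡⟨ trans (cong (_* suc n ^ r) (^-*-assoc (suc n) n k)) (sym (^-distribˡ-+-* (suc n) (n * k) r)) ⟩
    suc n ^ (n * k + r)               ∎)
    where
    open ≤-Reasoning
    r = S ∸ n * k

  tail : ∀ m → ∑ (m * q) (λ l → bit (n * (3 * m) ≤ᵇ rowSum m q (gap q x y) l)) * 2 ^ m ≤ 2 ^ (m * q)
  tail m = *-cancelʳ-≤ _ _ (C * 2 ^ (2 * m)) {{m*n≢0 C _ {{C≢0}} {{m^n≢0 2 (2 * m)}}}} (begin
    N * 2 ^ m * (C * 2 ^ (2 * m))         ≡⟨ lem₁ N (2 ^ m) C (2 ^ (2 * m)) ⟩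
    N * (C * (2 ^ m * 2 ^ (2 * m)))       ≡⟨ cong (λ z → N * (C * z)) (^-distribˡ-+-* 2 m (2 * m)) ⟨
    N * (C * 2 ^ (3 * m))                 ≤⟨ markov m q (λ l → ψ d (gap q x y l)) many (4 * c₀ ^ d * 2 ^ q) (C * 2 ^ (3 * m)) local ∑-ψ≤ heavy ⟩
    (4 * c₀ ^ d * 2 ^ q) ^ m              ≡⟨ trans (^-distribʳ-* m (4 * c₀ ^ d) (2 ^ q)) (cong (_* (2 ^ q) ^ m) (^-distribʳ-* m 4 (c₀ ^ d))) ⟩
    4 ^ m * C * (2 ^ q) ^ m               ≡⟨ cong₂ (λ a b → a * C * b) (^-*-assoc 2 2 m) (trans (^-*-assoc 2 q m) (cong (2 ^_) (*-comm q m))) ⟩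
    2 ^ (2 * m) * C * 2 ^ (m * q)         ≡⟨ lem₂ (2 ^ (2 * m)) C (2 ^ (m * q)) ⟩
    2 ^ (m * q) * (C * 2 ^ (2 * m))       ∎)
    where
    open ≤-Reasoning
    C = (c₀ ^ d) ^ m
    C≢0 : NonZero C
    C≢0 = m^n≢0 _ m {{m^n≢0 c₀ d {{m*n≢0 n (suc n)}}}}
    many : List Bool → Bool
    many l = n * (3 * m) ≤ᵇ rowSum m q (gap q x y) l
    N = ∑ (m * q) (λ l → bit (many l))
    lem₁ : ∀ n a c b → n * a * (c * b) ≡ n * (c * (a * b))
    lem₁ = solve-∀
    lem₂ : ∀ a c b → a * c * b ≡ b * (c * a)
    lem₂ = solve-∀
    local : ∀ l l' → length l ≡ q → ψ d (gap q x y (l ++ l')) ≡ ψ d (gap q x y l)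
    local l l' eq = cong (ψ d) (gap-++ q x y l l' eq)
    heavy : ∀ l → many l ≡ true → C * 2 ^ (3 * m) ≤ rowProd m q (λ l → ψ d (gap q x y l)) l
    heavy l eq = *-cancelʳ-≤ _ _ (n ^ S) {{m^n≢0 n S}} (begin
      C * 2 ^ (3 * m) * n ^ S   ≡⟨ *-assoc C _ _ ⟩
      C * (2 ^ (3 * m) * n ^ S) ≤⟨ *-monoʳ-≤ C (exp-growth (3 * m) S (≤ᵇ⇒≤ (n * (3 * m)) S (subst T (sym eq) tt))) ⟩
      C * suc n ^ S             ≤⟨ prod-large m l ⟩
      rowProd m q (λ l → ψ d (gap q x y l)) l * n ^ S ∎)
      where S = rowSum m q (gap q x y) l

-- The program

-- Arrays, all one-dimensional.  In is the input, shifted by one; Z has the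
-- coordinates of the points (the rows of A, then the columns of B), S the random
-- signs and Y the sketches.  For a point, Δ is the distance to its nearest center,
-- cp that center (as a point) and asg its index in ctr, where the centers of each
-- side start at the index of its first point.  D lists the cnt coordinates where
-- a point differs from its center.  Gr has the products of centers, and hd keeps
-- p, q and k for the queries.
pattern In  = 0
pattern Z   = 1
pattern S   = 2
pattern Y   = 3
pattern Δ   = 4
pattern asg = 5
pattern cp  = 6
pattern ctr = 7
pattern D   = 8
pattern cnt = 9
pattern Gr  = 10
pattern hd  = 11

-- Variables of the preprocessing: 0-4 parameters, 5 the constant C, 6 the input
-- size, 7 p + r, 10 and 11 a logarithm and its power of 2, 12 the sketch length;
-- 13-15 a point, a position in a sketch, a coordinate; 16 a sum; 17-19 the first
-- point, the number of points and the number of centers of a side; 20-26 and 30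
-- the traversal; 27 a coin; 28, 29 two centers.
--
-- The input is moved from the top down, as its target overlaps it.
copyCell copyInput : Cmd
copyCell =
  9 := var 6 ⊖ lit 1 ⊖ var 8 ⨾
  wr In (var 9 ⊕ lit 1) (lit 1 ⊖ (lit 1 ⊖ raw (var 9)))
copyInput =
  6 := var 0 ⊛ var 1 ⊕ var 1 ⊛ var 2 ⨾
  for 8 (var 6) copyCell

doubling computeLog : Cmd
doubling = ifz (var 7 ⊖ var 11) skip (
  11 := (var 7 ⊕ var 7) ⊖ ((var 7 ⊕ var 7) ⊖ (var 11 ⊕ var 11)) ⨾
  10 := var 7 ⊖ (var 7 ⊖ (var 10 ⊕ lit 1)))
computeLog =
  7 := var 0 ⊕ var 2 ⨾
  10 := lit 0 ⨾
  11 := lit 1 ⨾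
  for 8 (var 7) doubling ⨾
  12 := lit 16 ⊛ (var 5 ⊛ var 10)

flipCoin flipCoins : Cmd
flipCoin  = flp 27 ⨾ wr S (var 8) (var 27)
flipCoins = for 8 (var 12 ⊛ var 1) flipCoin

rowCell colCell rowPoints colPoints : Cmd
rowCell   = wr Z (var 13 ⊛ var 1 ⊕ var 15) (rd In (var 13 ⊛ var 1 ⊕ var 15 ⊕ lit 1))
rowPoints = for 13 (var 0) (for 15 (var 1) rowCell)
colCell   = wr Z ((var 0 ⊕ var 13) ⊛ var 1 ⊕ var 15)
                 (rd In (var 0 ⊛ var 1 ⊕ (var 15 ⊛ var 2 ⊕ var 13) ⊕ lit 1))
colPoints = for 13 (var 2) (for 15 (var 1) colCell)

coord : Expr → Expr
coord g = rd Z (g ⊛ var 1 ⊕ var 15)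

coin : Expr
coin = rd S (var 14 ⊛ var 1 ⊕ var 15)

sketchTerm : Expr
sketchTerm = coord (var 13) ⊛ (coin ⊕ coin) ⊕ (lit 1 ⊖ coord (var 13))

sketchCell sketches : Cmd
sketchCell =
  16 := lit 0 ⨾
  for 15 (var 1) (16 := var 16 ⊕ sketchTerm) ⨾
  wr Y (var 13 ⊛ var 12 ⊕ var 14) ((var 1 ⊕ var 1) ⊖ ((var 1 ⊕ var 1) ⊖ var 16))
sketches = for 13 (var 7) (for 14 (var 12) sketchCell)

sk : Expr → Expr
sk g = rd Y (g ⊛ var 12 ⊕ var 14)

farther farthest gapTo take update centerStep centers : Cmd
farther = ifz (rd Δ (var 17 ⊕ var 23) ⊖ var 22) skip
  (21 := var 23 ⨾ 22 := rd Δ (var 17 ⊕ var 23))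
farthest =
  21 := lit 0 ⨾
  22 := lit 0 ⨾
  for 23 (var 18) farther

gapTerm : Expr
gapTerm = (sk (var 17 ⊕ var 23) ⊖ sk (var 30)) ⊕ (sk (var 30) ⊖ sk (var 17 ⊕ var 23))

gapTo =
  24 := lit 0 ⨾
  for 14 (var 12) (24 := var 24 ⊕ gapTerm)
take = wr Δ (var 17 ⊕ var 23) (var 24) ⨾ wr asg (var 17 ⊕ var 23) (var 20) ⨾ wr cp (var 17 ⊕ var 23) (var 30)
update =
  25 := rd Δ (var 17 ⊕ var 23) ⨾
  ifz (var 20) (25 := var 24 ⊕ lit 1) skip ⨾
  ifz ((var 24 ⊕ lit 1) ⊖ var 25) take skip
centerStep =
  farthest ⨾
  30 := var 17 ⊕ var 21 ⨾
  wr ctr (var 17 ⊕ var 20) (var 30) ⨾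
  for 23 (var 18) (gapTo ⨾ update)
centers = for 20 (var 19) centerStep

rowCenters colCenters : Cmd
rowCenters = 17 := lit 0 ⨾ 18 := var 0 ⨾ 19 := var 3 ⨾ centers
colCenters = 17 := var 0 ⨾ 18 := var 2 ⨾ 19 := var 4 ⨾ centers

noteDifference differences : Cmd
noteDifference =
  wr D (var 13 ⊛ var 1 ⊕ (var 1 ⊖ (var 1 ⊖ var 26))) (var 15) ⨾
  26 := var 26 ⊕ lit 1

differ : Expr
differ = (coord (var 13) ⊖ coord (rd cp (var 13))) ⊕ (coord (rd cp (var 13)) ⊖ coord (var 13))

differenceList : Cmd
differenceList =
  26 := lit 0 ⨾
  for 15 (var 1) (ifz differ skip noteDifference) ⨾
  wr cnt (var 13) (var 26)
differences = for 13 (var 7) differenceList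

gramTerm : Expr
gramTerm = coord (rd ctr (var 28)) ⊛ coord (rd ctr (var 0 ⊕ var 29))

gramCell gram : Cmd
gramCell =
  16 := lit 0 ⨾
  for 15 (var 1) (16 := var 16 ⊕ gramTerm) ⨾
  wr Gr (var 28 ⊛ var 4 ⊕ var 29) (var 16)
gram = for 28 (var 3) (for 29 (var 4) gramCell)

header : Cmd
header = wr hd (lit 0) (var 0) ⨾ wr hd (lit 1) (var 1) ⨾ wr hd (lit 2) (var 4)

preprocess : Cmd
preprocess = copyInput ⨾ computeLog ⨾ flipCoins ⨾ rowPoints ⨾ colPoints ⨾ sketches ⨾
             rowCenters ⨾ colCenters ⨾ differences ⨾ gram ⨾ header

coordQ : ℕ → Expr
coordQ g = rd Z (var g ⊛ var 3 ⊕ var 11)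

-- Variables of a query: 0, 1 the indices i and j; 2-4 p, q and k; 5 the point
-- p + j; 6, 7 the centers; 8, 9 the positive and the negative part of the answer.
rowTerm colTerm query : Cmd
rowTerm =
  11 := rd D (var 0 ⊛ var 3 ⊕ var 10) ⨾
  8 := var 8 ⊕ coordQ 0 ⊛ coordQ 7 ⨾
  9 := var 9 ⊕ coordQ 6 ⊛ coordQ 7
colTerm =
  11 := rd D (var 5 ⊛ var 3 ⊕ var 10) ⨾
  8 := var 8 ⊕ coordQ 0 ⊛ coordQ 5 ⨾
  9 := var 9 ⊕ coordQ 0 ⊛ coordQ 7
query =
  2 := rd hd (lit 0) ⨾
  3 := rd hd (lit 1) ⨾
  4 := rd hd (lit 2) ⨾
  5 := var 2 ⊕ var 1 ⨾
  6 := rd cp (var 0) ⨾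
  7 := rd cp (var 5) ⨾
  8 := rd Gr (rd asg (var 0) ⊛ var 4 ⊕ rd asg (var 5)) ⨾
  9 := lit 0 ⨾
  for 10 (rd cnt (var 0)) rowTerm ⨾
  for 10 (rd cnt (var 5)) colTerm ⨾
  0 := var 3 ⊖ (var 3 ⊖ (var 8 ⊖ var 9))

sizes : List Size → ℕ → Size
sizes []       _       = small 1
sizes (s ∷ ss) zero    = s
sizes (s ∷ ss) (suc n) = sizes ss n

preVarSizes preArrSizes queryVarSizes : List Size
preVarSizes =
  small 1 ∷ small 1 ∷ small 1 ∷ small 1 ∷ small 1 ∷ small 1 ∷ small 3 ∷ small 2 ∷
  small 5 ∷ small 3 ∷ small 2 ∷ small 3 ∷ small 4 ∷ small 2 ∷ small 4 ∷ small 1 ∷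
  large 0 ∷ small 1 ∷ small 1 ∷ small 1 ∷ small 1 ∷ small 1 ∷ large 0 ∷ small 1 ∷
  large 0 ∷ large 0 ∷ large 0 ∷ small 1 ∷ small 1 ∷ small 1 ∷ small 2 ∷ []
preArrSizes =
  small 1 ∷ small 1 ∷ small 1 ∷ small 2 ∷ large 0 ∷ small 1 ∷ small 2 ∷ small 2 ∷
  small 1 ∷ large 0 ∷ large 0 ∷ []
queryVarSizes =
  small 1 ∷ small 1 ∷ small 1 ∷ small 1 ∷ small 1 ∷ small 2 ∷ small 1 ∷ small 1 ∷
  large 0 ∷ large 0 ∷ []

preCtx queryCtx : Ctx
preCtx = record
  { varSize = sizes preVarSizes ; arrSize = sizes preArrSizes ; maxDeg = 10 ; coinFlips = true }
queryCtx = record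
  { varSize = sizes queryVarSizes ; arrSize = λ _ → small 1 ; maxDeg = 6 ; coinFlips = false }

preprocess-typed : Typing.⊢_ preCtx preprocess
preprocess-typed = from-just (Typing.infer preCtx preprocess)

query-typed : Typing.⊢_ queryCtx query
query-typed = from-just (Typing.infer queryCtx query)

-- Cost bounds for straight-line code (u), for a branch of a conditional (h) and
-- for n rounds of a loop (lp n K); abstract, so that they remain symbolic.
abstract
  u h : ℕ
  u = 200
  h = 100

  u-def : u ≡ 200
  u-def = refl

  h-def : h ≡ 100
  h-def = refl

  lp : ℕ → ℕ → ℕ
  lp n K = 100 + n * (K + 7)

  lp-def : ∀ n K → lp n K ≡ 100 + n * (K + 7)
  lp-def n K = refl

for-rule : ∀ {x e c σ} {_ : T (lenE e ≤ᵇ 98)} (I : ℕ → Env → Set) {K n : ℕ} → evalE e σ ≡ n → I 0 σ →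
           (∀ i σ' → i < n → Frame (for x e c) σ σ' → I i σ' → Outcome c (setV x i σ') K (I (suc i))) →
           Outcome (for x e c) σ (lp n K) (I n)
for-rule {x} {e} {c} {σ} {le} I {K} {n} eq I₀ body =
  weaken (≤-trans (+-monoˡ-≤ (n * (K + 7)) (+-monoˡ-≤ 2 (≤ᵇ⇒≤ (lenE e) 98 le))) (≤-reflexive (sym (lp-def n K)))) (λ _ z → z)
    (loop-rule I K n eq I₀ body)

frame-body : ∀ {x e c i σ σ'} → Frame c (setV x i σ) σ' → Frame (for x e c) σ σ'
frame-body {x} {e} {c} {i} {σ} f = frame
  (λ y eq → trans (sameV f y (∨-falseʳ (y ≡ᵇ x) eq)) (false⇒set-same (V σ) (∨-falseˡ (y ≡ᵇ x) eq)))
  (sameA f) (sameω f)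

straight : ∀ {c σ} {Q : Env → Set} → Q (run c σ) → {_ : T (cost c σ ≤ᵇ 200)} → Outcome c σ u Q
straight {c} {σ} q {le} = outcome q (≤-trans (≤ᵇ⇒≤ (cost c σ) 200 le) (≤-reflexive (sym u-def)))

branch : ∀ {c σ} {Q : Env → Set} → Q (run c σ) → {_ : T (cost c σ ≤ᵇ 100)} → Outcome c σ h Q
branch {c} {σ} q {le} = outcome q (≤-trans (≤ᵇ⇒≤ (cost c σ) 100 le) (≤-reflexive (sym h-def)))

ifz-rule : ∀ {e c d σ Q} {_ : T (lenE e ≤ᵇ 98)} → (evalE e σ ≡ 0 → Outcome c σ h Q) →
           (0 < evalE e σ → Outcome d σ h Q) → Outcome (ifz e c d) σ u Q
ifz-rule {e} {c} {d} {σ} {Q} {le} f g = outcome (proj₁ (go (evalE e σ) refl))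
  (≤-trans (+-mono-≤ (+-monoˡ-≤ 2 (≤ᵇ⇒≤ (lenE e) 98 le)) (proj₂ (go (evalE e σ) refl)))
    (≤-reflexive (trans (cong (100 +_) h-def) (sym u-def))))
  where
  go : ∀ v → evalE e σ ≡ v → Q (if evalE e σ ≡ᵇ 0 then run c σ else run d σ)
                           × (if evalE e σ ≡ᵇ 0 then cost c σ else cost d σ) ≤ h
  go zero    eq = subst (λ v → Q (if v ≡ᵇ 0 then run c σ else run d σ) × (if v ≡ᵇ 0 then cost c σ else cost d σ) ≤ h)
    (sym eq) (holds (f eq) , within (f eq))
  go (suc v) eq = subst (λ v → Q (if v ≡ᵇ 0 then run c σ else run d σ) × (if v ≡ᵇ 0 then cost c σ else cost d σ) ≤ h)
    (sym eq) (holds o , within o)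
    where o = g (subst (0 <_) (sym eq) (s≤s z≤n))

0<m∸n⇒n<m : ∀ {m n} → 0 < m ∸ n → n < m
0<m∸n⇒n<m {m} {n} lt = ≰⇒> λ m≤n → <⇒≱ lt (≤-reflexive (m≤n⇒m∸n≡0 m≤n))

cell-mono : ∀ {m i i' j j'} → i' < i → j' < m → i' * m + j' < i * m + j
cell-mono {m} {i} {i'} {j} {j'} i'<i j'<m = <-≤-trans (+-monoʳ-< (i' * m) j'<m)
  (≤-trans (≤-reflexive (+-comm (i' * m) m)) (≤-trans (*-monoˡ-≤ m i'<i) (m≤m+n (i * m) j)))

tabulate-rule : ∀ {x y e₁ e₂ c σ K} {_ : T (lenE e₁ ≤ᵇ 98)} {_ : T (lenE e₂ ≤ᵇ 98)} a o n m (f : ℕ → ℕ → ℕ) →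
  evalE e₁ σ ≡ n → (x ≡ᵇ y) ∨ modV c x ≡ false →
  (∀ {σ'} i → Frame (for x e₁ (for y e₂ c)) σ σ' → evalE e₂ (setV x i σ') ≡ m) →
  (∀ {σ'} i j → i < n → j < m → Frame (for x e₁ (for y e₂ c)) σ σ' → V σ' x ≡ i →
     Outcome c (setV y j σ') K (λ σ'' → A σ'' a ≡ A σ' a [ (o + i) * m + j ≔ f i j ])) →
  Outcome (for x e₁ (for y e₂ c)) σ (lp n (lp m K))
    (λ σ' → (∀ i j → i < n → j < m → A σ' a ((o + i) * m + j) ≡ f i j)
          × (∀ z → z < o * m → A σ' a z ≡ A σ a z))
tabulate-rule {x} {y} {e₁} {e₂} {c} {σ} {K} {l₁} {l₂} a o n m f en nx em body =
  for-rule {_} {_} {_} {_} {l₁} I en ((λ _ _ ()) , λ _ _ → refl) outer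
  where
  I : ℕ → Env → Set
  I i σ' = (∀ i' j → i' < i → j < m → A σ' a ((o + i') * m + j) ≡ f i' j)
         × (∀ z → z < o * m → A σ' a z ≡ A σ a z)
  outer : ∀ i σ' → i < n → Frame (for x e₁ (for y e₂ c)) σ σ' → I i σ' →
          Outcome (for y e₂ c) (setV x i σ') (lp m K) (I (suc i))
  outer i σ' i<n fr (I₁ , I₂) = weaken ≤-refl finish
    (for-rule {_} {_} {_} {_} {l₂} J (em i fr) ((λ _ ()) , I₁ , I₂) inner)
    where
    J : ℕ → Env → Set
    J j σ'' = (∀ j' → j' < j → A σ'' a ((o + i) * m + j') ≡ f i j') × I i σ''
    finish : ∀ σ'' → J m σ'' → I (suc i) σ''
    finish σ'' (J₁ , I₁ , I₂) = (λ i' j i'< j< → case m<1+n⇒m<n∨m≡n i'< of λ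
      { (inj₁ lt) → I₁ i' j lt j< ; (inj₂ refl) → J₁ j j< }) , I₂
    inner : ∀ j σ'' → j < m → Frame (for y e₂ c) (setV x i σ') σ'' → J j σ'' →
            Outcome c (setV y j σ'') K (J (suc j))
    inner j σ'' j<m fr' (J₁ , I₁ , I₂)
      with body i j i<n j<m (frame-trans fr (frame-body fr'))
             (trans (sameV fr' x nx) (≔-same (V σ') x))
    ... | outcome eq le = outcome
      ( (λ j' j'< → case m<1+n⇒m<n∨m≡n j'< of λ
          { (inj₁ lt) → trans (cong-app eq _) (trans (≔-other (A σ'' a) (<⇒≢ (+-monoʳ-< ((o + i) * m) lt))) (J₁ j' lt))
          ; (inj₂ refl) → trans (cong-app eq _) (≔-same (A σ'' a) ((o + i) * m + j)) })
      , (λ i' j' i'<i j'<m → trans (cong-app eq _) (trans (≔-other (A σ'' a)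
          (<⇒≢ (cell-mono {m} {o + i} (+-monoʳ-< o i'<i) j'<m))) (I₁ i' j' i'<i j'<m)))
      , (λ z z< → trans (cong-app eq _) (trans (≔-other (A σ'' a)
          (<⇒≢ (<-≤-trans z< (≤-trans (*-monoˡ-≤ m (m≤m+n o i)) (m≤m+n _ j))))) (I₂ z z<))))
      le

sum-rule : ∀ {x e t acc σ} {_ : T (lenE e ≤ᵇ 98)} {_ : T (lenE t ≤ᵇ 90)} n f →
  acc ≢ x → evalE e σ ≡ n → V σ acc ≡ 0 →
  (∀ {σ'} i → i < n → Frame (for x e (acc := var acc ⊕ t)) σ σ' → evalE t (setV x i σ') ≡ f i) →
  Outcome (for x e (acc := var acc ⊕ t)) σ (lp n u) (λ σ' → V σ' acc ≡ sumTo n f)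
sum-rule {x} {e} {t} {acc} {σ} {le} {lt} n f ne en z body =
  for-rule {_} {_} {_} {_} {le} (λ i σ' → V σ' acc ≡ sumTo i f) en z
    (λ i σ' i< fr Ii → outcome
      (trans (≔-same (V (setV x i σ')) acc) (trans (cong₂ _+_ (trans (≔-other (V σ') ne) Ii) (body i i< fr)) (sym (sumTo-snoc i f))))
      (≤-trans (≤-reflexive (count (lenE t))) (≤-trans (+-monoʳ-≤ 5 (≤ᵇ⇒≤ (lenE t) 90 lt))
        (≤-trans (m≤m+n 95 105) (≤-reflexive (sym u-def))))))
  where
  count : ∀ n → (2 + n + 1) + 2 ≡ 5 + n
  count n = trans (+-comm (2 + n + 1) 2) (cong (4 +_) (+-comm n 1))

n≤2^⌈log₂n⌉ : ∀ n → n ≤ 2 ^ ⌈log₂ n ⌉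
n≤2^⌈log₂n⌉ n = go n n ≤-refl
  where
  go : ∀ b n → n ≤ b → n ≤ 2 ^ ⌈log₂ n ⌉
  go b       zero          _  = z≤n
  go b       (suc zero)    _  = m^n>0 2 ⌈log₂ 1 ⌉
  go (suc b) n@(suc (suc k)) (s≤s k≤) = begin
    n                             ≡⟨ ⌊n/2⌋+⌈n/2⌉≡n n ⟨
    ⌊ n /2⌋ + ⌈ n /2⌉             ≤⟨ +-monoˡ-≤ ⌈ n /2⌉ (⌊n/2⌋≤⌈n/2⌉ n) ⟩
    ⌈ n /2⌉ + ⌈ n /2⌉             ≡⟨ cong (⌈ n /2⌉ +_) (+-identityʳ ⌈ n /2⌉) ⟨
    2 * ⌈ n /2⌉                   ≤⟨ *-monoʳ-≤ 2 (go b ⌈ n /2⌉ (≤-trans (≤-pred (⌈n/2⌉<n k)) k≤)) ⟩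
    2 * 2 ^ ⌈log₂ ⌈ n /2⌉ ⌉       ≡⟨ cong (λ z → 2 * 2 ^ z) (⌈log₂⌈n/2⌉⌉≡⌈log₂n⌉∸1 n) ⟩
    2 ^ suc (⌈log₂ n ⌉ ∸ 1)       ≡⟨ cong (2 ^_) (m+[n∸m]≡n {1} {⌈log₂ n ⌉} (⌈log₂⌉-mono-≤ {2} {n} (s≤s (s≤s z≤n)))) ⟩
    2 ^ ⌈log₂ n ⌉                 ∎
    where open ≤-Reasoning

≤2^⇒⌈log₂⌉≤ : ∀ {n L} → n ≤ 2 ^ L → ⌈log₂ n ⌉ ≤ L
≤2^⇒⌈log₂⌉≤ {n} {L} le = ≤-trans (⌈log₂⌉-mono-≤ le) (≤-reflexive (⌈log₂2^n⌉≡n L))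

2^<⇒<⌈log₂⌉ : ∀ {n L} → 2 ^ L < n → L < ⌈log₂ n ⌉
2^<⇒<⌈log₂⌉ {n} {L} lt = ≰⇒> λ le → <⇒≱ lt (≤-trans (n≤2^⌈log₂n⌉ n) (^-monoʳ-≤ 2 le))

n≤2^n : ∀ n → n ≤ 2 ^ n
n≤2^n zero    = z≤n
n≤2^n (suc n) = ≤-trans (+-mono-≤ (m^n>0 2 n) (n≤2^n n)) (≤-reflexive (cong (2 ^ n +_) (sym (+-identityʳ _))))

clamp : ∀ {m n} → n ≤ m → m ∸ (m ∸ n) ≡ n
clamp = m∸[m∸n]≡n

rawMem : Env → ℕ → ℕ
rawMem σ x = A σ (x % 16) (x / 16)

rawMem-set : ∀ σ {i v x} → x / 16 ≢ i → rawMem (env (V σ) (setA (A σ) In i v) (ωs σ)) x ≡ rawMem σ x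
rawMem-set σ {i} {v} {x} ne with x % 16 ≡ᵇ 0 in eq
... | false = refl
... | true rewrite ≢⇒≡ᵇ ne = cong (λ a → A σ a (x / 16)) (sym (≡ᵇ⇒≡ (x % 16) 0 (subst T (sym eq) tt)))

copyInput-spec : ∀ σ n → V σ 0 * V σ 1 + V σ 1 * V σ 2 ≡ n → (∀ x → x < n → rawMem σ x ≤ 1) →
  Outcome copyInput σ (u + lp n u) (λ σ' → ∀ x → x < n → A σ' In (suc x) ≡ rawMem σ x)
copyInput-spec σ n en bits = seq-rule {Q = λ σ' → V σ' 6 ≡ n × A σ' ≡ A σ} (straight (en , refl)) λ _ _ → loop-spec
  where
  loop-spec : ∀ {σ₁} → V σ₁ 6 ≡ n × A σ₁ ≡ A σ → Outcome (for 8 (var 6) copyCell) σ₁ (lp n u) (λ σ' → ∀ x → x < n → A σ' In (suc x) ≡ rawMem σ x)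
  loop-spec {σ₁} (e₆ , eA) = weaken ≤-refl (λ σ' (_ , done) x x< → done x x< (m≤n+m n x))
    (for-rule I e₆ ((λ x _ → cong (λ M → M (x % 16) (x / 16)) eA)
                   , (λ x x< n≤x → ⊥-elim (<⇒≱ x< (≤-trans n≤x (≤-reflexive (+-identityʳ x)))))) body)
    where
    I : ℕ → Env → Set
    I i σ' = (∀ x → x + i < n → rawMem σ' x ≡ rawMem σ x)
           × (∀ x → x < n → n ≤ x + i → A σ' In (suc x) ≡ rawMem σ x)
    body : ∀ i σ' → i < n → Frame (for 8 (var 6) copyCell) σ₁ σ' → I i σ' → Outcome copyCell (setV 8 i σ') u (I (suc i))
    body i σ' i<n fr (I₁ , I₂) = straight
      ( (λ x x< → trans (rawMem-set σ' {x₀ + 1} {v} {x} (λ eq → <⇒≢ (below x x<) eq)) (I₁ x (≤-<-trans (+-monoʳ-≤ x (n≤1+n i)) x<)))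
      , (λ x x< n≤ → case x ≟ x₀ of λ
          { (yes refl) → trans (cong (A₁ [ x₀ + 1 ≔ v ]) (+-comm 1 x₀)) (trans (≔-same A₁ (x₀ + 1)) v≡)
          ; (no ne) → trans (≔-other A₁ {x₀ + 1} {suc x} (λ eq → ne (suc-injective (trans eq (+-comm x₀ 1)))))
              (I₂ x x< (≤-pred (≤∧≢⇒< (≤-trans n≤ (≤-reflexive (+-suc x i)))
                 (λ eq → ne (+-cancelʳ-≡ (suc i) x x₀ (trans (+-suc x i) (trans (sym eq) (sym x₀+i))))) ))) }))
      where
      x₀ = V σ' 6 ∸ 1 ∸ i
      A₁ = A σ' In
      v = 1 ∸ (1 ∸ rawMem σ' x₀)
      x₀+i : x₀ + suc i ≡ n
      x₀+i = trans (cong (λ z → z ∸ 1 ∸ i + suc i) (trans (sameV fr 6 refl) e₆))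
               (trans (cong (_+ suc i) (∸-+-assoc n 1 i)) (m∸n+n≡m i<n))
      x₀< : x₀ + i < n
      x₀< = ≤-reflexive (trans (sym (+-suc x₀ i)) x₀+i)
      v≡ : v ≡ rawMem σ x₀
      v≡ = trans (clamp (subst (_≤ 1) (sym (I₁ x₀ x₀<)) (bits x₀ (≤-<-trans (m≤m+n x₀ i) x₀<)))) (I₁ x₀ x₀<)
      below : ∀ x → x + suc i < n → x / 16 < x₀ + 1
      below x x< = ≤-<-trans (m/n≤m x 16) (<-≤-trans (+-cancelʳ-< (suc i) x x₀ (<-≤-trans x< (≤-reflexive (sym x₀+i)))) (m≤m+n x₀ 1))

computeLog-spec : ∀ σ N → V σ 0 + V σ 2 ≡ N →
  Outcome computeLog σ (u + (u + (u + (lp N u + u))))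
    (λ σ' → V σ' 7 ≡ N × V σ' 12 ≡ 16 * (V σ 5 * ⌈log₂ N ⌉))
computeLog-spec σ N refl = seq-rule {Q = λ σ' → σ' ≡ σ₁} (straight refl) λ { _ _ refl →
  seq-rule {Q = λ σ' → σ' ≡ σ₂} (straight refl) λ { _ _ refl →
  seq-rule {Q = λ σ' → σ' ≡ σ₃} (straight refl) λ { _ _ refl →
  seq-rule {Q = Q} (weaken ≤-refl finish (for-rule I refl start body)) λ { σ₄ fr₃ (e₇ , e₁₀) → straight
    (e₇ , cong (16 *_) (cong₂ _*_ (sameV fr₃ 5 refl) e₁₀)) } } } }
  where
  σ₁ = setV 7 N σ
  σ₂ = setV 10 0 σ₁
  σ₃ = setV 11 1 σ₂
  Q : Env → Set
  Q σ' = V σ' 7 ≡ N × V σ' 10 ≡ ⌈log₂ N ⌉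
  I : ℕ → Env → Set
  I i σ' = V σ' 7 ≡ N × V σ' 11 ≡ 2 ^ V σ' 10 × V σ' 10 ≤ ⌈log₂ N ⌉ × V σ' 10 ≤ i × (N ≤ 2 ^ V σ' 10 ⊎ i ≤ V σ' 10)
  start : I 0 σ₃
  start = refl , refl , z≤n , z≤n , inj₂ z≤n
  finish : ∀ σ' → I N σ' → Q σ'
  finish σ' (e₇ , _ , le , _ , inj₁ N≤) = e₇ , ≤-antisym le (≤2^⇒⌈log₂⌉≤ N≤)
  finish σ' (e₇ , _ , le , _ , inj₂ N≤) = e₇ , ≤-antisym le (≤2^⇒⌈log₂⌉≤ (≤-trans (n≤2^n N) (^-monoʳ-≤ 2 N≤)))
  body : ∀ i σ' → i < N → Frame (for 8 (var 7) doubling) σ₃ σ' → I i σ' → Outcome doubling (setV 8 i σ') u (I (suc i))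
  body i σ' i<N fr (e₇ , e₁₁ , le , L≤i , alt) = ifz-rule
    (λ eq → branch (e₇ , e₁₁ , le , ≤-trans L≤i (n≤1+n i) , inj₁ (subst₂ _≤_ e₇ e₁₁ (m∸n≡0⇒m≤n eq))))
    (λ lt → branch (grow-log (0<m∸n⇒n<m lt)))
    where
    grow-log : V σ' 11 < V σ' 7 → I (suc i) (run
      ( 11 := (var 7 ⊕ var 7) ⊖ ((var 7 ⊕ var 7) ⊖ (var 11 ⊕ var 11)) ⨾
        10 := var 7 ⊖ (var 7 ⊖ (var 10 ⊕ lit 1))) (setV 8 i σ'))
    grow-log pw<' =
        e₇
      , trans (clamp (+-mono-≤ pw≤ pw≤)) (trans (cong₂ _+_ e₁₁ e₁₁)
          (sym (trans (cong (2 ^_) L') (cong (2 ^ V σ' 10 +_) (+-identityʳ _)))))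
      , subst (_≤ ⌈log₂ N ⌉) (sym L') (2^<⇒<⌈log₂⌉ pw<)
      , subst (_≤ suc i) (sym L') (s≤s L≤i)
      , (case alt of λ { (inj₁ N≤) → ⊥-elim (<⇒≱ pw< N≤) ; (inj₂ i≤) → inj₂ (subst (suc i ≤_) (sym L') (s≤s i≤)) })
      where
      pw≤ : V σ' 11 ≤ V σ' 7
      pw≤ = <⇒≤ pw<'
      pw< : 2 ^ V σ' 10 < N
      pw< = subst₂ _<_ e₁₁ e₇ pw<'
      L' : V σ' 7 ∸ (V σ' 7 ∸ (V σ' 10 + 1)) ≡ suc (V σ' 10)
      L' = trans (clamp (≤-trans (≤-trans (≤-reflexive (+-comm (V σ' 10) 1)) (s≤s L≤i)) (subst (suc i ≤_) (sym e₇) i<N)))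
                 (+-comm (V σ' 10) 1)

nth-drop-head : ∀ ω i → headBit (List.drop i ω) ≡ bit (nth ω i)
nth-drop-head []      zero    = refl
nth-drop-head (b ∷ ω) zero    = refl
nth-drop-head []      (suc i) = refl
nth-drop-head (b ∷ ω) (suc i) = nth-drop-head ω i

sketch≤ : ∀ q x l → sketch q x l ≤ q + q
sketch≤ q x l = ≤-trans (sumTo-mono q (λ h _ → signed≤2 (x h) (nth l h)))
  (≤-reflexive (trans (sumTo-const q 2) (trans (*-comm q 2) (cong (q +_) (+-identityʳ q)))))
  where
  signed≤2 : ∀ a s → signed a s ≤ 2
  signed≤2 true  true  = ≤-refl
  signed≤2 true  false = z≤n
  signed≤2 false s     = s≤s z≤n

at-eq : ∀ {f g : ℕ → ℕ} {i j} → f ≡ g → i ≡ j → f i ≡ g j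
at-eq refl refl = refl

set-eq : ∀ (f : ℕ → ℕ) {i i' v v'} → i ≡ i' → v ≡ v' → f [ i ≔ v ] ≡ f [ i' ≔ v' ]
set-eq f refl refl = refl

module Phases (p q r ℓ k C : ℕ) where

  N m : ℕ
  N = p + r
  m = 16 * (C * ⌈log₂ N ⌉)

  record Params (σ : Env) : Set where
    field
      par₀ : V σ 0 ≡ p
      par₁ : V σ 1 ≡ q
      par₂ : V σ 2 ≡ r
      par₃ : V σ 3 ≡ ℓ
      par₄ : V σ 4 ≡ k
      par₅ : V σ 5 ≡ C

  record Ready (σ : Env) : Set where
    field
      params : Params σ
      par₇   : V σ 7 ≡ N
      par₁₂  : V σ 12 ≡ m
    open Params params public

  open Ready

  keepsPar : Cmd → Bool
  keepsPar c = not (modV c 0 ∨ (modV c 1 ∨ (modV c 2 ∨ (modV c 3 ∨ (modV c 4 ∨ (modV c 5 ∨ (modV c 7 ∨ modV c 12)))))))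

  ready : ∀ {c σ σ'} {_ : T (keepsPar c)} → Frame c σ σ' → Ready σ → Ready σ'
  ready {c} {σ} {σ'} {ok} fr rdy = go (modV c 0) (modV c 1) (modV c 2) (modV c 3) (modV c 4) (modV c 5) (modV c 7) (modV c 12)
    ok (sameV fr 0) (sameV fr 1) (sameV fr 2) (sameV fr 3) (sameV fr 4) (sameV fr 5) (sameV fr 7) (sameV fr 12)
    where
    go : ∀ a₀ a₁ a₂ a₃ a₄ a₅ a₇ a₁₂ → T (not (a₀ ∨ (a₁ ∨ (a₂ ∨ (a₃ ∨ (a₄ ∨ (a₅ ∨ (a₇ ∨ a₁₂)))))))) →
      (a₀ ≡ false → V σ' 0 ≡ V σ 0) → (a₁ ≡ false → V σ' 1 ≡ V σ 1) → (a₂ ≡ false → V σ' 2 ≡ V σ 2) →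
      (a₃ ≡ false → V σ' 3 ≡ V σ 3) → (a₄ ≡ false → V σ' 4 ≡ V σ 4) → (a₅ ≡ false → V σ' 5 ≡ V σ 5) →
      (a₇ ≡ false → V σ' 7 ≡ V σ 7) → (a₁₂ ≡ false → V σ' 12 ≡ V σ 12) → Ready σ'
    go false false false false false false false false _ f₀ f₁ f₂ f₃ f₄ f₅ f₇ f₁₂ = record
      { params = record
        { par₀ = trans (f₀ refl) (par₀ rdy) ; par₁ = trans (f₁ refl) (par₁ rdy) ; par₂ = trans (f₂ refl) (par₂ rdy)
        ; par₃ = trans (f₃ refl) (par₃ rdy) ; par₄ = trans (f₄ refl) (par₄ rdy) ; par₅ = trans (f₅ refl) (par₅ rdy) }
      ; par₇ = trans (f₇ refl) (par₇ rdy) ; par₁₂ = trans (f₁₂ refl) (par₁₂ rdy) }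

  flipCoins-spec : ∀ {σ} → Ready σ →
    Outcome flipCoins σ (lp (m * q) u) (λ σ' → ∀ i → i < m * q → A σ' S i ≡ bit (nth (ωs σ) i))
  flipCoins-spec {σ} rdy = weaken ≤-refl (λ _ → proj₂) (for-rule I (cong₂ _*_ (par₁₂ rdy) (par₁ rdy)) (refl , λ _ ()) body)
    where
    I : ℕ → Env → Set
    I i σ' = ωs σ' ≡ List.drop i (ωs σ) × (∀ j → j < i → A σ' S j ≡ bit (nth (ωs σ) j))
    body : ∀ i σ' → i < m * q → Frame flipCoins σ σ' → I i σ' → Outcome flipCoin (setV 8 i σ') u (I (suc i))
    body i σ' i< fr (I₁ , I₂) = straight
      ( trans (cong (List.drop 1) I₁) (trans (List.drop-drop i 1 (ωs σ)) (cong (λ n → List.drop n (ωs σ)) (+-comm i 1)))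
      , (λ j j< → case m<1+n⇒m<n∨m≡n j< of λ
        { (inj₁ lt) → trans (≔-other (A σ' S) (<⇒≢ lt)) (I₂ j lt)
        ; (inj₂ refl) → trans (≔-same (A σ' S) i) (trans (cong headBit I₁) (nth-drop-head (ωs σ) i)) }))

  rowPoints-spec : ∀ {σ} (pt : ℕ → Point) → Ready σ →
    (∀ g h → g < p → h < q → A σ In (suc (g * q + h)) ≡ bit (pt g h)) →
    Outcome rowPoints σ (lp p (lp q u)) (λ σ' → ∀ g h → g < p → h < q → A σ' Z (g * q + h) ≡ bit (pt g h))
  rowPoints-spec {σ} pt rdy inp = weaken ≤-refl (λ _ → proj₁)
    (tabulate-rule Z 0 p q (λ g h → bit (pt g h)) (par₀ rdy) refl
      (λ i fr → trans (sameV fr 1 refl) (par₁ rdy))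
      (λ {σ'} g h g< h< fr e₁₃ → straight (set-eq (A σ' Z)
        (index fr e₁₃ h) (trans (at-eq (sameA fr In refl) (trans (cong (_+ 1) (index fr e₁₃ h)) (+-comm (g * q + h) 1)))
          (inp g h g< h<)))))
    where
    index : ∀ {σ' g} → Frame rowPoints σ σ' → V σ' 13 ≡ g → ∀ h → V σ' 13 * V σ' 1 + h ≡ g * q + h
    index fr e₁₃ h = cong₂ (λ a b → a * b + h) e₁₃ (trans (sameV fr 1 refl) (par₁ rdy))

  colPoints-spec : ∀ {σ} (pt : ℕ → Point) → Ready σ →
    (∀ g h → g < r → h < q → A σ In (suc (p * q + (h * r + g))) ≡ bit (pt (p + g) h)) →
    (∀ g h → g < p → h < q → A σ Z (g * q + h) ≡ bit (pt g h)) →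
    Outcome colPoints σ (lp r (lp q u)) (λ σ' → ∀ g h → g < N → h < q → A σ' Z (g * q + h) ≡ bit (pt g h))
  colPoints-spec {σ} pt rdy inp rows = weaken ≤-refl combine
    (tabulate-rule Z p r q (λ g h → bit (pt (p + g) h)) (par₂ rdy) refl
      (λ i fr → trans (sameV fr 1 refl) (par₁ rdy))
      (λ {σ'} g h g< h< fr e₁₃ → straight (set-eq (A σ' Z)
        (cong₂ (λ a b → a * b + h) (cong₂ _+_ (e₀ fr) e₁₃) (e₁ fr))
        (trans (at-eq (sameA fr In refl) (trans (cong₂ (λ a b → a + b + 1) (cong₂ _*_ (e₀ fr) (e₁ fr))
            (cong₂ (λ a b → h * a + b) (e₂ fr) e₁₃)) (+-comm (p * q + (h * r + g)) 1)))
          (inp g h g< h<)))))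
    where
    e₀ : ∀ {σ'} → Frame colPoints σ σ' → V σ' 0 ≡ p
    e₀ fr = trans (sameV fr 0 refl) (par₀ rdy)
    e₁ : ∀ {σ'} → Frame colPoints σ σ' → V σ' 1 ≡ q
    e₁ fr = trans (sameV fr 1 refl) (par₁ rdy)
    e₂ : ∀ {σ'} → Frame colPoints σ σ' → V σ' 2 ≡ r
    e₂ fr = trans (sameV fr 2 refl) (par₂ rdy)
    combine : ∀ σ' → (∀ i j → i < r → j < q → A σ' Z ((p + i) * q + j) ≡ bit (pt (p + i) j))
              × (∀ z → z < p * q → A σ' Z z ≡ A σ Z z) →
              ∀ g h → g < N → h < q → A σ' Z (g * q + h) ≡ bit (pt g h)
    combine σ' (new , old) g h g< h< with g <? p
    ... | yes g<p = trans (old _ (<-≤-trans (cell-mono {q} {p} {g} {0} g<p h<) (≤-reflexive (+-identityʳ (p * q))))) (rows g h g<p h<)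
    ... | no g≮p = subst (λ g → A σ' Z (g * q + h) ≡ bit (pt g h)) p+
                     (new (g ∸ p) h (+-cancelˡ-< p (g ∸ p) r (subst (_< p + r) (sym p+) g<)) h<)
      where p+ : p + (g ∸ p) ≡ g
            p+ = m+[n∸m]≡n (≮⇒≥ g≮p)

  Points : (ℕ → Point) → Env → Set
  Points pt σ = ∀ g h → g < N → h < q → A σ Z (g * q + h) ≡ bit (pt g h)

  sketches-spec : ∀ {σ} pt ω → Ready σ → Points pt σ → (∀ i → i < m * q → A σ S i ≡ bit (nth ω i)) →
    Outcome sketches σ (lp N (lp m (u + (lp q u + u))))
      (λ σ' → ∀ g t → g < N → t < m → A σ' Y (g * m + t) ≡ sketch q (pt g) (List.drop (t * q) ω))
  sketches-spec {σ} pt ω rdy pts coins = weaken ≤-refl (λ _ → proj₁)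
    (tabulate-rule Y 0 N m (λ g t → sketch q (pt g) (List.drop (t * q) ω)) (par₇ rdy) refl
      (λ i fr → trans (sameV fr 12 refl) (par₁₂ rdy)) cell)
    where
    cell : ∀ {σ'} g t → g < N → t < m → Frame sketches σ σ' → V σ' 13 ≡ g →
           Outcome sketchCell (setV 14 t σ') (u + (lp q u + u))
             (λ σ'' → A σ'' Y ≡ A σ' Y [ g * m + t ≔ sketch q (pt g) (List.drop (t * q) ω) ])
    cell {σ'} g t g< t< fr e₁₃ =
      seq-rule {Q = λ σ'' → σ'' ≡ σ₁} (straight refl) λ { _ _ refl →
      seq-rule {Q = λ σ'' → V σ'' 16 ≡ sketch q (pt g) (List.drop (t * q) ω)}
        (sum-rule q _ (λ ()) (e₁ fr) refl summand) λ σ₂ fr₁ e₁₆ →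
      straight (trans (set-eq (A σ₂ Y)
          (cong₂ (λ a b → a * b + V σ₂ 14) (trans (sameV fr₁ 13 refl) e₁₃) (trans (sameV fr₁ 12 refl) (trans (sameV fr 12 refl) (par₁₂ rdy))))
          (trans (cong₂ (λ a b → (a + a) ∸ ((a + a) ∸ b)) (trans (sameV fr₁ 1 refl) (e₁ fr)) e₁₆)
            (clamp (sketch≤ q (pt g) (List.drop (t * q) ω)))))
        (cong₂ (λ f t' → f [ g * m + t' ≔ sketch q (pt g) (List.drop (t * q) ω) ]) (sameA fr₁ Y refl) (sameV fr₁ 14 refl))) }
      where
      σ₁ = setV 16 0 (setV 14 t σ')
      loop₁ = for 15 (var 1) (16 := var 16 ⊕ sketchTerm)
      e₁ : ∀ {σ'} → Frame sketches σ σ' → V σ' 1 ≡ q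
      e₁ fr = trans (sameV fr 1 refl) (par₁ rdy)
      summand : ∀ {σ''} h → h < q → Frame loop₁ σ₁ σ'' →
                evalE sketchTerm (setV 15 h σ'') ≡ signed (pt g h) (nth (List.drop (t * q) ω) h)
      summand {σ''} h h< fr₁ = cong₂ (λ z s → z * (s + s) + (1 ∸ z))
        (trans (at-eq (trans (sameA fr₁ Z refl) (sameA fr Z refl))
                  (cong₂ (λ a b → a * b + h) (trans (sameV fr₁ 13 refl) e₁₃) (trans (sameV fr₁ 1 refl) (e₁ fr)))) (pts g h g< h<))
        (trans (at-eq (trans (sameA fr₁ S refl) (sameA fr S refl))
                  (cong₂ (λ a b → a * b + h) (sameV fr₁ 14 refl) (trans (sameV fr₁ 1 refl) (e₁ fr))))
          (trans (coins (t * q + h) (<-≤-trans (cell-mono {q} {m} {t} {0} t< h<) (≤-reflexive (+-identityʳ (m * q)))))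
            (cong bit (sym (nth-drop (t * q) ω h)))))

-- The state of a point g after c centers s 0, …, s (c ∸ 1): d is its
-- distance to the nearest center e = s a.  By "apart", the centers and g
-- are pairwise at distance at least d.
record Nearest (δ : ℕ → ℕ → ℕ) (s : ℕ → ℕ) (c g d a e : ℕ) : Set where
  field
    near  : ∀ i → i < c → d ≤ δ g (s i)
    apart : ∀ i j → i < j → j < c → d ≤ δ (s j) (s i)
    dist≡ : 1 ≤ c → d ≡ δ g e
    e≡    : 1 ≤ c → e ≡ s a
    a<    : 1 ≤ c → a < c

open Nearest public

nearest-cong : ∀ {δ s s' c g d a e} → (∀ i → i < c → s i ≡ s' i) → Nearest δ s c g d a e → Nearest δ s' c g d a e
nearest-cong {δ} {g = g} {d} eq n = record
  { near  = λ i i< → subst (λ z → d ≤ δ g z) (eq i i<) (near n i i<)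
  ; apart = λ i j i<j j< → subst₂ (λ y z → d ≤ δ y z) (eq j j<) (eq i (<-trans i<j j<)) (apart n i j i<j j<)
  ; dist≡ = dist≡ n ; e≡ = λ le → trans (e≡ n le) (eq _ (a< n le)) ; a< = a< n }

nearest-take : ∀ {δ s c g d a e} → Nearest δ s c g d a e → (∀ i → i < c → d ≤ δ (s c) (s i)) →
               c ≡ 0 ⊎ δ g (s c) < d → Nearest δ s (suc c) g (δ g (s c)) c (s c)
nearest-take {δ} {s} {c} {g} {d} n far alt = record
  { near  = λ i i< → case m<1+n⇒m<n∨m≡n i< of λ { (inj₁ lt) → ≤-trans (smaller lt) (near n i lt) ; (inj₂ refl) → ≤-refl }
  ; apart = λ i j i<j j< → case m<1+n⇒m<n∨m≡n j< of λ
      { (inj₁ lt) → ≤-trans (smaller lt) (apart n i j i<j lt) ; (inj₂ refl) → ≤-trans (smaller i<j) (far i i<j) }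
  ; dist≡ = λ _ → refl ; e≡ = λ _ → refl ; a< = λ _ → ≤-refl }
  where
  smaller : ∀ {i} → i < c → δ g (s c) ≤ d
  smaller i< = case alt of λ { (inj₁ refl) → ⊥-elim (n≮0 i<) ; (inj₂ lt) → <⇒≤ lt }

nearest-skip : ∀ {δ s c g d a e} → Nearest δ s c g d a e → (∀ i → i < c → d ≤ δ (s c) (s i)) →
               0 < c → d ≤ δ g (s c) → Nearest δ s (suc c) g d a e
nearest-skip n far 0<c le = record
  { near  = λ i i< → case m<1+n⇒m<n∨m≡n i< of λ { (inj₁ lt) → near n i lt ; (inj₂ refl) → le }
  ; apart = λ i j i<j j< → case m<1+n⇒m<n∨m≡n j< of λ
      { (inj₁ lt) → apart n i j i<j lt ; (inj₂ refl) → far i i<j }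
  ; dist≡ = λ _ → dist≡ n 0<c ; e≡ = λ _ → e≡ n 0<c ; a< = λ _ → ≤-trans (a< n 0<c) (n≤1+n _) }

module Traversal (p q r ℓ k C : ℕ) where
  open Phases p q r ℓ k C
  open Ready

  gapOf : (ℕ → ℕ) → ℕ → ℕ → ℕ
  gapOf y g g' = sumTo m (λ t → (y (g * m + t) ∸ y (g' * m + t)) + (y (g' * m + t) ∸ y (g * m + t)))

  farthest-spec : ∀ {σ} off n → V σ 17 ≡ off → V σ 18 ≡ n → 1 ≤ n →
    Outcome farthest σ (u + (u + lp n u))
      (λ σ' → V σ' 21 < n × (∀ i → i < n → A σ Δ (off + i) ≤ A σ Δ (off + V σ' 21)))
  farthest-spec {σ} off n e₁₇ e₁₈ 1≤n =
    seq-rule {Q = λ σ' → σ' ≡ setV 21 0 σ} (straight refl) λ { _ _ refl →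
    seq-rule {Q = λ σ' → σ' ≡ σ₂} (straight refl) λ { _ _ refl →
    weaken ≤-refl (λ _ (I₁ , I₂ , I₃) → I₁ , λ i i< → ≤-trans (I₃ i i<) I₂)
      (for-rule I e₁₈ (1≤n , z≤n , λ _ ()) body) } }
    where
    σ₂ = setV 22 0 (setV 21 0 σ)
    I : ℕ → Env → Set
    I i σ' = V σ' 21 < n × V σ' 22 ≤ A σ Δ (off + V σ' 21) × (∀ i' → i' < i → A σ Δ (off + i') ≤ V σ' 22)
    body : ∀ i σ' → i < n → Frame (for 23 (var 18) farther) σ₂ σ' → I i σ' → Outcome farther (setV 23 i σ') u (I (suc i))
    body i σ' i< fr (I₁ , I₂ , I₃) = ifz-rule
      (λ eq → branch (I₁ , I₂ , λ i' i'< → case m<1+n⇒m<n∨m≡n i'< of λ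
        { (inj₁ lt) → I₃ i' lt ; (inj₂ refl) → subst (_≤ V σ' 22) here≡ (m∸n≡0⇒m≤n eq) }))
      (λ lt → branch (i< , ≤-reflexive here≡ , λ i' i'< → case m<1+n⇒m<n∨m≡n i'< of λ
        { (inj₁ lt') → ≤-trans (I₃ i' lt') (≤-trans (<⇒≤ (0<m∸n⇒n<m lt)) ≤-refl)
        ; (inj₂ refl) → ≤-reflexive (sym here≡) }))
      where
      here≡ : A σ' Δ (V σ' 17 + i) ≡ A σ Δ (off + i)
      here≡ = at-eq (sameA fr Δ refl) (cong (_+ i) (trans (sameV fr 17 refl) e₁₇))

  gapTo-spec : ∀ {σ} → Ready σ →
    Outcome gapTo σ (u + lp m u) (λ σ' → V σ' 24 ≡ gapOf (A σ Y) (V σ 17 + V σ 23) (V σ 30))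
  gapTo-spec {σ} rdy = seq-rule {Q = λ σ' → σ' ≡ setV 24 0 σ} (straight refl) λ { _ _ refl →
    sum-rule m _ (λ ()) (par₁₂ rdy) refl λ {σ'} t t< fr →
      cong₂ (λ a b → (a ∸ b) + (b ∸ a))
        (at-eq (sameA fr Y refl) (cong (_+ t) (cong₂ _*_ (cong₂ _+_ (sameV fr 17 refl) (sameV fr 23 refl)) (trans (sameV fr 12 refl) (par₁₂ rdy)))))
        (at-eq (sameA fr Y refl) (cong (_+ t) (cong₂ _*_ (sameV fr 30 refl) (trans (sameV fr 12 refl) (par₁₂ rdy))))) }

  Taken Kept : Env → Env → ℕ → Set
  Taken σ σ' δ = (V σ 20 ≡ 0 ⊎ δ < A σ Δ g) × A σ' Δ ≡ A σ Δ [ g ≔ δ ]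
                 × A σ' asg ≡ A σ asg [ g ≔ V σ 20 ] × A σ' cp ≡ A σ cp [ g ≔ V σ 30 ]
    where g = V σ 17 + V σ 23
  Kept σ σ' δ = 0 < V σ 20 × A σ Δ (V σ 17 + V σ 23) ≤ δ
                × A σ' Δ ≡ A σ Δ × A σ' asg ≡ A σ asg × A σ' cp ≡ A σ cp

  update-spec : ∀ {σ} δ → V σ 24 ≡ δ → Outcome update σ (u + (u + u)) (λ σ' → Taken σ σ' δ ⊎ Kept σ σ' δ)
  update-spec {σ} δ refl =
    seq-rule {Q = λ σ' → σ' ≡ σ₁} (straight refl) λ { _ _ refl →
    seq-rule {Q = Q} (ifz-rule (λ eq → branch (inj₁ (eq , refl))) (λ lt → branch (inj₂ (lt , refl)))) λ _ _ → last } 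
    where
    σ₁ = setV 25 (A σ Δ (V σ 17 + V σ 23)) σ
    Q : Env → Set
    Q σ' = (V σ 20 ≡ 0 × σ' ≡ setV 25 (V σ 24 + 1) σ₁) ⊎ (0 < V σ 20 × σ' ≡ σ₁)
    last : ∀ {σ'} → Q σ' → Outcome (ifz ((var 24 ⊕ lit 1) ⊖ var 25) take skip) σ' u (λ σ' → Taken σ σ' δ ⊎ Kept σ σ' δ)
    last (inj₁ (z , refl)) = ifz-rule (λ eq → branch (inj₁ (inj₁ z , refl , refl , refl)))
      (λ lt → ⊥-elim (<⇒≢ (0<m∸n⇒n<m {V σ 24 + 1} {V σ 24 + 1} lt) refl))
    last (inj₂ (0<c , refl)) = ifz-rule
      (λ eq → branch (inj₁ (inj₂ (≤-trans (≤-reflexive (+-comm 1 (V σ 24))) (m∸n≡0⇒m≤n {V σ 24 + 1} eq)) , refl , refl , refl)))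
      (λ lt → branch (inj₂ (0<c , ≤-pred (≤-trans (0<m∸n⇒n<m {V σ 24 + 1} lt) (≤-reflexive (+-comm (V σ 24) 1))) , refl , refl , refl)))

  PointState : (ℕ → ℕ → ℕ) → (ℕ → ℕ) → ℕ → ℕ → Env → Set
  PointState δ s c g σ = Nearest δ s c g (A σ Δ g) (A σ asg g) (A σ cp g)

  SameBelow : ℕ → Env → Env → Set
  SameBelow off σ σ' = ∀ z → z < off → A σ' asg z ≡ A σ asg z × A σ' cp z ≡ A σ cp z × A σ' ctr z ≡ A σ ctr z

  centersOf : ℕ → Env → ℕ → ℕ
  centersOf off σ c = A σ ctr (off + c)

  record Clustering (δ : ℕ → ℕ → ℕ) (off n c : ℕ) (σ₀ σ : Env) : Set where
    field
      center< : ∀ i → i < c → Σ[ b ∈ ℕ ] b < n × centersOf off σ i ≡ off + b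
      state   : ∀ i → i < n → PointState δ (centersOf off σ) c (off + i) σ
      below   : SameBelow off σ₀ σ

  open Clustering public

  centerCost : ℕ → ℕ
  centerCost n = (u + (u + lp n u)) + (u + (u + lp n ((u + lp m u) + (u + (u + u)))))

  private
    scan : Cmd
    scan = for 23 (var 18) (gapTo ⨾ update)

  scan-spec : ∀ {σ} off n c s → Ready σ → V σ 17 ≡ off → V σ 18 ≡ n → V σ 20 ≡ c → V σ 30 ≡ s c →
    (∀ i → i < n → PointState (gapOf (A σ Y)) s c (off + i) σ × (∀ j → j < c → A σ Δ (off + i) ≤ gapOf (A σ Y) (s c) (s j))) →
    Outcome scan σ (lp n ((u + lp m u) + (u + (u + u))))
      (λ σ' → (∀ i → i < n → PointState (gapOf (A σ Y)) s (suc c) (off + i) σ') × SameBelow off σ σ')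
  scan-spec {σ} off n c s rdy e₁₇ e₁₈ e₂₀ e₃₀ st =
    weaken ≤-refl (λ _ (I₁ , _ , I₃) → I₁ , I₃)
      (for-rule I e₁₈ ((λ _ ()) , (λ i _ i< → st i i<) , (λ _ _ → refl , refl , refl)) body)
    where
    δ = gapOf (A σ Y)
    I : ℕ → Env → Set
    I i σ' = (∀ j → j < i → PointState δ s (suc c) (off + j) σ')
           × (∀ j → i ≤ j → j < n → PointState δ s c (off + j) σ' × (∀ i' → i' < c → A σ' Δ (off + j) ≤ δ (s c) (s i')))
           × SameBelow off σ σ'
    body : ∀ i σ' → i < n → Frame scan σ σ' → I i σ' →
           Outcome (gapTo ⨾ update) (setV 23 i σ') ((u + lp m u) + (u + (u + u))) (I (suc i))
    body i σ' i< fr (I₁ , I₂ , I₃) =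
      seq-rule (gapTo-spec {σ₁} (ready {23 := lit i} (run-frame (23 := lit i) σ') (ready {scan} fr rdy))) λ σ₂ fr₁ e₂₄ →
      conseq (λ { σ₃ fr₂ (inj₁ (alt , eΔ , ea , ec)) → taken σ₂ σ₃ fr₁ fr₂ alt eΔ ea ec
                ; σ₃ fr₂ (inj₂ (pos , le , eΔ , ea , ec)) → kept σ₂ σ₃ fr₁ fr₂ pos le eΔ ea ec })
        (update-spec {σ₂} (δ g (s c)) (trans e₂₄ gap-eq))
      where
      σ₁ = setV 23 i σ'
      g  = off + i
      at₁₇ : V σ' 17 ≡ off
      at₁₇ = trans (sameV fr 17 refl) e₁₇
      at₃₀ : V σ' 30 ≡ s c
      at₃₀ = trans (sameV fr 30 refl) e₃₀
      at₂₀ : V σ' 20 ≡ c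
      at₂₀ = trans (sameV fr 20 refl) e₂₀
      gap-eq : gapOf (A σ' Y) (V σ' 17 + i) (V σ' 30) ≡ δ g (s c)
      gap-eq = trans (cong (λ y → gapOf y (V σ' 17 + i) (V σ' 30)) (sameA fr Y refl)) (cong₂ (λ a b → δ (a + i) b) at₁₇ at₃₀)
      here≡ : ∀ {σ₂} → Frame gapTo σ₁ σ₂ → V σ₂ 17 + V σ₂ 23 ≡ g
      here≡ {σ₂} fr₁ = cong₂ _+_ (trans (sameV fr₁ 17 refl) at₁₇) (sameV fr₁ 23 refl)
      st-i = I₂ i ≤-refl i<
      move : ∀ {s c g} σ σ' → A σ' Δ g ≡ A σ Δ g → A σ' asg g ≡ A σ asg g → A σ' cp g ≡ A σ cp g →
             PointState δ s c g σ → PointState δ s c g σ'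
      move σ σ' e₁ e₂ e₃ n rewrite e₁ | e₂ | e₃ = n
      taken : ∀ σ₂ σ₃ → Frame gapTo σ₁ σ₂ → Frame update σ₂ σ₃ → V σ₂ 20 ≡ 0 ⊎ δ g (s c) < A σ₂ Δ (V σ₂ 17 + V σ₂ 23) →
              A σ₃ Δ ≡ A σ₂ Δ [ V σ₂ 17 + V σ₂ 23 ≔ δ g (s c) ] →
              A σ₃ asg ≡ A σ₂ asg [ V σ₂ 17 + V σ₂ 23 ≔ V σ₂ 20 ] →
              A σ₃ cp ≡ A σ₂ cp [ V σ₂ 17 + V σ₂ 23 ≔ V σ₂ 30 ] → I (suc i) σ₃
      taken σ₂ σ₃ fr₁ fr₂ alt eΔ ea ec =
          (λ j j< → case m<1+n⇒m<n∨m≡n j< of λ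
            { (inj₁ lt) → move σ' σ₃ (off-g Δ eΔ' (<⇒≢ lt)) (off-g asg ea' (<⇒≢ lt)) (off-g cp ec' (<⇒≢ lt)) (I₁ j lt)
            ; (inj₂ refl) → new })
        , (λ j i<j j< → let old = I₂ j (<⇒≤ i<j) j< ; ne = λ eq → <⇒≢ i<j (sym eq) in
              move σ' σ₃ (off-g Δ eΔ' ne) (off-g asg ea' ne) (off-g cp ec' ne) (proj₁ old)
            , λ i' i'< → ≤-trans (≤-reflexive (off-g Δ eΔ' ne)) (proj₂ old i' i'<))
        , (λ z z< → trans (low asg ea' z<) (proj₁ (I₃ z z<)) , trans (low cp ec' z<) (proj₁ (proj₂ (I₃ z z<)))
                  , trans (trans (cong-app (sameA fr₂ ctr refl) z) (cong-app (sameA fr₁ ctr refl) z)) (proj₂ (proj₂ (I₃ z z<))))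
        where
        eΔ' : A σ₃ Δ ≡ A σ' Δ [ g ≔ δ g (s c) ]
        eΔ' = trans eΔ (cong₂ (λ f i → f [ i ≔ δ g (s c) ]) (sameA fr₁ Δ refl) (here≡ {σ₂} fr₁))
        ea' : A σ₃ asg ≡ A σ' asg [ g ≔ c ]
        ea' = trans ea (trans (cong₂ (λ f i → f [ i ≔ V σ₂ 20 ]) (sameA fr₁ asg refl) (here≡ {σ₂} fr₁)) (cong (λ v → A σ' asg [ g ≔ v ]) (trans (sameV fr₁ 20 refl) at₂₀)))
        ec' : A σ₃ cp ≡ A σ' cp [ g ≔ s c ]
        ec' = trans ec (trans (cong₂ (λ f i → f [ i ≔ V σ₂ 30 ]) (sameA fr₁ cp refl) (here≡ {σ₂} fr₁)) (cong (λ v → A σ' cp [ g ≔ v ]) (trans (sameV fr₁ 30 refl) at₃₀)))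
        off-g : ∀ a {v} → A σ₃ a ≡ A σ' a [ g ≔ v ] → ∀ {j} → j ≢ i → A σ₃ a (off + j) ≡ A σ' a (off + j)
        off-g a e {j} ne = trans (cong-app e (off + j)) (≔-other (A σ' a) (λ eq → ne (+-cancelˡ-≡ off j i eq)))
        low : ∀ a {v} → A σ₃ a ≡ A σ' a [ g ≔ v ] → ∀ {z} → z < off → A σ₃ a z ≡ A σ' a z
        low a e {z} z< = trans (cong-app e z) (≔-other (A σ' a) (<⇒≢ (<-≤-trans z< (m≤m+n off i))))
        at-g : ∀ a {v} → A σ₃ a ≡ A σ' a [ g ≔ v ] → A σ₃ a g ≡ v
        at-g a e = trans (cong-app e g) (≔-same (A σ' a) g)
        new : PointState δ s (suc c) g σ₃
        new rewrite at-g Δ eΔ' | at-g asg ea' | at-g cp ec' = nearest-take (proj₁ st-i) (proj₂ st-i)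
          (subst₂ (λ a b → a ≡ 0 ⊎ δ g (s c) < b) (trans (sameV fr₁ 20 refl) at₂₀) (at-eq (sameA fr₁ Δ refl) (here≡ {σ₂} fr₁)) alt)
      kept : ∀ σ₂ σ₃ → Frame gapTo σ₁ σ₂ → Frame update σ₂ σ₃ → 0 < V σ₂ 20 → A σ₂ Δ (V σ₂ 17 + V σ₂ 23) ≤ δ g (s c) →
             A σ₃ Δ ≡ A σ₂ Δ → A σ₃ asg ≡ A σ₂ asg → A σ₃ cp ≡ A σ₂ cp → I (suc i) σ₃
      kept σ₂ σ₃ fr₁ fr₂ pos le eΔ ea ec =
          (λ j j< → case m<1+n⇒m<n∨m≡n j< of λ
            { (inj₁ lt) → stay (I₁ j lt)
            ; (inj₂ refl) → stay (nearest-skip (proj₁ st-i) (proj₂ st-i) (subst (0 <_) (trans (sameV fr₁ 20 refl) at₂₀) pos)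
                                (subst (_≤ δ g (s c)) (at-eq (sameA fr₁ Δ refl) (here≡ {σ₂} fr₁)) le)) })
        , (λ j i<j j< → let old = I₂ j (<⇒≤ i<j) j< in stay (proj₁ old)
            , λ i' i'< → ≤-trans (≤-reflexive (cong-app eΔ' (off + j))) (proj₂ old i' i'<))
        , (λ z z< → trans (cong-app ea' z) (proj₁ (I₃ z z<)) , trans (cong-app ec' z) (proj₁ (proj₂ (I₃ z z<)))
                  , trans (trans (cong-app (sameA fr₂ ctr refl) z) (cong-app (sameA fr₁ ctr refl) z)) (proj₂ (proj₂ (I₃ z z<))))
        where
        eΔ' : A σ₃ Δ ≡ A σ' Δ
        eΔ' = trans eΔ (sameA fr₁ Δ refl)
        ea' : A σ₃ asg ≡ A σ' asg
        ea' = trans ea (sameA fr₁ asg refl)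
        ec' : A σ₃ cp ≡ A σ' cp
        ec' = trans ec (sameA fr₁ cp refl)
        stay : ∀ {c g} → PointState δ s c g σ' → PointState δ s c g σ₃
        stay {c} {g} = move σ' σ₃ (cong-app eΔ' g) (cong-app ea' g) (cong-app ec' g)

  centers-spec : ∀ {σ} off n c → Ready σ → V σ 17 ≡ off → V σ 18 ≡ n → V σ 19 ≡ c → 1 ≤ n →
    Outcome centers σ (lp c (centerCost n)) (Clustering (gapOf (A σ Y)) off n c σ)
  centers-spec {σ} off n c rdy e₁₇ e₁₈ e₁₉ 1≤n = for-rule (λ i σ' → Clustering δ off n i σ σ') e₁₉ start body
    where
    δ = gapOf (A σ Y)
    start : Clustering δ off n 0 σ σ
    start = record { center< = λ _ () ; below = λ _ _ → refl , refl , refl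
                   ; state = λ i _ → record { near = λ _ () ; apart = λ _ _ _ () ; dist≡ = λ () ; e≡ = λ () ; a< = λ () } }
    body : ∀ i σ' → i < c → Frame centers σ σ' → Clustering δ off n i σ σ' →
           Outcome centerStep (setV 20 i σ') (centerCost n) (Clustering δ off n (suc i) σ)
    body i σ' i< fr cl =
      seq-rule {Q = λ σ₁ → V σ₁ 21 < n × (∀ j → j < n → A σ' Δ (off + j) ≤ A σ' Δ (off + V σ₁ 21))}
        (farthest-spec {setV 20 i σ'} off n (trans (sameV fr 17 refl) e₁₇) (trans (sameV fr 18 refl) e₁₈) 1≤n) λ σ₁' fr₁ (b< , far) →
      seq-rule {Q = λ σ₂ → σ₂ ≡ σ₂' σ₁'} (straight refl) λ { _ _ refl →
      seq-rule {Q = λ σ₃ → σ₃ ≡ σ₃' σ₁'} (straight refl) λ { _ _ refl →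
      conseq (Step.finish σ₁' fr₁ b<)
        (scan-spec {σ₃' σ₁'} off n i (centersOf off (σ₃' σ₁')) (Step.rdy₃ σ₁' fr₁ b<) (Step.at₁₇ σ₁' fr₁ b<) (trans (sameV fr₁ 18 refl) (trans (sameV fr 18 refl) e₁₈))
          (sameV fr₁ 20 refl) (sym (Step.new-center σ₁' fr₁ b<)) (Step.states σ₁' fr₁ b< far)) } }
      where
      σ₂' σ₃' : Env → Env
      σ₂' σ₁' = setV 30 (V σ₁' 17 + V σ₁' 21) σ₁'
      σ₃' σ₁' = run (wr ctr (var 17 ⊕ var 20) (var 30)) (σ₂' σ₁')
      module Step σ₁' (fr₁ : Frame farthest (setV 20 i σ') σ₁') (b< : V σ₁' 21 < n) where
        τ = σ₃' σ₁'
        at₁₇ : V σ₁' 17 ≡ off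
        at₁₇ = trans (sameV fr₁ 17 refl) (trans (sameV fr 17 refl) e₁₇)
        rdy₃ : Ready τ
        rdy₃ = ready {wr ctr (var 17 ⊕ var 20) (var 30)} (run-frame (wr ctr (var 17 ⊕ var 20) (var 30)) (σ₂' σ₁'))
          (ready {30 := var 17 ⊕ var 21} (run-frame (30 := var 17 ⊕ var 21) σ₁')
          (ready {farthest} fr₁ (ready {20 := lit i} (run-frame (20 := lit i) σ') (ready {centers} fr rdy))))
        ctr-eq : A τ ctr ≡ A σ' ctr [ off + i ≔ off + V σ₁' 21 ]
        ctr-eq = trans (set-eq (A σ₁' ctr) (cong₂ _+_ (at₁₇) (sameV fr₁ 20 refl)) (cong (_+ V σ₁' 21) (at₁₇)))
          (cong (_[ off + i ≔ off + V σ₁' 21 ]) (sameA fr₁ ctr refl))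
        center-i : centersOf off τ i ≡ off + V σ₁' 21
        center-i = trans (cong-app (ctr-eq) (off + i)) (≔-same (A σ' ctr) (off + i))
        new-center : centersOf off τ i ≡ V σ₁' 17 + V σ₁' 21
        new-center = trans (center-i) (cong (_+ V σ₁' 21) (sym (at₁₇)))
        center-old : ∀ j → j < i → centersOf off τ j ≡ centersOf off σ' j
        center-old j j< = trans (cong-app (ctr-eq) (off + j)) (≔-other (A σ' ctr) (<⇒≢ (+-monoʳ-< off j<)))
        same : ∀ a → (a ≡ᵇ ctr) ≡ false → modA farthest a ≡ false → A τ a ≡ A σ' a
        same a e e' = trans (sameA (run-frame (wr ctr (var 17 ⊕ var 20) (var 30)) (σ₂' σ₁')) a e) (sameA fr₁ a e')
        δ-eq : gapOf (A τ Y) ≡ δ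
        δ-eq = cong gapOf (trans (same Y refl refl) (sameA fr Y refl))
        state₃ : ∀ j → j < n → PointState (gapOf (A τ Y)) (centersOf off τ) i (off + j) τ
        state₃ j j< rewrite δ-eq | same Δ refl refl | same asg refl refl | same cp refl refl =
          nearest-cong (λ j' j'< → sym (center-old j' j'<)) (state cl j j<)
        states : (∀ j → j < n → A σ' Δ (off + j) ≤ A σ' Δ (off + V σ₁' 21)) →
          ∀ j → j < n → PointState (gapOf (A τ Y)) (centersOf off τ) i (off + j) τ
                      × (∀ j' → j' < i → A τ Δ (off + j) ≤ gapOf (A τ Y) (centersOf off τ i) (centersOf off τ j'))
        states far j j< = state₃ j j< , λ j' j'< →
          ≤-trans (≤-reflexive (cong-app (same Δ refl refl) (off + j))) (≤-trans (far j j<)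
            (≤-trans (≤-reflexive (sym (cong-app (same Δ refl refl) (off + V σ₁' 21))))
              (subst (λ z → A τ Δ (off + V σ₁' 21) ≤ gapOf (A τ Y) z (centersOf off τ j')) (sym (center-i))
                (near (state₃ (V σ₁' 21) b<) j' j'<))))
        finish : ∀ τ' → Frame scan τ τ' → (∀ j → j < n → PointState (gapOf (A τ Y)) (centersOf off τ) (suc i) (off + j) τ') × SameBelow off τ τ' → Clustering δ off n (suc i) σ τ'
        finish τ' fr₄ (st , bel) = record
          { center< = λ j j< → case m<1+n⇒m<n∨m≡n j< of λ
              { (inj₁ lt) → let (b , b<n , eq) = center< cl j lt in b , b<n , trans (cong-app ctr₄ (off + j)) (trans (center-old j lt) eq)
              ; (inj₂ refl) → V σ₁' 21 , b< , trans (cong-app ctr₄ (off + i)) (center-i) }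
          ; state = λ j j< → nearest-cong (λ j' _ → sym (cong-app ctr₄ (off + j')))
              (subst (λ d → PointState d (centersOf off τ) (suc i) (off + j) τ') (δ-eq) (st j j<))
          ; below = λ z z< → let (b₁ , b₂ , b₃) = bel z z< ; (o₁ , o₂ , o₃) = below cl z z< in
                trans b₁ (trans (cong-app (same asg refl refl) z) o₁)
              , trans b₂ (trans (cong-app (same cp refl refl) z) o₂)
              , trans b₃ (trans (trans (cong-app (ctr-eq) z) (≔-other (A σ' ctr) (<⇒≢ (<-≤-trans z< (m≤m+n off i))))) o₃) }
          where
          ctr₄ : A τ' ctr ≡ A τ ctr
          ctr₄ = sameA fr₄ ctr refl

sumTo-bits≤ : ∀ n (f : ℕ → Bool) → sumTo n (λ i → bit (f i)) ≤ n
sumTo-bits≤ n f = ≤-trans (sumTo-mono n (λ i _ → bit≤1 (f i))) (≤-reflexive (trans (sumTo-const n 1) (*-identityʳ n)))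

∸+∸-bits : ∀ a b → (bit a ∸ bit b) + (bit b ∸ bit a) ≡ bit (a xor b)
∸+∸-bits true  true  = refl
∸+∸-bits true  false = refl
∸+∸-bits false true  = refl
∸+∸-bits false false = refl

-- The contribution of coordinate h to x · y, expressed by the centers
-- u, v of x, y; moved to the side where no subtraction occurs.
correction : ∀ x u y v → bit u * bit v + (bit (x xor u) * (bit x * bit v) + bit (y xor v) * (bit x * bit y))
             ≡ bit x * bit y + (bit (x xor u) * (bit u * bit v) + bit (y xor v) * (bit x * bit v))
correction true  true  true  true  = refl
correction true  true  true  false = refl
correction true  true  false true  = refl
correction true  true  false false = refl
correction true  false true  true  = refl
correction true  false true  false = refl
correction true  false false true  = refl
correction true  false false false = refl
correction false true  true  true  = refl
correction false true  true  false = refl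
correction false true  false true  = refl
correction false true  false false = refl
correction false false true  true  = refl
correction false false true  false = refl
correction false false false true  = refl
correction false false false false = refl

module Tables (p q r ℓ k C : ℕ) where
  open Phases p q r ℓ k C
  open Traversal p q r ℓ k C
  open Ready

  DiffersOn : Point → Point → (ℕ → ℕ) → ℕ → Set
  DiffersOn x y list n = n ≡ dist q x y
    × (∀ f → sumTo n (f ∘ list) ≡ sumTo q (λ h → bit (x h xor y h) * f h))

  Differences : (ℕ → Point) → ℕ → Env → Env → Set
  Differences pt g σ σ' = DiffersOn (pt g) (pt (A σ cp g)) (λ e → A σ' D (g * q + e)) (A σ' cnt g)

  differences-spec : ∀ {σ} pt → Ready σ → Points pt σ → (∀ g → g < N → A σ cp g < N) →
    Outcome differences σ (lp N (u + (lp q u + u))) (λ σ' → ∀ g → g < N → Differences pt g σ σ')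
  differences-spec {σ} pt rdy pts cp< = for-rule I (par₇ rdy) (λ _ ()) outer
    where
    I : ℕ → Env → Set
    I g σ' = ∀ g' → g' < g → Differences pt g' σ σ'
    outer : ∀ g σ' → g < N → Frame differences σ σ' → I g σ' →
            Outcome differenceList (setV 13 g σ') (u + (lp q u + u)) (I (suc g))
    outer g σ' g< fr Ig =
      seq-rule {Q = λ σ₁ → σ₁ ≡ σ₁'} (straight refl) λ { _ _ refl →
      seq-rule {Q = In-loop q} (for-rule In-loop at₁ (refl , (λ _ → refl) , Ig) inner) λ σ₂ fr₂ (J₁ , J₂ , J₃) →
      straight (λ g' g'< → case m<1+n⇒m<n∨m≡n g'< of λ
        { (inj₁ lt) → subst (DiffersOn (pt g') (pt (A σ cp g')) (λ e → A σ₂ D (g' * q + e))) (sym (≔-other (A σ₂ cnt) (λ eq → <⇒≢ lt (trans eq (sameV fr₂ 13 refl))))) (J₃ g' lt)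
        ; (inj₂ refl) → subst (DiffersOn x y (λ e → A σ₂ D (g * q + e))) (sym (trans (cong (λ i → (A σ₂ cnt [ i ≔ V σ₂ 26 ]) g) (sameV fr₂ 13 refl)) (≔-same (A σ₂ cnt) g)))
            (J₁ , λ f → trans (cong (λ n → sumTo n (λ e → f (A σ₂ D (g * q + e)))) J₁) (J₂ f)) }) }
      where
      x = pt g
      y = pt (A σ cp g)
      σ₁' = setV 26 0 (setV 13 g σ')
      at₁ : V σ' 1 ≡ q
      at₁ = trans (sameV fr 1 refl) (par₁ rdy)
      upTo : ℕ → ℕ
      upTo h = sumTo h (λ h → bit (x h xor y h))
      In-loop : ℕ → Env → Set
      In-loop h σ₂ = V σ₂ 26 ≡ upTo h
        × (∀ f → sumTo (upTo h) (λ e → f (A σ₂ D (g * q + e))) ≡ sumTo h (λ h → bit (x h xor y h) * f h))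
        × I g σ₂
      loop₁ = for 15 (var 1) (ifz differ skip noteDifference)
      inner : ∀ h σ₂ → h < q → Frame loop₁ σ₁' σ₂ → In-loop h σ₂ →
              Outcome (ifz differ skip noteDifference) (setV 15 h σ₂) u (In-loop (suc h))
      inner h σ₂ h< fr₂ (J₁ , J₂ , J₃) = ifz-rule
        (λ eq → let z = trans (sym differ≡) eq in branch
          ( trans J₁ (sym (snoc₀ z))
          , (λ f → trans (cong (λ n → sumTo n (λ e → f (A σ₂ D (g * q + e)))) (snoc₀ z)) (trans (J₂ f)
              (sym (trans (sumTo-snoc h _) (trans (cong (λ b → sumTo h (λ h → bit (x h xor y h) * f h) + b * f h) z) (+-identityʳ _))))))
          , J₃))
        (λ lt → let o = one (subst (0 <_) differ≡ lt) in branch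
          ( trans (cong (_+ 1) J₁) (trans (+-comm (upTo h) 1) (sym (snoc₁ o)))
          , (λ f → trans (cong (λ n → sumTo n (λ e → f (D' (g * q + e)))) (snoc₁ o))
              (trans (sumTo-snoc (upTo h) _) (trans (cong₂ _+_
                (trans (sumTo-cong (upTo h) (λ e e< → cong f (D'-old (<⇒≢ (+-monoʳ-< (g * q) e<))))) (J₂ f))
                (trans (cong f D'-new) (sym (trans (cong (_* f h) o) (*-identityˡ (f h))))))
                (sym (sumTo-snoc h _)))))
          , (λ g' g'< → let (d≡ , list) = J₃ g' g'< in d≡ , λ f → trans
              (sumTo-cong (A σ₂ cnt g') (λ e e< → cong f (D'-old (<⇒≢ (cell-mono {q} {g} {g'} g'<
                (<-≤-trans e< (≤-trans (≤-reflexive d≡) (sumTo-bits≤ q _)))))))) (list f))))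
        where
        zg : A σ₂ Z (V σ₂ 13 * V σ₂ 1 + h) ≡ bit (x h)
        zg = trans (at-eq (trans (sameA fr₂ Z refl) (sameA fr Z refl)) (cong₂ (λ a b → a * b + h) (sameV fr₂ 13 refl) (trans (sameV fr₂ 1 refl) at₁))) (pts g h g< h<)
        zc : A σ₂ Z (A σ₂ cp (V σ₂ 13) * V σ₂ 1 + h) ≡ bit (y h)
        zc = trans (at-eq (trans (sameA fr₂ Z refl) (sameA fr Z refl)) (cong₂ (λ a b → a * b + h)
               (at-eq (trans (sameA fr₂ cp refl) (sameA fr cp refl)) (sameV fr₂ 13 refl)) (trans (sameV fr₂ 1 refl) at₁))) (pts _ h (cp< g g<) h<)
        differ≡ : evalE differ (setV 15 h σ₂) ≡ bit (x h xor y h)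
        differ≡ = trans (cong₂ (λ a b → (a ∸ b) + (b ∸ a)) zg zc) (∸+∸-bits (x h) (y h))
        snoc₀ : bit (x h xor y h) ≡ 0 → upTo (suc h) ≡ upTo h
        snoc₀ z = trans (sumTo-snoc h _) (trans (cong (upTo h +_) z) (+-identityʳ _))
        snoc₁ : bit (x h xor y h) ≡ 1 → upTo (suc h) ≡ suc (upTo h)
        snoc₁ o = trans (sumTo-snoc h _) (trans (cong (upTo h +_) o) (+-comm (upTo h) 1))
        one : 0 < bit (x h xor y h) → bit (x h xor y h) ≡ 1
        one lt = ≤-antisym (bit≤1 (x h xor y h)) lt
        i' = V σ₂ 13 * V σ₂ 1 + (V σ₂ 1 ∸ (V σ₂ 1 ∸ V σ₂ 26))
        D' = A σ₂ D [ i' ≔ h ]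
        i'≡ : i' ≡ g * q + upTo h
        i'≡ = cong₂ _+_ (cong₂ _*_ (sameV fr₂ 13 refl) (trans (sameV fr₂ 1 refl) at₁))
                (trans (cong₂ (λ a b → a ∸ (a ∸ b)) (trans (sameV fr₂ 1 refl) at₁) J₁) (clamp (≤-trans (sumTo-bits≤ h _) (<⇒≤ h<))))
        D'-old : ∀ {z} → z ≢ g * q + upTo h → D' z ≡ A σ₂ D z
        D'-old ne = ≔-other (A σ₂ D) (λ eq → ne (trans eq i'≡))
        D'-new : D' (g * q + upTo h) ≡ h
        D'-new = trans (cong D' (sym i'≡)) (≔-same (A σ₂ D) i')

  gram-spec : ∀ {σ} pt → Ready σ → Points pt σ → (∀ a → a < ℓ → A σ ctr a < N) → (∀ b → b < k → A σ ctr (p + b) < N) →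
    Outcome gram σ (lp ℓ (lp k (u + (lp q u + u))))
      (λ σ' → ∀ a b → a < ℓ → b < k →
         A σ' Gr (a * k + b) ≡ sumTo q (λ h → bit (pt (A σ ctr a) h) * bit (pt (A σ ctr (p + b)) h)))
  gram-spec {σ} pt rdy pts row< col< = weaken ≤-refl (λ _ → proj₁)
    (tabulate-rule Gr 0 ℓ k value (par₃ rdy) refl (λ i fr → trans (sameV fr 4 refl) (par₄ rdy)) cell)
    where
    value : ℕ → ℕ → ℕ
    value a b = sumTo q (λ h → bit (pt (A σ ctr a) h) * bit (pt (A σ ctr (p + b)) h))
    cell : ∀ {σ'} a b → a < ℓ → b < k → Frame gram σ σ' → V σ' 28 ≡ a →
           Outcome gramCell (setV 29 b σ') (u + (lp q u + u)) (λ σ'' → A σ'' Gr ≡ A σ' Gr [ a * k + b ≔ value a b ])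
    cell {σ'} a b a< b< fr e₂₈ =
      seq-rule {Q = λ σ₁ → σ₁ ≡ σ₁'} (straight refl) λ { _ _ refl →
      seq-rule {Q = λ σ₂ → V σ₂ 16 ≡ value a b} (sum-rule q _ (λ ()) (trans (sameV fr 1 refl) (par₁ rdy)) refl summand) λ σ₂ fr₂ e₁₆ →
      straight (trans (set-eq (A σ₂ Gr)
          (cong₂ _+_ (cong₂ _*_ (trans (sameV fr₂ 28 refl) e₂₈) (trans (sameV fr₂ 4 refl) (trans (sameV fr 4 refl) (par₄ rdy)))) (sameV fr₂ 29 refl))
          e₁₆) (cong (_[ a * k + b ≔ value a b ]) (sameA fr₂ Gr refl))) }
      where
      σ₁' = setV 16 0 (setV 29 b σ')
      loop₁ = for 15 (var 1) (16 := var 16 ⊕ gramTerm)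
      summand : ∀ {σ₂} h → h < q → Frame loop₁ σ₁' σ₂ →
                evalE gramTerm (setV 15 h σ₂) ≡ bit (pt (A σ ctr a) h) * bit (pt (A σ ctr (p + b)) h)
      summand {σ₂} h h< fr₂ = cong₂ _*_
        (trans (at-eq z≡ (cong₂ (λ a b → a * b + h) (at-eq c≡ (trans (sameV fr₂ 28 refl) e₂₈)) q≡)) (pts _ h (row< a a<) h<))
        (trans (at-eq z≡ (cong₂ (λ a b → a * b + h) (at-eq c≡ (cong₂ _+_ (trans (sameV fr₂ 0 refl) (trans (sameV fr 0 refl) (par₀ rdy))) (sameV fr₂ 29 refl))) q≡))
          (pts _ h (col< b b<) h<))
        where
        z≡ : A σ₂ Z ≡ A σ Z
        z≡ = trans (sameA fr₂ Z refl) (sameA fr Z refl)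
        c≡ : A σ₂ ctr ≡ A σ ctr
        c≡ = trans (sameA fr₂ ctr refl) (sameA fr ctr refl)
        q≡ : V σ₂ 1 ≡ q
        q≡ = trans (sameV fr₂ 1 refl) (trans (sameV fr 1 refl) (par₁ rdy))

  header-spec : ∀ {σ} → Ready σ →
    Outcome header σ u (λ σ' → A σ' hd 0 ≡ p × A σ' hd 1 ≡ q × A σ' hd 2 ≡ k)
  header-spec rdy = straight (par₀ rdy , par₁ rdy , par₄ rdy)

  record Clusters (off n c : ℕ) (σ : Env) : Set where
    field
      center  : ∀ i → i < c → Σ[ b ∈ ℕ ] b < n × centersOf off σ i ≡ off + b
      nearest : ∀ i → i < n → Σ[ d ∈ ℕ ] Nearest (gapOf (A σ Y)) (centersOf off σ) c (off + i) d (A σ asg (off + i)) (A σ cp (off + i))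

  open Clusters public

  clusters : ∀ {off n c σ₀ σ} → A σ Y ≡ A σ₀ Y → Clustering (gapOf (A σ₀ Y)) off n c σ₀ σ → Clusters off n c σ
  clusters {off} {n} {c} {σ₀} {σ} eq cl = record { center = center< cl
    ; nearest = λ i i< → _ , subst (λ y → Nearest (gapOf y) (centersOf off σ) c (off + i) _ (A σ asg (off + i)) (A σ cp (off + i))) (sym eq) (state cl i i<) }

  clusters-move : ∀ {off n c σ σ'} → c ≤ n → A σ' Y ≡ A σ Y →
    (∀ z → z < off + n → A σ' asg z ≡ A σ asg z × A σ' cp z ≡ A σ cp z × A σ' ctr z ≡ A σ ctr z) →
    Clusters off n c σ → Clusters off n c σ'
  clusters-move {off} {n} {c} {σ} {σ'} c≤n eY eq cl = record
    { center = λ i i< → let (b , b< , e) = center cl i i< in b , b< , trans (same-ctr i i<) e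
    ; nearest = λ i i< → let (d , nr) = nearest cl i i< ; (ea , ec , _) = eq (off + i) (+-monoʳ-< off i<) in d ,
        subst (λ y → Nearest (gapOf y) (centersOf off σ') c (off + i) d (A σ' asg (off + i)) (A σ' cp (off + i))) (sym eY)
          (subst₂ (Nearest (gapOf (A σ Y)) (centersOf off σ') c (off + i) d) (sym ea) (sym ec)
            (nearest-cong (λ j j< → sym (same-ctr j j<)) nr)) }
    where
    same-ctr : ∀ i → i < c → centersOf off σ' i ≡ centersOf off σ i
    same-ctr i i< = proj₂ (proj₂ (eq (off + i) (+-monoʳ-< off (<-≤-trans i< c≤n))))

  record Prepared (pt : ℕ → Point) (ω : List Bool) (σ : Env) : Set where
    field
      hd₀    : A σ hd 0 ≡ p
      hd₁    : A σ hd 1 ≡ q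
      hd₂    : A σ hd 2 ≡ k
      points : Points pt σ
      sketched : ∀ g t → g < N → t < m → A σ Y (g * m + t) ≡ sketch q (pt g) (List.drop (t * q) ω)
      rowClusters : Clusters 0 p ℓ σ
      colClusters : Clusters p r k σ
      cp<    : ∀ g → g < N → A σ cp g < N
      diffs  : ∀ g → g < N → Differences pt g σ σ
      grams  : ∀ i j → i < p → j < r →
               A σ Gr (A σ asg i * k + A σ asg (p + j)) ≡ sumTo q (λ h → bit (pt (A σ cp i) h) * bit (pt (A σ cp (p + j)) h))

  rowCenters-spec : ∀ {σ} → Ready σ → 1 ≤ p →
    Outcome rowCenters σ (u + (u + (u + lp ℓ (centerCost p)))) (Clusters 0 p ℓ)
  rowCenters-spec {σ} rdy 1≤p =
    seq-rule {Q = λ σ' → σ' ≡ σ₁} (straight refl) λ { _ _ refl →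
    seq-rule {Q = λ σ' → σ' ≡ σ₂} (straight refl) λ { _ _ refl →
    seq-rule {Q = λ σ' → σ' ≡ σ₃} (straight refl) λ { _ _ refl →
    conseq (λ σ' fr cl → clusters (sameA fr Y refl) cl)
      (centers-spec {σ₃} 0 p ℓ (ready {17 := lit 0 ⨾ 18 := var 0 ⨾ 19 := var 3} (run-frame (17 := lit 0 ⨾ 18 := var 0 ⨾ 19 := var 3) σ) rdy) refl (par₀ rdy) (par₃ rdy) 1≤p) } } }
    where
    σ₁ = setV 17 0 σ
    σ₂ = setV 18 (V σ 0) σ₁
    σ₃ = setV 19 (V σ 3) σ₂

  colCenters-spec : ∀ {σ} → Ready σ → 1 ≤ r →
    Outcome colCenters σ (u + (u + (u + lp k (centerCost r)))) (λ σ' → Clusters p r k σ' × SameBelow p σ σ')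
  colCenters-spec {σ} rdy 1≤r =
    seq-rule {Q = λ σ' → σ' ≡ σ₁} (straight refl) λ { _ _ refl →
    seq-rule {Q = λ σ' → σ' ≡ σ₂} (straight refl) λ { _ _ refl →
    seq-rule {Q = λ σ' → σ' ≡ σ₃} (straight refl) λ { _ _ refl →
    conseq (λ σ' fr cl → clusters (sameA fr Y refl) cl , below cl)
      (centers-spec {σ₃} p r k (ready {17 := var 0 ⨾ 18 := var 2 ⨾ 19 := var 4} (run-frame (17 := var 0 ⨾ 18 := var 2 ⨾ 19 := var 4) σ) rdy) (par₀ rdy) (par₂ rdy) (par₄ rdy) 1≤r) } } }
    where
    σ₁ = setV 17 (V σ 0) σ
    σ₂ = setV 18 (V σ 2) σ₁
    σ₃ = setV 19 (V σ 4) σ₂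

module Correctness (p q r ℓ k C : ℕ) where
  open Phases p q r ℓ k C
  open Traversal p q r ℓ k C
  open Tables p q r ℓ k C
  open Ready
  open Params

  inputSize : ℕ
  inputSize = p * q + q * r

  preprocessCost : ℕ
  preprocessCost =
    (u + lp inputSize u) + ((u + (u + (u + (lp N u + u)))) + (lp (m * q) u + (lp p (lp q u) + (lp r (lp q u)
    + (lp N (lp m (u + (lp q u + u))) + ((u + (u + (u + lp ℓ (centerCost p)))) + ((u + (u + (u + lp k (centerCost r))))
    + (lp N (u + (lp q u + u)) + (lp ℓ (lp k (u + (lp q u + u))) + u)))))))))

  center-index : ∀ {off n c σ} → 1 ≤ c → (cl : Clusters off n c σ) → ∀ i → i < n →
                 A σ asg (off + i) < c × A σ cp (off + i) ≡ A σ ctr (off + A σ asg (off + i))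
                 × (Σ[ b ∈ ℕ ] b < n × A σ cp (off + i) ≡ off + b)
  center-index {off} {n} {c} {σ} 1≤c cl i i< with nearest cl i i<
  ... | _ , nr = a< nr 1≤c , e≡ nr 1≤c , proj₁ c' , proj₁ (proj₂ c') , trans (e≡ nr 1≤c) (proj₂ (proj₂ c'))
    where c' = center cl (A σ asg (off + i)) (a< nr 1≤c)

  split-point : ∀ {P : ℕ → Set} → (∀ i → i < p → P i) → (∀ j → j < r → P (p + j)) → ∀ g → g < N → P g
  split-point {P} f g x x< with x <? p
  ... | yes x<p = f x x<p
  ... | no x≮p = subst P p+ (g (x ∸ p) (+-cancelˡ-< p (x ∸ p) r (subst (_< p + r) (sym p+) x<)))
    where p+ : p + (x ∸ p) ≡ x
          p+ = m+[n∸m]≡n (≮⇒≥ x≮p)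

  row-cell : ∀ {g h} → g < p → h < q → g * q + h < inputSize
  row-cell {g} g< h< = <-≤-trans (cell-mono {q} {p} {g} {0} g< h<) (≤-trans (≤-reflexive (+-identityʳ (p * q))) (m≤m+n _ _))

  col-cell : ∀ {g h} → g < r → h < q → p * q + (h * r + g) < inputSize
  col-cell {g} {h} g< h< = +-monoʳ-< (p * q) (<-≤-trans (cell-mono {r} {q} {h} {0} h< g<) (≤-reflexive (+-identityʳ (q * r))))

  preprocess-spec : ∀ {σ} (pt : ℕ → Point) → Params σ → 1 ≤ ℓ → ℓ ≤ p → 1 ≤ k → k ≤ r →
    (∀ x → x < inputSize → rawMem σ x ≤ 1) →
    (∀ g h → g < p → h < q → rawMem σ (g * q + h) ≡ bit (pt g h)) →
    (∀ g h → g < r → h < q → rawMem σ (p * q + (h * r + g)) ≡ bit (pt (p + g) h)) →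
    Outcome preprocess σ preprocessCost (Prepared pt (ωs σ))
  preprocess-spec {σ₀} pt par 1≤ℓ ℓ≤p 1≤k k≤r bits rows cols =
    seq-rule (copyInput-spec σ₀ inputSize (trans (cong₂ (λ a b → a * b + b * V σ₀ 2) (par₀ par) (par₁ par)) (cong (λ c → p * q + q * c) (par₂ par))) bits) λ σ₁ f₁ in₁ →
    seq-rule (computeLog-spec σ₁ N (cong₂ _+_ (trans (sameV f₁ 0 refl) (par₀ par)) (trans (sameV f₁ 2 refl) (par₂ par)))) λ σ₂ f₂ (e₇ , e₁₂) →
    let rdy₂ = ready₂ σ₁ σ₂ f₁ f₂ e₇ e₁₂
        In₂  = λ z → cong-app (sameA f₂ In refl) z in
    seq-rule (flipCoins-spec rdy₂) λ σ₃ f₃ coins₃ →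
    let rdy₃ = ready {flipCoins} f₃ rdy₂
        In₃  = λ z → trans (cong-app (sameA f₃ In refl) z) (In₂ z) in
    seq-rule (rowPoints-spec pt rdy₃ (λ g h g< h< → trans (In₃ _) (trans (in₁ _ (row-cell g< h<)) (rows g h g< h<)))) λ σ₄ f₄ rows₄ →
    let rdy₄ = ready {rowPoints} f₄ rdy₃ in
    seq-rule (colPoints-spec pt rdy₄
      (λ g h g< h< → trans (cong-app (sameA f₄ In refl) _) (trans (In₃ _) (trans (in₁ _ (col-cell g< h<)) (cols g h g< h<)))) rows₄) λ σ₅ f₅ pts₅ →
    let rdy₅ = ready {colPoints} f₅ rdy₄ in
    seq-rule (sketches-spec pt (ωs σ₀) rdy₅ pts₅ (λ i i< → trans (cong-app (trans (sameA f₅ S refl) (sameA f₄ S refl)) i)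
      (trans (coins₃ i i<) (cong (λ ω → bit (nth ω i)) (trans (sameω f₂ refl) (sameω f₁ refl)))))) λ σ₆ f₆ sk₆ →
    let rdy₆ = ready {sketches} f₆ rdy₅ in
    seq-rule (rowCenters-spec rdy₆ (≤-trans 1≤ℓ ℓ≤p)) λ σ₇ f₇ rc₇ →
    let rdy₇ = ready {rowCenters} f₇ rdy₆ in
    seq-rule (colCenters-spec rdy₇ (≤-trans 1≤k k≤r)) λ σ₈ f₈ (cc₈ , same₈) →
    let rdy₈ = ready {colCenters} f₈ rdy₇
        rc₈  = clusters-move {σ = σ₇} {σ₈} ℓ≤p (sameA f₈ Y refl) same₈ rc₇
        pts₈ = λ g h g< h< → trans (cong-app (trans (sameA f₈ Z refl) (trans (sameA f₇ Z refl) (sameA f₆ Z refl))) (g * q + h)) (pts₅ g h g< h<)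
        cp₈  = cp-bound σ₈ rc₈ cc₈ in
    seq-rule (differences-spec pt rdy₈ pts₈ cp₈) λ σ₉ f₉ diffs₉ →
    let rdy₉ = ready {differences} f₉ rdy₈
        pts₉ = λ g h g< h< → trans (cong-app (sameA f₉ Z refl) (g * q + h)) (pts₈ g h g< h<)
        rc₉ = clusters-move {σ = σ₈} {σ₉} ℓ≤p (sameA f₉ Y refl) (λ z _ → cong-app (sameA f₉ asg refl) z , cong-app (sameA f₉ cp refl) z , cong-app (sameA f₉ ctr refl) z) rc₈
        cc₉ = clusters-move {σ = σ₈} {σ₉} k≤r (sameA f₉ Y refl) (λ z _ → cong-app (sameA f₉ asg refl) z , cong-app (sameA f₉ cp refl) z , cong-app (sameA f₉ ctr refl) z) cc₈ in
    seq-rule (gram-spec pt rdy₉ pts₉ (λ a a< → let (b , b< , e) = center rc₉ a a< in subst (_< N) (sym e) (<-≤-trans b< (m≤m+n p r)))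
      (λ a a< → let (b , b< , e) = center cc₉ a a< in subst (_< N) (sym e) (+-monoʳ-< p b<))) λ σ₁₀ f₁₀ gram₁₀ →
    conseq (λ σ f (h₀ , h₁ , h₂) →
      let move : ∀ a → modA gram a ≡ false → modA header a ≡ false → A σ a ≡ A σ₉ a
          move = λ a e e' → trans (sameA f a e') (sameA f₁₀ a e)
          moves = λ z → cong-app (move asg refl refl) z , cong-app (move cp refl refl) z , cong-app (move ctr refl refl) z
          rc = clusters-move {σ = σ₉} {σ} ℓ≤p (move Y refl refl) (λ z _ → moves z) rc₉
          cc = clusters-move {σ = σ₉} {σ} k≤r (move Y refl refl) (λ z _ → moves z) cc₉
      in record
        { hd₀ = h₀ ; hd₁ = h₁ ; hd₂ = h₂
        ; points = λ g h g< h< → trans (cong-app (move Z refl refl) (g * q + h)) (pts₉ g h g< h<)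
        ; sketched = λ g t g< t< → trans (cong-app (trans (move Y refl refl) (trans (sameA f₉ Y refl) (trans (sameA f₈ Y refl) (sameA f₇ Y refl)))) (g * m + t)) (sk₆ g t g< t<)
        ; rowClusters = rc ; colClusters = cc
        ; cp< = cp-bound σ rc cc
        ; diffs = λ g g< → let (d≡ , list) = diffs₉ g g< ; e₈ = cong-app (trans (move cp refl refl) (sameA f₉ cp refl)) g in
            subst (λ y → DiffersOn (pt g) (pt y) (λ e → A σ D (g * q + e)) (A σ cnt g)) (sym e₈)
              (subst₂ (λ f n → DiffersOn (pt g) (pt (A σ₈ cp g)) (λ e → f (g * q + e)) n)
                (sym (move D refl refl)) (cong-app (sym (move cnt refl refl)) g) (d≡ , list))
        ; grams = λ i j i< j< →
            let (a< , e , _) = center-index {σ = σ} 1≤ℓ rc i i< ; (b< , e' , _) = center-index {σ = σ} 1≤k cc j j< in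
            trans (cong-app (sameA f Gr refl) _) (trans (gram₁₀ _ _ a< b<)
              (sumTo-cong q (λ h _ → cong₂ (λ g g' → bit (pt g h) * bit (pt g' h))
                (trans (cong-app (sym (move ctr refl refl)) _) (sym e)) (trans (cong-app (sym (move ctr refl refl)) _) (sym e')))))
        }) (header-spec (ready {gram} f₁₀ rdy₉))
    where
    ready₂ : ∀ σ₁ σ₂ → Frame copyInput σ₀ σ₁ → Frame computeLog σ₁ σ₂ → V σ₂ 7 ≡ N →
             V σ₂ 12 ≡ 16 * (V σ₁ 5 * ⌈log₂ N ⌉) → Ready σ₂
    ready₂ σ₁ σ₂ f₁ f₂ e₇ e₁₂ = record
      { params = record
        { par₀ = trans (sameV f₂ 0 refl) q₀ ; par₁ = trans (sameV f₂ 1 refl) (trans (sameV f₁ 1 refl) (par₁ par))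
        ; par₂ = trans (sameV f₂ 2 refl) q₂ ; par₃ = trans (sameV f₂ 3 refl) (trans (sameV f₁ 3 refl) (par₃ par))
        ; par₄ = trans (sameV f₂ 4 refl) (trans (sameV f₁ 4 refl) (par₄ par)) ; par₅ = trans (sameV f₂ 5 refl) q₅ }
      ; par₇ = e₇ ; par₁₂ = trans e₁₂ (cong (λ c → 16 * (c * ⌈log₂ N ⌉)) q₅) }
      where
      q₀ = trans (sameV f₁ 0 refl) (par₀ par)
      q₂ = trans (sameV f₁ 2 refl) (par₂ par)
      q₅ = trans (sameV f₁ 5 refl) (par₅ par)
    cp-bound : ∀ σ → Clusters 0 p ℓ σ → Clusters p r k σ → ∀ g → g < N → A σ cp g < N
    cp-bound σ rc cc = split-point
      (λ i i< → let (_ , _ , b , b< , e) = center-index {σ = σ} 1≤ℓ rc i i< in subst (_< N) (sym e) (<-≤-trans b< (m≤m+n p r)))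
      (λ j j< → let (_ , _ , b , b< , e) = center-index {σ = σ} 1≤k cc j j< in subst (_< N) (sym e) (+-monoʳ-< p b<))

  queryCost : ℕ → ℕ → ℕ
  queryCost a b = u + (u + (u + (u + (u + (u + (u + (u + (lp a u + (lp b u + u)))))))))

  query-spec : ∀ {σ pt ω} i j → V σ 0 ≡ i → V σ 1 ≡ j → i < p → j < r → Prepared pt ω σ →
    Outcome query σ (queryCost (A σ cnt i) (A σ cnt (p + j))) (λ σ' → V σ' 0 ≡ sumTo q (λ h → bit (pt i h) * bit (pt (p + j) h)))
  query-spec {σ} {pt} {ω} i j e₀ e₁ i< j< pr =
    seq-rule {Q = _≡ σ₁} (straight refl) λ { _ _ refl →
    seq-rule {Q = _≡ σ₂} (straight refl) λ { _ _ refl →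
    seq-rule {Q = _≡ σ₃} (straight refl) λ { _ _ refl →
    seq-rule {Q = _≡ σ₄} (straight refl) λ { _ _ refl →
    seq-rule {Q = _≡ σ₅} (straight refl) λ { _ _ refl →
    seq-rule {Q = _≡ σ₆} (straight refl) λ { _ _ refl →
    seq-rule {Q = _≡ σ₇} (straight refl) λ { _ _ refl →
    seq-rule {Q = _≡ σ₈} (straight refl) λ { _ _ refl →
    seq-rule {Q = I₉ (A σ cnt i)} (for-rule I₉ (cong (A σ cnt) e₀) ((sym (+-identityʳ _)) , refl) body₉) λ σ₉ f₉ (a₉ , b₉) →
    seq-rule {Q = I₁₀ σ₉ (A σ cnt gj)} (for-rule (I₁₀ σ₉) (at-eq (sameA f₉ cnt refl) (trans (sameV f₉ 5 refl) v₅)) ((sym (+-identityʳ _)) , (sym (+-identityʳ _))) (body₁₀ σ₉ f₉))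
      λ σ₁₀ f₁₀ (a₁₀ , b₁₀) →
    straight (trans (cong₂ (λ a b → a ∸ (a ∸ b)) (trans (sameV f₁₀ 3 refl) (trans (sameV f₉ 3 refl) hd₁))
        (trans (cong₂ _∸_ (trans a₁₀ (cong (_+ sumTo (A σ cnt gj) _) a₉)) (trans b₁₀ (cong (_+ sumTo (A σ cnt gj) _) b₉))) balance))
      (clamp value≤q)) } } } } } } } }
    where
    open Prepared pr
    gj = p + j
    σ₁ = setV 2 (A σ hd 0) σ
    σ₂ = setV 3 (A σ hd 1) σ₁
    σ₃ = setV 4 (A σ hd 2) σ₂
    σ₄ = setV 5 (A σ hd 0 + V σ 1) σ₃
    σ₅ = setV 6 (A σ cp (V σ 0)) σ₄
    σ₆ = setV 7 (A σ cp (A σ hd 0 + V σ 1)) σ₅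
    σ₇ = setV 8 (A σ Gr (A σ asg (V σ 0) * A σ hd 2 + A σ asg (A σ hd 0 + V σ 1))) σ₆
    σ₈ = setV 9 0 σ₇
    g₀ = V σ₈ 8
    v₅ : V σ₈ 5 ≡ gj
    v₅ = cong₂ _+_ hd₀ e₁
    cu = A σ cp i
    cv = A σ cp gj
    v₆ : V σ₈ 6 ≡ cu
    v₆ = cong (A σ cp) e₀
    v₇ : V σ₈ 7 ≡ cv
    v₇ = cong (A σ cp) v₅
    z : ℕ → ℕ → ℕ
    z g h = A σ Z (g * q + h)
    Di Dj : ℕ → ℕ
    Di e = A σ D (i * q + e)
    Dj e = A σ D (gj * q + e)
    I₉ : ℕ → Env → Set
    I₉ n σ' = V σ' 8 ≡ g₀ + sumTo n (λ e → z i (Di e) * z cv (Di e)) × V σ' 9 ≡ sumTo n (λ e → z cu (Di e) * z cv (Di e))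
    I₁₀ : Env → ℕ → Env → Set
    I₁₀ σ₉ n σ' = V σ' 8 ≡ V σ₉ 8 + sumTo n (λ e → z i (Dj e) * z gj (Dj e)) × V σ' 9 ≡ V σ₉ 9 + sumTo n (λ e → z i (Dj e) * z cv (Dj e))
    entryAt : ∀ {a b c d g' h'} (f : ℕ → ℕ) → f ≡ A σ Z → a ≡ g' → b ≡ q → c ≡ h' → d ≡ z g' h' → f (a * b + c) ≡ d
    entryAt f refl refl refl refl refl = refl
    add-term : ∀ a n (f : ℕ → ℕ) {v t} → v ≡ a + sumTo n f → t ≡ f n → v + t ≡ a + sumTo (suc n) f
    add-term a n f refl refl = trans (+-assoc a (sumTo n f) (f n)) (cong (a +_) (sym (sumTo-snoc n f)))
    body₉ : ∀ n σ' → n < A σ cnt i → Frame (for 10 (rd cnt (var 0)) rowTerm) σ₈ σ' → I₉ n σ' → Outcome rowTerm (setV 10 n σ') u (I₉ (suc n))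
    body₉ n σ' _ fr (a , b) = straight
      ( add-term g₀ n _ a (cong₂ _*_ (entryAt (A σ' Z) z≡ w₀ w₃ h≡ refl) (entryAt (A σ' Z) z≡ w₇ w₃ h≡ refl))
      , add-term 0 n _ b (cong₂ _*_ (entryAt (A σ' Z) z≡ w₆ w₃ h≡ refl) (entryAt (A σ' Z) z≡ w₇ w₃ h≡ refl)))
      where
      z≡ = sameA fr Z refl
      w₀ = trans (sameV fr 0 refl) e₀
      w₃ = trans (sameV fr 3 refl) hd₁
      w₆ = trans (sameV fr 6 refl) v₆
      w₇ = trans (sameV fr 7 refl) v₇
      h≡ : A σ' D (V σ' 0 * V σ' 3 + n) ≡ Di n
      h≡ = at-eq (sameA fr D refl) (cong₂ (λ a b → a * b + n) w₀ w₃)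
    body₁₀ : ∀ σ₉ → Frame (for 10 (rd cnt (var 0)) rowTerm) σ₈ σ₉ → ∀ n σ' → n < A σ cnt gj →
             Frame (for 10 (rd cnt (var 5)) colTerm) σ₉ σ' → I₁₀ σ₉ n σ' → Outcome colTerm (setV 10 n σ') u (I₁₀ σ₉ (suc n))
    body₁₀ σ₉ f₉ n σ' _ fr (a , b) = straight
      ( add-term (V σ₉ 8) n _ a (cong₂ _*_ (entryAt (A σ' Z) z≡ w₀ w₃ h≡ refl) (entryAt (A σ' Z) z≡ w₅ w₃ h≡ refl))
      , add-term (V σ₉ 9) n _ b (cong₂ _*_ (entryAt (A σ' Z) z≡ w₀ w₃ h≡ refl) (entryAt (A σ' Z) z≡ w₇ w₃ h≡ refl)))
      where
      z≡ = trans (sameA fr Z refl) (sameA f₉ Z refl)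
      w₀ = trans (sameV fr 0 refl) (trans (sameV f₉ 0 refl) e₀)
      w₃ = trans (sameV fr 3 refl) (trans (sameV f₉ 3 refl) hd₁)
      w₅ = trans (sameV fr 5 refl) (trans (sameV f₉ 5 refl) v₅)
      w₇ = trans (sameV fr 7 refl) (trans (sameV f₉ 7 refl) v₇)
      h≡ : A σ' D (V σ' 5 * V σ' 3 + n) ≡ Dj n
      h≡ = at-eq (trans (sameA fr D refl) (sameA f₉ D refl)) (cong₂ (λ a b → a * b + n) w₅ w₃)
    x y : Point
    x = pt i
    y = pt gj
    gi< : i < N
    gi< = <-≤-trans i< (m≤m+n p r)
    gj< : gj < N
    gj< = +-monoʳ-< p j<
    cu< = cp< i gi<
    cv< = cp< gj gj<
    value : ℕ
    value = sumTo q (λ h → bit (x h) * bit (y h))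
    value≤q : value ≤ q
    value≤q = ≤-trans (sumTo-mono q (λ h _ → *-mono-≤ (bit≤1 (x h)) (bit≤1 (y h)))) (≤-reflexive (trans (sumTo-const q 1) (*-identityʳ q)))
    expand : ∀ g a b → g < N → a < N → b < N →
             sumTo (A σ cnt g) (λ e → z a (A σ D (g * q + e)) * z b (A σ D (g * q + e)))
             ≡ sumTo q (λ h → bit (pt g h xor pt (A σ cp g) h) * (bit (pt a h) * bit (pt b h)))
    expand g a b g< a< b< = trans (proj₂ (diffs g g<) (λ h → z a h * z b h))
      (sumTo-cong q (λ h h< → cong (bit (pt g h xor pt (A σ cp g) h) *_) (cong₂ _*_ (points a h a< h<) (points b h b< h<))))
    balance : (g₀ + sumTo (A σ cnt i) (λ e → z i (Di e) * z cv (Di e))) + sumTo (A σ cnt gj) (λ e → z i (Dj e) * z gj (Dj e))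
              ∸ (sumTo (A σ cnt i) (λ e → z cu (Di e) * z cv (Di e)) + sumTo (A σ cnt gj) (λ e → z i (Dj e) * z cv (Dj e))) ≡ value
    balance = trans (cong₂ _∸_ (trans (+-assoc g₀ _ _) (trans (cong₂ _+_ gram≡ (cong₂ _+_ (expand i i cv gi< gi< cv<) (expand gj i gj gj< gi< gj<))) sides))
                                (cong₂ _+_ (expand i cu cv gi< cu< cv<) (expand gj i cv gj< gi< cv<)))
              (m+n∸n≡m value (sumTo q (λ h → bit (x h xor pt cu h) * (bit (pt cu h) * bit (pt cv h)))
                              + sumTo q (λ h → bit (y h xor pt cv h) * (bit (x h) * bit (pt cv h)))))
      where
      gram≡ : g₀ ≡ sumTo q (λ h → bit (pt cu h) * bit (pt cv h))
      gram≡ = trans (cong (A σ Gr) (cong₂ _+_ (cong₂ _*_ (cong (A σ asg) e₀) hd₂) (cong (A σ asg) v₅))) (grams i j i< j<)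
      sides : sumTo q (λ h → bit (pt cu h) * bit (pt cv h))
              + (sumTo q (λ h → bit (x h xor pt cu h) * (bit (x h) * bit (pt cv h))) + sumTo q (λ h → bit (y h xor pt cv h) * (bit (x h) * bit (y h))))
              ≡ value + (sumTo q (λ h → bit (x h xor pt cu h) * (bit (pt cu h) * bit (pt cv h))) + sumTo q (λ h → bit (y h xor pt cv h) * (bit (x h) * bit (pt cv h))))
      sides = trans (merge _ _ _) (trans (sumTo-cong q (λ h _ → correction (x h) (pt cu h) (y h) (pt cv h))) (sym (merge _ _ _)))
        where
        merge : ∀ f g h → sumTo q f + (sumTo q g + sumTo q h) ≡ sumTo q (λ i → f i + (g i + h i))
        merge f g h = trans (cong (sumTo q f +_) (sym (sumTo-+ q g h))) (sym (sumTo-+ q f (λ i → g i + h i)))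

point : ∀ {q} → Vec Bool q → Point
point v = nth (toList v)

nth-lookup : ∀ {q} (v : Vec Bool q) i → nth (toList v) (toℕ i) ≡ lookup v i
nth-lookup (b ∷ v) Fin.zero    = refl
nth-lookup (b ∷ v) (Fin.suc i) = nth-lookup v i

ham≡dist : ∀ {q} (a b : Vec Bool q) → ham a b ≡ dist q (point a) (point b)
ham≡dist []      []      = refl
ham≡dist (x ∷ a) (y ∷ b) = cong (bit (x xor y) +_) (ham≡dist a b)

dist≤ : ∀ q x y → dist q x y ≤ q
dist≤ q x y = ≤-trans (sumTo-mono q (λ i _ → bit≤1 (x i xor y i))) (≤-reflexive (trans (sumTo-const q 1) (*-identityʳ q)))

-- The g-th row of a matrix; beyond the last row, the zero point.
rowAt : ∀ {n q} → Vec (Vec Bool q) n → ℕ → Point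
rowAt []       g       h = false
rowAt (x ∷ xs) zero    h = point x h
rowAt (x ∷ xs) (suc g) h = rowAt xs g h

rowAt-lookup : ∀ {n q} (X : Vec (Vec Bool q) n) i h → rowAt X (toℕ i) h ≡ point (lookup X i) h
rowAt-lookup (x ∷ X) Fin.zero    h = refl
rowAt-lookup (x ∷ X) (Fin.suc i) h = rowAt-lookup X i h

rowAt-++ˡ : ∀ {m n q} (X : Vec (Vec Bool q) m) (X' : Vec (Vec Bool q) n) {g} → g < m → ∀ h →
            rowAt (X Vec.++ X') g h ≡ rowAt X g h
rowAt-++ˡ (x ∷ X) X' {zero}  g<       h = refl
rowAt-++ˡ (x ∷ X) X' {suc g} (s≤s g<) h = rowAt-++ˡ X X' g< h

rowAt-++ʳ : ∀ {m n q} (X : Vec (Vec Bool q) m) (X' : Vec (Vec Bool q) n) g h →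
            rowAt (X Vec.++ X') (m + g) h ≡ rowAt X' g h
rowAt-++ʳ []      X' g h = refl
rowAt-++ʳ (x ∷ X) X' g h = rowAt-++ʳ X X' g h

lookup-transpose : ∀ {m n} (X : Vec (Vec Bool n) m) i j → lookup (lookup (transpose X) j) i ≡ lookup (lookup X i) j
lookup-transpose {suc m} {n} (x ∷ X) i j = trans (cong (λ v → lookup v i) column) (go i)
  where
  cons : Bool → Vec Bool m → Vec Bool (suc m)
  cons b v = b ∷ v
  column : lookup (transpose (x ∷ X)) j ≡ cons (lookup x j) (lookup (transpose X) j)
  column = trans (Vec.lookup-⊛ j (Vec.replicate n cons Vec.⊛ x) (transpose X))
    (cong (λ f → f (lookup (transpose X) j)) (trans (Vec.lookup-⊛ j (Vec.replicate n cons) x)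
      (cong (λ f → f (lookup x j)) (Vec.lookup-replicate j cons))))
  go : ∀ i → lookup (cons (lookup x j) (lookup (transpose X) j)) i ≡ lookup (lookup (x ∷ X) i) j
  go Fin.zero    = refl
  go (Fin.suc i) = lookup-transpose X i j

rowAt-transpose : ∀ {m n} (X : Vec (Vec Bool n) m) {g h} → g < n → h < m → rowAt (transpose X) g h ≡ rowAt X h g
rowAt-transpose X {g} {h} g< h< = subst₂ (λ g h → rowAt (transpose X) g h ≡ rowAt X h g) (Fin.toℕ-fromℕ< g<) (Fin.toℕ-fromℕ< h<)
  (trans (rowAt-lookup (transpose X) j (toℕ i)) (trans (nth-lookup (lookup (transpose X) j) i)
    (trans (lookup-transpose X i j) (sym (trans (rowAt-lookup X i (toℕ j)) (nth-lookup (lookup X i) j))))))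
  where
  i = Fin.fromℕ< h<
  j = Fin.fromℕ< g<

cells-bits : ∀ l x → cells (List.map bit l) x ≡ bit (nth l x)
cells-bits []      x       = refl
cells-bits (b ∷ l) zero    = refl
cells-bits (b ∷ l) (suc x) = cells-bits l x

nth-++ʳ : ∀ l l' x → nth (l ++ l') (length l + x) ≡ nth l' x
nth-++ʳ []      l' x = refl
nth-++ʳ (b ∷ l) l' x = nth-++ʳ l l' x

nth-concat : ∀ {n q} (X : Vec (Vec Bool q) n) g h → g < n → h < q → nth (toList (concat X)) (g * q + h) ≡ rowAt X g h
nth-concat {q = q} (x ∷ X) zero    h g< h< = trans (cong (λ l → nth l h) (Vec.toList-++ x (concat X)))
  (nth-++ (toList x) (toList (concat X)) (subst (h <_) (sym (Vec.length-toList x)) h<))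
nth-concat {q = q} (x ∷ X) (suc g) h (s≤s g<) h< = trans (cong₂ nth (Vec.toList-++ x (concat X))
    (trans (+-assoc q (g * q) h) (cong (_+ (g * q + h)) (sym (Vec.length-toList x)))))
  (trans (nth-++ʳ (toList x) (toList (concat X)) (g * q + h)) (nth-concat X g h g< h<))

sum-tabulate : ∀ n (f : Fin n → ℕ) (g : ℕ → ℕ) → (∀ i → f i ≡ g (toℕ i)) → Vec.sum (Vec.tabulate f) ≡ sumTo n g
sum-tabulate zero    f g eq = refl
sum-tabulate (suc n) f g eq = cong₂ _+_ (eq Fin.zero) (sum-tabulate n (f ∘ Fin.suc) (g ∘ suc) (eq ∘ Fin.suc))

productEntry≡ : ∀ {p q r} (A : Matrix01 p q) (B : Matrix01 q r) i j →
  productEntry A B i j ≡ sumTo q (λ h → bit (rowAt A (toℕ i) h) * bit (rowAt (transpose B) (toℕ j) h))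
productEntry≡ {q = q} A B i j = sum-tabulate q _ _ (λ h → cong₂ (λ a b → bit a * bit b)
  (sym (trans (rowAt-lookup A i (toℕ h)) (nth-lookup (lookup A i) h)))
  (sym (trans (rowAt-lookup (transpose B) j (toℕ h)) (trans (nth-lookup (lookup (transpose B) j) h) (lookup-transpose B h j)))))

-- Covering radii

∈-subsetsOfSize : ∀ {X : Set} m (xs : List X) {T} → T ∈ subsetsOfSize m xs → length T ≡ m
∈-subsetsOfSize zero    xs       (here refl) = refl
∈-subsetsOfSize (suc m) (x ∷ xs) T∈ with ∈-++⁻ (List.map (x ∷_) (subsetsOfSize m xs)) T∈
... | inj₂ T∈' = ∈-subsetsOfSize (suc m) xs T∈'
... | inj₁ T∈' with ∈-map⁻ (x ∷_) T∈'
...   | T' , T'∈ , refl = cong suc (∈-subsetsOfSize m xs T'∈)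

nthPoint : ∀ {q} → List (Vec Bool q) → ℕ → Point
nthPoint []      c       h = false
nthPoint (v ∷ T) zero    h = point v h
nthPoint (v ∷ T) (suc c) h = nthPoint T c h

∈⇒nthPoint : ∀ {q} {T : List (Vec Bool q)} {v} → v ∈ T →
             Σ[ c ∈ ℕ ] c < length T × (∀ x → dist q x (nthPoint T c) ≡ dist q x (point v))
∈⇒nthPoint (here refl) = 0 , s≤s z≤n , λ x → refl
∈⇒nthPoint (there v∈) with ∈⇒nthPoint v∈
... | c , c< , eq = suc c , s≤s c< , eq

Covers : ∀ {n} q ℓ → Vec (Vec Bool q) n → (ℕ → Point) → ℕ → Set
Covers {n} q ℓ X U ρ = ∀ i → i < n → Σ[ c ∈ ℕ ] c < ℓ × dist q (rowAt X i) (U c) ≤ ρ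

distanceTo-attained : ∀ {q ℓ ρ} (T : List (Vec Bool q)) x → 1 ≤ ℓ → length T ≤ ℓ → distanceTo T x ≤ ρ →
                      Σ[ c ∈ ℕ ] c < ℓ × dist q (point x) (nthPoint T c) ≤ ρ
distanceTo-attained {q} T x 1≤ℓ T≤ℓ le with argmin-sel (λ z → z) q (List.map (ham x) T)
... | inj₁ eq = 0 , 1≤ℓ , ≤-trans (dist≤ q (point x) (nthPoint T 0)) (subst (_≤ _) eq le)
... | inj₂ d∈ with ∈-map⁻ (ham x) d∈
...   | v , v∈ , eq with ∈⇒nthPoint v∈
...     | c , c< , dist≡ = c , <-≤-trans c< T≤ℓ , ≤-trans (≤-reflexive (trans (dist≡ (point x)) (trans (sym (ham≡dist x v)) (sym eq)))) le

radius-covers : ∀ {n q ℓ} (X : Vec (Vec Bool q) n) T → 1 ≤ ℓ → length T ≤ ℓ → Covers q ℓ X (nthPoint T) (radius X T)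
radius-covers {ℓ = ℓ} X T 1≤ℓ T≤ℓ = go X (All.map⁻ (xs≤max 0 (List.map (distanceTo T) (toList X))))
  where
  go : ∀ {n ρ} (X : Vec _ n) → All (λ x → distanceTo T x ≤ ρ) (toList X) → Covers _ ℓ X (nthPoint T) ρ
  go (x ∷ X) (le All.∷ les) zero    i<       = distanceTo-attained T x 1≤ℓ T≤ℓ le
  go (x ∷ X) (le All.∷ les) (suc i) (s≤s i<) = go X les i i<

coveringRadius-covers : ∀ {n q} ℓ (X : Vec (Vec Bool q) n) → 1 ≤ ℓ → Σ[ U ∈ (ℕ → Point) ] Covers q ℓ X U (coveringRadius ℓ X)
coveringRadius-covers {q = q} ℓ X 1≤ℓ
  with argmin-sel (λ z → z) q (List.map (radius X) (subsetsOfSize (ℓ ⊓ 2 ^ q) (bitVectors q)))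
... | inj₁ eq = (λ _ _ → false) , λ i i< → 0 , 1≤ℓ , ≤-trans (dist≤ q (rowAt X i) (λ _ → false)) (≤-reflexive (sym eq))
... | inj₂ ρ∈ with ∈-map⁻ (radius X) ρ∈
...   | T , T∈ , eq = nthPoint T , λ i i< →
          let (c , c< , le) = radius-covers X T 1≤ℓ (≤-trans (≤-reflexive (∈-subsetsOfSize _ _ T∈)) (m⊓n≤m ℓ (2 ^ q))) i i<
          in c , c< , ≤-trans le (≤-reflexive (sym eq))

isqrt : ℕ → ℕ
isqrt zero    = 0
isqrt (suc n) = if suc (isqrt n) * suc (isqrt n) ≤ᵇ suc n then suc (isqrt n) else isqrt n

isqrt-spec : ∀ n → isqrt n * isqrt n ≤ n × n < suc (isqrt n) * suc (isqrt n)
isqrt-spec zero    = z≤n , s≤s z≤n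
isqrt-spec (suc n) with suc (isqrt n) * suc (isqrt n) ≤ᵇ suc n in eq | isqrt-spec n
... | true  | lo , hi = ≤ᵇ⇒≤ _ _ (subst T (sym eq) tt) , ≤-<-trans hi (*-mono-< (n<1+n (suc (isqrt n))) (n<1+n (suc (isqrt n))))
... | false | lo , hi = ≤-trans lo (n≤1+n n) , ≰⇒> λ le → subst T eq (≤⇒≤ᵇ le)

-- Running time

1≤⌈log₂⌉ : ∀ {n} → 2 ≤ n → 1 ≤ ⌈log₂ n ⌉
1≤⌈log₂⌉ = ⌈log₂⌉-mono-≤ {2}

⌈log₂n⌉≤n : ∀ n → ⌈log₂ n ⌉ ≤ n
⌈log₂n⌉≤n n = ≤2^⇒⌈log₂⌉≤ (n≤2^n n)

⌈log₂⌉-sum≤ : ∀ {p r} → p ≤ r → 1 ≤ r → ⌈log₂ (p + r) ⌉ ≤ 1 + ⌈log₂ r ⌉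
⌈log₂⌉-sum≤ {p} {r} p≤r 1≤r = ≤-trans (⌈log₂⌉-mono-≤ (+-mono-≤ p≤r (≤-reflexive (sym (+-identityʳ r)))))
  (≤-reflexive (⌈log₂2*n⌉≡1+⌈log₂n⌉ r {{>-nonZero 1≤r}}))

double-log : ∀ {p r} → p ≤ r → 2 ≤ r → ⌈log₂ (p + r) ⌉ ≤ 2 * ⌈log₂ r ⌉
double-log {p} {r} p≤r 2≤r = ≤-trans (⌈log₂⌉-sum≤ p≤r (≤-trans (s≤s z≤n) 2≤r))
  (≤-trans (+-monoˡ-≤ ⌈log₂ r ⌉ (1≤⌈log₂⌉ 2≤r)) (≤-reflexive (cong (⌈log₂ r ⌉ +_) (sym (+-identityʳ _)))))

scan-half : ∀ {p r k q} → 1 ≤ p → p ≤ r → 1 ≤ k →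
            (p + r) * ⌈log₂ (p + r) ⌉ * (q + 1) ≤ 4 * (r * ⌈log₂ r ⌉ * (q + k) + (q + 1))
scan-half {p} {r} {k} {q} 1≤p p≤r 1≤k with m≤n⇒m<n∨m≡n (≤-trans 1≤p p≤r)
... | inj₂ refl = subst (λ p → (p + 1) * ⌈log₂ (p + 1) ⌉ * (q + 1) ≤ 4 * (1 * ⌈log₂ 1 ⌉ * (q + k) + (q + 1))) (≤-antisym 1≤p p≤r)
  (≤-trans (*-monoˡ-≤ (q + 1) (m≤m+n 2 2)) (*-monoʳ-≤ 4 (m≤n+m (q + 1) 0)))
... | inj₁ 2≤r = begin
  (p + r) * ⌈log₂ (p + r) ⌉ * (q + 1) ≤⟨ *-mono-≤ (*-mono-≤ (+-monoˡ-≤ r p≤r) (double-log p≤r 2≤r)) (+-monoʳ-≤ q 1≤k) ⟩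
  (r + r) * (2 * ⌈log₂ r ⌉) * (q + k) ≡⟨ lem r ⌈log₂ r ⌉ (q + k) ⟩
  4 * (r * ⌈log₂ r ⌉ * (q + k))       ≤⟨ *-monoʳ-≤ 4 (m≤m+n (r * ⌈log₂ r ⌉ * (q + k)) (q + 1)) ⟩
  4 * (r * ⌈log₂ r ⌉ * (q + k) + (q + 1)) ∎
  where
  open ≤-Reasoning
  lem : ∀ r l z → (r + r) * (2 * l) * z ≡ 4 * (r * l * z)
  lem = solve-∀

module Time {p q r ℓ k : ℕ} (1≤ℓ : 1 ≤ ℓ) (ℓ≤p : ℓ ≤ p) (1≤k : 1 ≤ k) (k≤r : k ≤ r) where
  tc = preprocessingCost p q r ℓ k
  L  = ⌈log₂ (p + r) ⌉
  a  = p * ⌈log₂ p ⌉ * (q + ℓ)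
  b  = r * ⌈log₂ r ⌉ * (q + k)
  1≤p = ≤-trans 1≤ℓ ℓ≤p
  1≤r = ≤-trans 1≤k k≤r

  1≤pr : 1 ≤ p * r
  1≤pr = *-mono-≤ 1≤p 1≤r

  q≤ℓqk : q ≤ ℓ * q * k
  q≤ℓqk = ≤-trans (≤-reflexive (trans (sym (*-identityˡ q)) (sym (*-identityʳ (1 * q))))) (*-mono-≤ (*-monoˡ-≤ q 1≤ℓ) 1≤k)

  1≤L : 1 ≤ L
  1≤L = 1≤⌈log₂⌉ (+-mono-≤ 1≤p 1≤r)

  scan≤ : (p + r) * L * (q + 1) ≤ 4 * tc
  scan≤ with ≤-total p r
  ... | inj₁ p≤r = ≤-trans (scan-half {p} {r} {k} {q} 1≤p p≤r 1≤k) (*-monoʳ-≤ 4 (begin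
      b + (q + 1) ≤⟨ +-monoʳ-≤ b (+-mono-≤ q≤ℓqk 1≤pr) ⟩
      b + (ℓ * q * k + p * r) ≤⟨ m≤n+m _ a ⟩
      a + (b + (ℓ * q * k + p * r)) ≡⟨ lem a b (ℓ * q * k) (p * r) ⟩
      tc ∎))
    where
    open ≤-Reasoning
    lem : ∀ a b c d → a + (b + (c + d)) ≡ a + b + c + d
    lem = solve-∀
  ... | inj₂ r≤p = ≤-trans (≤-reflexive (cong (λ n → n * ⌈log₂ n ⌉ * (q + 1)) (+-comm p r)))
    (≤-trans (scan-half {r} {p} {ℓ} {q} 1≤r r≤p 1≤ℓ) (*-monoʳ-≤ 4 (begin
      a + (q + 1) ≤⟨ +-monoʳ-≤ a (+-mono-≤ q≤ℓqk 1≤pr) ⟩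
      a + (ℓ * q * k + p * r) ≤⟨ m≤n+m _ b ⟩
      b + (a + (ℓ * q * k + p * r)) ≡⟨ lem a b (ℓ * q * k) (p * r) ⟩
      tc ∎)))
    where
    open ≤-Reasoning
    lem : ∀ a b c d → b + (a + (c + d)) ≡ a + b + c + d
    lem = solve-∀

traversal-half : ∀ {p r ℓ k q} → 1 ≤ ℓ → ℓ ≤ p → 1 ≤ r → 1 ≤ k →
  p * ℓ * ⌈log₂ (p + r) ⌉ ≤ 3 * (p * ⌈log₂ p ⌉ * (q + ℓ) + r * ⌈log₂ r ⌉ * (q + k) + p * r)
traversal-half {p} {r} {ℓ} {k} {q} 1≤ℓ ℓ≤p 1≤r 1≤k with ≤-total r p
... | inj₁ r≤p with m≤n⇒m<n∨m≡n (≤-trans 1≤ℓ ℓ≤p)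
...   | inj₂ refl = subst₂ (λ ℓ r → 1 * ℓ * ⌈log₂ (1 + r) ⌉ ≤ 3 * (0 + r * ⌈log₂ r ⌉ * (q + k) + 1 * r)) (≤-antisym 1≤ℓ ℓ≤p) (≤-antisym 1≤r r≤p)
        (m≤m+n 1 2)
...   | inj₁ 2≤p = begin
  p * ℓ * ⌈log₂ (p + r) ⌉       ≡⟨ cong (λ n → p * ℓ * ⌈log₂ n ⌉) (+-comm p r) ⟩
  p * ℓ * ⌈log₂ (r + p) ⌉       ≤⟨ *-monoʳ-≤ (p * ℓ) (double-log r≤p 2≤p) ⟩
  p * ℓ * (2 * ⌈log₂ p ⌉)       ≤⟨ m≤m+n _ (p * ℓ * ⌈log₂ p ⌉) ⟩
  p * ℓ * (2 * ⌈log₂ p ⌉) + p * ℓ * ⌈log₂ p ⌉ ≡⟨ lem p ℓ ⌈log₂ p ⌉ ⟩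
  3 * (p * ⌈log₂ p ⌉ * ℓ)       ≤⟨ *-monoʳ-≤ 3 (≤-trans (*-monoʳ-≤ (p * ⌈log₂ p ⌉) (m≤n+m ℓ q)) (≤-trans (m≤m+n _ (r * ⌈log₂ r ⌉ * (q + k))) (m≤m+n _ (p * r)))) ⟩
  3 * (p * ⌈log₂ p ⌉ * (q + ℓ) + r * ⌈log₂ r ⌉ * (q + k) + p * r) ∎
  where
  open ≤-Reasoning
  lem : ∀ p ℓ l → p * ℓ * (2 * l) + p * ℓ * l ≡ 3 * (p * l * ℓ)
  lem = solve-∀
traversal-half {p} {r} {ℓ} {k} {q} 1≤ℓ ℓ≤p 1≤r 1≤k | inj₂ p≤r with m≤n⇒m<n∨m≡n 1≤r
... | inj₂ refl = subst₂ (λ ℓ p → p * ℓ * ⌈log₂ (p + 1) ⌉ ≤ 3 * (p * ⌈log₂ p ⌉ * (q + ℓ) + 0 + p * 1))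
        (≤-antisym 1≤ℓ (≤-trans ℓ≤p p≤r)) (≤-antisym (≤-trans 1≤ℓ ℓ≤p) p≤r) (m≤m+n 1 2)
... | inj₁ 2≤r with ≤-total (p * p) r
...   | inj₁ p²≤r = begin
  p * ℓ * ⌈log₂ (p + r) ⌉       ≤⟨ *-mono-≤ (≤-trans (*-monoʳ-≤ p ℓ≤p) p²≤r) (double-log p≤r 2≤r) ⟩
  r * (2 * ⌈log₂ r ⌉)           ≤⟨ m≤m+n _ (r * ⌈log₂ r ⌉) ⟩
  r * (2 * ⌈log₂ r ⌉) + r * ⌈log₂ r ⌉ ≡⟨ lem r ⌈log₂ r ⌉ ⟩
  3 * (r * ⌈log₂ r ⌉ * 1)       ≤⟨ *-monoʳ-≤ 3 (≤-trans (*-monoʳ-≤ (r * ⌈log₂ r ⌉) (≤-trans 1≤k (m≤n+m k q)))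
                                     (≤-trans (m≤n+m _ (p * ⌈log₂ p ⌉ * (q + ℓ))) (m≤m+n _ (p * r)))) ⟩
  3 * (p * ⌈log₂ p ⌉ * (q + ℓ) + r * ⌈log₂ r ⌉ * (q + k) + p * r) ∎
  where
  open ≤-Reasoning
  lem : ∀ r l → r * (2 * l) + r * l ≡ 3 * (r * l * 1)
  lem = solve-∀
...   | inj₂ r≤p² = begin
  p * ℓ * ⌈log₂ (p + r) ⌉       ≤⟨ *-monoʳ-≤ (p * ℓ) (≤-trans (⌈log₂⌉-sum≤ p≤r 1≤r) (+-mono-≤ (1≤⌈log₂⌉ 2≤p) log-square)) ⟩
  p * ℓ * (⌈log₂ p ⌉ + 2 * ⌈log₂ p ⌉) ≡⟨ lem p ℓ ⌈log₂ p ⌉ ⟩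
  3 * (p * ⌈log₂ p ⌉ * ℓ)       ≤⟨ *-monoʳ-≤ 3 (≤-trans (*-monoʳ-≤ (p * ⌈log₂ p ⌉) (m≤n+m ℓ q)) (≤-trans (m≤m+n _ (r * ⌈log₂ r ⌉ * (q + k))) (m≤m+n _ (p * r)))) ⟩
  3 * (p * ⌈log₂ p ⌉ * (q + ℓ) + r * ⌈log₂ r ⌉ * (q + k) + p * r) ∎
  where
  open ≤-Reasoning
  lem : ∀ p ℓ l → p * ℓ * (l + 2 * l) ≡ 3 * (p * l * ℓ)
  lem = solve-∀
  2≤p : 2 ≤ p
  2≤p = ≰⇒> λ p≤1 → <⇒≱ 2≤r (≤-trans r≤p² (*-mono-≤ p≤1 p≤1))
  log-square : ⌈log₂ r ⌉ ≤ 2 * ⌈log₂ p ⌉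
  log-square = ≤2^⇒⌈log₂⌉≤ (≤-trans r≤p² (≤-trans (*-mono-≤ (n≤2^⌈log₂n⌉ p) (n≤2^⌈log₂n⌉ p))
    (≤-reflexive (trans (sym (^-distribˡ-+-* 2 ⌈log₂ p ⌉ ⌈log₂ p ⌉)) (cong (λ z → 2 ^ (⌈log₂ p ⌉ + z)) (sym (+-identityʳ _)))))))

u≤ : u ≤ 200
u≤ = ≤-reflexive u-def

lp≤ : ∀ n {K K'} → K ≤ K' → lp n K ≤ 100 + n * (K' + 7)
lp≤ n {K} le = ≤-trans (≤-reflexive (lp-def n K)) (+-monoʳ-≤ 100 (*-monoʳ-≤ n (+-monoˡ-≤ 7 le)))

module CostBound {p q r ℓ k C : ℕ} (1≤ℓ : 1 ≤ ℓ) (ℓ≤p : ℓ ≤ p) (1≤k : 1 ≤ k) (k≤r : k ≤ r) (1≤C : 1 ≤ C) where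
  open Time {p} {q} {r} {ℓ} {k} 1≤ℓ ℓ≤p 1≤k k≤r
  open Phases p q r ℓ k C using (N; m)
  open Traversal p q r ℓ k C using (centerCost)
  open Correctness p q r ℓ k C using (inputSize; preprocessCost; queryCost)

  scanWork rowWork colWork : ℕ
  scanWork = C * (N * L * (q + 1))
  rowWork  = C * (p * ℓ * L)
  colWork  = C * (r * k * L)

  1≤N : 1 ≤ N
  1≤N = ≤-trans 1≤p (m≤m+n p r)

  *-grow : ∀ {x y} → 1 ≤ y → x ≤ x * y
  *-grow {x} 1≤y = ≤-trans (≤-reflexive (sym (*-identityʳ x))) (*-monoʳ-≤ x 1≤y)

  *-growˡ : ∀ {x y} → 1 ≤ y → x ≤ y * x
  *-growˡ {x} 1≤y = ≤-trans (≤-reflexive (sym (*-identityˡ x))) (*-monoˡ-≤ x 1≤y)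

  N≤scan : N ≤ scanWork
  N≤scan = ≤-trans (≤-trans (*-grow {N} 1≤L) (*-grow {N * L} (m≤n+m 1 q))) (*-growˡ 1≤C)

  Nq≤scan : N * q ≤ scanWork
  Nq≤scan = ≤-trans (≤-trans (*-monoˡ-≤ q (*-grow {N} 1≤L)) (*-monoʳ-≤ (N * L) (m≤m+n q 1))) (*-growˡ 1≤C)

  1≤scan : 1 ≤ scanWork
  1≤scan = ≤-trans 1≤N N≤scan

  mq≤scan : m * q ≤ 16 * scanWork
  mq≤scan = begin
    16 * (C * L) * q          ≡⟨ lem C L q ⟩
    16 * (C * (1 * L * q))    ≤⟨ *-monoʳ-≤ 16 (*-monoʳ-≤ C (*-mono-≤ (*-monoˡ-≤ L 1≤N) (m≤m+n q 1))) ⟩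
    16 * scanWork             ∎
    where
    open ≤-Reasoning
    lem : ∀ C L q → 16 * (C * L) * q ≡ 16 * (C * (1 * L * q))
    lem = solve-∀

  linear : ∀ a b {x} → x ≤ scanWork → a + b * x ≤ (a + b) * scanWork
  linear a b le = ≤-trans (+-mono-≤ (*-grow {a} 1≤scan) (*-monoʳ-≤ b le)) (≤-reflexive (sym (*-distribʳ-+ scanWork a b)))

  copy≤ : u + lp inputSize u ≤ 507 * scanWork
  copy≤ = ≤-trans (+-mono-≤ u≤ (lp≤ inputSize u≤)) (≤-trans (≤-reflexive (lem p q r)) (linear 300 207 Nq≤scan))
    where lem : ∀ p q r → 200 + (100 + (p * q + q * r) * 207) ≡ 300 + 207 * ((p + r) * q)
          lem = solve-∀

  log≤ : u + (u + (u + (lp N u + u))) ≤ 1107 * scanWork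
  log≤ = ≤-trans (+-mono-≤ u≤ (+-mono-≤ u≤ (+-mono-≤ u≤ (+-mono-≤ (lp≤ N u≤) u≤)))) (≤-trans (≤-reflexive (lem N)) (linear 900 207 N≤scan))
    where lem : ∀ n → 200 + (200 + (200 + ((100 + n * 207) + 200))) ≡ 900 + 207 * n
          lem = solve-∀

  flips≤ : lp (m * q) u ≤ 3412 * scanWork
  flips≤ = ≤-trans (lp≤ (m * q) u≤) (≤-trans (+-mono-≤ (*-grow {100} 1≤scan) (*-monoˡ-≤ 207 mq≤scan)) (≤-reflexive (lem scanWork)))
    where lem : ∀ w → 100 * w + 16 * w * 207 ≡ 3412 * w
          lem = solve-∀

  points≤ : ∀ {n} → n ≤ N → lp n (lp q u) ≤ 414 * scanWork
  points≤ {n} n≤N = ≤-trans (lp≤ n (lp≤ q u≤)) (≤-trans (≤-reflexive (lem n q))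
    (≤-trans (+-mono-≤ (+-mono-≤ (*-grow {100} 1≤scan) (*-monoʳ-≤ 107 (≤-trans n≤N N≤scan))) (*-monoʳ-≤ 207 (≤-trans (*-monoˡ-≤ q n≤N) Nq≤scan)))
      (≤-reflexive (lem₂ scanWork))))
    where
    lem : ∀ n q → 100 + n * (100 + q * 207 + 7) ≡ 100 + 107 * n + 207 * (n * q)
    lem = solve-∀
    lem₂ : ∀ w → 100 * w + 107 * w + 207 * w ≡ 414 * w
    lem₂ = solve-∀

  cell≤ : u + (lp q u + u) ≤ 500 + 207 * q
  cell≤ = ≤-trans (+-mono-≤ u≤ (+-mono-≤ (lp≤ q u≤) u≤)) (≤-reflexive (lem q))
    where lem : ∀ q → 200 + (100 + q * 207 + 200) ≡ 500 + 207 * q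
          lem = solve-∀

  sketches≤ : lp N (lp m (u + (lp q u + u))) ≤ 8319 * scanWork
  sketches≤ = ≤-trans (lp≤ N (lp≤ m cell≤)) (≤-trans (m≤m+n _ (4800 * (C * (N * L * q)))) (≤-trans (≤-reflexive (lem N C L q))
    (≤-trans (+-monoˡ-≤ (8112 * scanWork) (linear 100 107 N≤scan)) (≤-reflexive (sym (*-distribʳ-+ scanWork 207 8112))))))
    where lem : ∀ n c l q → 100 + n * (100 + 16 * (c * l) * (500 + 207 * q + 7) + 7) + 4800 * (c * (n * l * q)) ≡ 100 + 107 * n + 8112 * (c * (n * l * (q + 1)))
          lem = solve-∀

  centers≤ : ∀ {n c} → 1 ≤ n → 1 ≤ c → u + (u + (u + lp c (centerCost n))) ≤ 6133 * (C * (n * c * L))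
  centers≤ {n} {c} 1≤n 1≤c = ≤-trans
    (+-mono-≤ u≤ (+-mono-≤ u≤ (+-mono-≤ u≤ (lp≤ c
      (+-mono-≤ (+-mono-≤ u≤ (+-mono-≤ u≤ (lp≤ n u≤))) (+-mono-≤ u≤ (+-mono-≤ u≤ (lp≤ n (+-mono-≤ (+-mono-≤ u≤ (lp≤ m u≤)) (+-mono-≤ u≤ (+-mono-≤ u≤ u≤)))))))))))
    (≤-trans (≤-reflexive (lem n c C L)) (≤-trans
      (+-monoˡ-≤ (3312 * w) (+-mono-≤ (+-mono-≤ (*-grow {700} 1≤w) (*-monoʳ-≤ 1007 (≤-trans (*-growˡ 1≤n) nc≤w))) (*-monoʳ-≤ 1114 nc≤w)))
      (≤-reflexive (lem₂ w))))
    where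
    w = C * (n * c * L)
    nc≤w : n * c ≤ w
    nc≤w = ≤-trans (*-grow 1≤L) (*-growˡ 1≤C)
    1≤w : 1 ≤ w
    1≤w = ≤-trans (*-mono-≤ 1≤n 1≤c) nc≤w
    lem : ∀ n c C L → 200 + (200 + (200 + (100 + c * ((200 + (200 + (100 + n * 207))) + (200 + (200 + (100 + n * ((200 + (100 + 16 * (C * L) * 207)) + (200 + (200 + 200)) + 7)))) + 7))))
          ≡ 700 + 1007 * c + 1114 * (n * c) + 3312 * (C * (n * c * L))
    lem = solve-∀
    lem₂ : ∀ w → 700 * w + 1007 * w + 1114 * w + 3312 * w ≡ 6133 * w
    lem₂ = solve-∀

  differences≤ : lp N (u + (lp q u + u)) ≤ 814 * scanWork
  differences≤ = ≤-trans (lp≤ N cell≤) (≤-trans (≤-reflexive (lem N q))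
    (≤-trans (+-mono-≤ (+-mono-≤ (*-grow {100} 1≤scan) (*-monoʳ-≤ 507 N≤scan)) (*-monoʳ-≤ 207 Nq≤scan)) (≤-reflexive (lem₂ scanWork))))
    where
    lem : ∀ n q → 100 + n * (500 + 207 * q + 7) ≡ 100 + 507 * n + 207 * (n * q)
    lem = solve-∀
    lem₂ : ∀ w → 100 * w + 507 * w + 207 * w ≡ 814 * w
    lem₂ = solve-∀

  gram≤ : lp ℓ (lp k (u + (lp q u + u))) ≤ 714 * (p * r) + 207 * (ℓ * q * k)
  gram≤ = ≤-trans (lp≤ ℓ (lp≤ k cell≤)) (≤-trans (≤-reflexive (lem ℓ k q)) (+-monoˡ-≤ (207 * (ℓ * q * k))
    (≤-trans (+-mono-≤ (+-mono-≤ (*-grow {100} 1≤pr) (*-monoʳ-≤ 107 (≤-trans (*-grow {ℓ} 1≤k) ℓk≤))) (*-monoʳ-≤ 507 ℓk≤)) (≤-reflexive (lem₂ (p * r))))))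
    where
    ℓk≤ : ℓ * k ≤ p * r
    ℓk≤ = *-mono-≤ ℓ≤p k≤r
    lem : ∀ l k q → 100 + l * (100 + k * (500 + 207 * q + 7) + 7) ≡ 100 + 107 * l + 507 * (l * k) + 207 * (l * q * k)
    lem = solve-∀
    lem₂ : ∀ w → 100 * w + 107 * w + 507 * w ≡ 714 * w
    lem₂ = solve-∀

  preprocessCost≤ : preprocessCost ≤ 200000 * C * tc
  preprocessCost≤ = begin
    preprocessCost
      ≤⟨ +-mono-≤ copy≤ (+-mono-≤ log≤ (+-mono-≤ flips≤ (+-mono-≤ (points≤ (m≤m+n p r)) (+-mono-≤ (points≤ (m≤n+m r p))
         (+-mono-≤ sketches≤ (+-mono-≤ (centers≤ 1≤p 1≤ℓ) (+-mono-≤ (centers≤ 1≤r 1≤k)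
         (+-mono-≤ differences≤ (+-mono-≤ gram≤ (≤-trans u≤ (*-grow {200} 1≤pr))))))))))) ⟩
    507 * s + (1107 * s + (3412 * s + (414 * s + (414 * s + (8319 * s + (6133 * rowWork + (6133 * colWork
      + (814 * s + ((714 * d + 207 * e) + 200 * d))))))))) ≡⟨ lem s rowWork colWork d e ⟩
    14987 * s + 6133 * rowWork + 6133 * colWork + (914 * d + 207 * e)
      ≤⟨ +-mono-≤ (+-mono-≤ (+-mono-≤ (*-monoʳ-≤ 14987 (*-monoʳ-≤ C scan≤)) (*-monoʳ-≤ 6133 (*-monoʳ-≤ C row≤)))
           (*-monoʳ-≤ 6133 (*-monoʳ-≤ C col≤))) de≤ ⟩
    14987 * (C * (4 * tc)) + 6133 * (C * (3 * tc)) + 6133 * (C * (3 * tc)) + 1121 * (C * tc) ≤⟨ m≤m+n _ (102133 * (C * tc)) ⟩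
    14987 * (C * (4 * tc)) + 6133 * (C * (3 * tc)) + 6133 * (C * (3 * tc)) + 1121 * (C * tc) + 102133 * (C * tc) ≤⟨ m≤m+n _ 0 ⟩
    14987 * (C * (4 * tc)) + 6133 * (C * (3 * tc)) + 6133 * (C * (3 * tc)) + 1121 * (C * tc) + 102133 * (C * tc) + 0 ≡⟨ lem₂ C tc ⟩
    200000 * C * tc ∎
    where
    open ≤-Reasoning
    s = scanWork
    d = p * r
    e = ℓ * q * k
    lem : ∀ s x y d e → 507 * s + (1107 * s + (3412 * s + (414 * s + (414 * s + (8319 * s + (6133 * x + (6133 * y
      + (814 * s + ((714 * d + 207 * e) + 200 * d))))))))) ≡ 14987 * s + 6133 * x + 6133 * y + (914 * d + 207 * e)
    lem = solve-∀
    lem₂ : ∀ C t → 14987 * (C * (4 * t)) + 6133 * (C * (3 * t)) + 6133 * (C * (3 * t)) + 1121 * (C * t) + 102133 * (C * t) + 0 ≡ 200000 * C * t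
    lem₂ = solve-∀
    row≤ : p * ℓ * L ≤ 3 * tc
    row≤ = ≤-trans (traversal-half {p} {r} {ℓ} {k} {q} 1≤ℓ ℓ≤p 1≤r 1≤k) (*-monoʳ-≤ 3 (+-monoˡ-≤ d (m≤m+n (a + b) e)))
    col≤ : r * k * L ≤ 3 * tc
    col≤ = ≤-trans (≤-reflexive (cong (λ n → r * k * ⌈log₂ n ⌉) (+-comm p r)))
      (≤-trans (traversal-half {r} {p} {k} {ℓ} {q} 1≤k k≤r 1≤p 1≤ℓ) (*-monoʳ-≤ 3
        (≤-trans (≤-reflexive (cong₂ _+_ (+-comm b a) (*-comm r p))) (+-monoˡ-≤ d (m≤m+n (a + b) e)))))
    de≤ : 914 * d + 207 * e ≤ 1121 * (C * tc)
    de≤ = ≤-trans (+-mono-≤ (*-monoʳ-≤ 914 (m≤n+m d (a + b + e))) (*-monoʳ-≤ 207 (≤-trans (m≤n+m e (a + b)) (m≤m+n _ d))))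
      (≤-trans (≤-reflexive (sym (*-distribʳ-+ tc 914 207))) (*-monoʳ-≤ 1121 (*-growˡ 1≤C)))

  mq≤ : m * q ≤ 64 * C * tc
  mq≤ = ≤-trans mq≤scan (≤-trans (*-monoʳ-≤ 16 (*-monoʳ-≤ C scan≤)) (≤-reflexive (lem C tc)))
    where lem : ∀ C t → 16 * (C * (4 * t)) ≡ 64 * C * t
          lem = solve-∀

  queryCost≤ : ∀ a b → queryCost a b ≤ 2000 + 207 * (a + b)
  queryCost≤ a b = ≤-trans
    (+-mono-≤ u≤ (+-mono-≤ u≤ (+-mono-≤ u≤ (+-mono-≤ u≤ (+-mono-≤ u≤ (+-mono-≤ u≤ (+-mono-≤ u≤ (+-mono-≤ u≤
      (+-mono-≤ (lp≤ a u≤) (+-mono-≤ (lp≤ b u≤) u≤)))))))))) (≤-reflexive (lem a b))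
    where lem : ∀ a b → 200 + (200 + (200 + (200 + (200 + (200 + (200 + (200 + ((100 + a * 207) + ((100 + b * 207) + 200))))))))) ≡ 2000 + 207 * (a + b)
          lem = solve-∀

∣-∣≡∸+∸ : ∀ a b → (a ∸ b) + (b ∸ a) ≡ ∣ a - b ∣
∣-∣≡∸+∸ zero    zero    = refl
∣-∣≡∸+∸ zero    (suc b) = refl
∣-∣≡∸+∸ (suc a) zero    = +-identityʳ (suc a)
∣-∣≡∸+∸ (suc a) (suc b) = ∣-∣≡∸+∸ a b

rowSum-mono : ∀ m q {f g : List Bool → ℕ} → (∀ l → f l ≤ g l) → ∀ l → rowSum m q f l ≤ rowSum m q g l
rowSum-mono zero    q le l = z≤n
rowSum-mono (suc m) q le l = +-mono-≤ (le l) (rowSum-mono m q le (List.drop q l))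

rowSum-+ : ∀ m q (f g : List Bool → ℕ) l → rowSum m q (λ l → f l + g l) l ≡ rowSum m q f l + rowSum m q g l
rowSum-+ zero    q f g l = refl
rowSum-+ (suc m) q f g l = trans (cong (f l + g l +_) (rowSum-+ m q f g (List.drop q l)))
  (interchange (f l) (g l) (rowSum m q f (List.drop q l)) (rowSum m q g (List.drop q l)))
  where
  interchange : ∀ a b c d → a + b + (c + d) ≡ a + c + (b + d)
  interchange = solve-∀

gaps : ℕ → ℕ → Point → Point → List Bool → ℕ
gaps m q x y l = rowSum m q (gap q x y) l

gaps-triangle : ∀ m q x y z l → gaps m q x y l ≤ gaps m q x z l + gaps m q y z l
gaps-triangle m q x y z l = ≤-trans (rowSum-mono m q (λ l → ≤-trans (∣-∣-triangle (sketch q x l) (sketch q z l) (sketch q y l))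
    (+-monoʳ-≤ (gap q x z l) (≤-reflexive (∣-∣-comm (sketch q z l) (sketch q y l))))) l)
  (≤-reflexive (rowSum-+ m q (gap q x z) (gap q y z) l))

module Quality (p q r ℓ k C : ℕ) where
  open Phases p q r ℓ k C
  open Traversal p q r ℓ k C
  open Tables p q r ℓ k C

  gapOf≡gaps : ∀ {σ pt ω} → Prepared pt ω σ → ∀ g g' → g < N → g' < N → gapOf (A σ Y) g g' ≡ gaps m q (pt g) (pt g') ω
  gapOf≡gaps {pt = pt} {ω} pr g g' g< g'< = trans (sumTo-cong m (λ t t< → trans
      (cong₂ (λ a b → (a ∸ b) + (b ∸ a)) (sketched g t g< t<) (sketched g' t g'< t<))
      (∣-∣≡∸+∸ (sketch q (pt g) (List.drop (t * q) ω)) (sketch q (pt g') (List.drop (t * q) ω)))))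
    (sym (rowSum-sumTo m q (gap q (pt g) (pt g')) ω))
    where open Prepared pr

  -- Among the c centers and the point itself, two lie in the same optimal cluster.
  traversal-quality : ∀ {σ pt ω off n c ρ} (U : ℕ → Point) → Prepared pt ω σ → Clusters off n c σ → 1 ≤ c → off + n ≤ N →
    (∀ i → i < n → A σ cp (off + i) < N) →
    (∀ i → i < n → Σ[ a ∈ ℕ ] a < c × gaps m q (pt (off + i)) (U a) ω ≤ ρ) →
    ∀ i → i < n → gaps m q (pt (off + i)) (pt (A σ cp (off + i))) ω ≤ ρ + ρ
  traversal-quality {σ} {pt} {ω} {off} {n} {c} {ρ} U pr cl 1≤c off+n≤ cp<' near-U i i< =
    subst (_≤ ρ + ρ) (trans (dist≡ nr 1≤c) (gapOf≡gaps pr (off + i) _ (index< i<) (cp<' i i<))) d≤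
    where
    d = proj₁ (nearest cl i i<)
    nr = proj₂ (nearest cl i i<)
    index< : ∀ {j} → j < n → off + j < N
    index< j< = <-≤-trans (+-monoʳ-< off j<) off+n≤
    ctr-index : ∀ j → j < c → ℕ
    ctr-index j j< = proj₁ (center cl j j<)
    member : Fin (suc c) → ℕ
    member Fin.zero    = i
    member (Fin.suc j) = ctr-index (toℕ j) (Fin.toℕ<n j)
    member< : ∀ j → member j < n
    member< Fin.zero    = i<
    member< (Fin.suc j) = proj₁ (proj₂ (center cl (toℕ j) (Fin.toℕ<n j)))
    cluster : Fin (suc c) → Fin c
    cluster j = Fin.fromℕ< (proj₁ (proj₂ (near-U (member j) (member< j))))
    close : ∀ x y → cluster x ≡ cluster y → gapOf (A σ Y) (off + member x) (off + member y) ≤ ρ + ρ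
    close x y eq = ≤-trans (≤-reflexive (gapOf≡gaps pr _ _ (index< (member< x)) (index< (member< y))))
      (≤-trans (gaps-triangle m q (pt (off + member x)) (pt (off + member y)) (U ax) ω)
        (+-mono-≤ (proj₂ (proj₂ (near-U (member x) (member< x))))
          (subst (λ a → gaps m q (pt (off + member y)) (U a) ω ≤ ρ) (sym ax≡ay) (proj₂ (proj₂ (near-U (member y) (member< y)))))))
      where
      ax = proj₁ (near-U (member x) (member< x))
      ay = proj₁ (near-U (member y) (member< y))
      ax≡ay : ax ≡ ay
      ax≡ay = trans (sym (Fin.toℕ-fromℕ< _)) (trans (cong toℕ eq) (Fin.toℕ-fromℕ< _))
    separated : ∀ x y → x Fin.< y → d ≤ gapOf (A σ Y) (off + member x) (off + member y)
                                  ⊎ d ≤ gapOf (A σ Y) (off + member y) (off + member x)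
    separated Fin.zero    (Fin.suc y) _ = inj₁ (subst (λ z → d ≤ gapOf (A σ Y) (off + i) z)
      (proj₂ (proj₂ (center cl (toℕ y) (Fin.toℕ<n y)))) (near nr (toℕ y) (Fin.toℕ<n y)))
    separated (Fin.suc x) (Fin.suc y) (s≤s x<y) = inj₂ (subst₂ (λ a b → d ≤ gapOf (A σ Y) a b)
      (proj₂ (proj₂ (center cl (toℕ y) (Fin.toℕ<n y)))) (proj₂ (proj₂ (center cl (toℕ x) (Fin.toℕ<n x))))
      (apart nr (toℕ x) (toℕ y) x<y (Fin.toℕ<n y)))
    d≤ : d ≤ ρ + ρ
    d≤ with Fin.pigeonhole (n<1+n c) cluster
    ... | x , y , x<y , eq with separated x y x<y
    ...   | inj₁ le = ≤-trans le (close x y eq)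
    ...   | inj₂ le = ≤-trans le (close y x (sym eq))

distance-bound : ∀ {M n₀ d λ* G} → 1 ≤ M → 1 ≤ n₀ → n₀ * n₀ ≤ 2 * suc λ* → M * isqrt d ≤ 2 * G →
                 G ≤ n₀ * (3 * (16 * M)) + n₀ * (3 * (16 * M)) → d ≤ 74498 * suc λ*
distance-bound {M} {n₀} {d} {λ*} {G} 1≤M 1≤n₀ n₀²≤ low up = begin
  d                                     ≤⟨ <⇒≤ (proj₂ (isqrt-spec d)) ⟩
  suc (isqrt d) * suc (isqrt d)         ≤⟨ *-mono-≤ root≤ root≤ ⟩
  (193 * n₀) * (193 * n₀)               ≡⟨ lem₁ n₀ ⟩
  37249 * (n₀ * n₀)                     ≤⟨ *-monoʳ-≤ 37249 n₀²≤ ⟩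
  37249 * (2 * suc λ*)                  ≡⟨ *-assoc 37249 2 (suc λ*) ⟨
  74498 * suc λ*                        ∎
  where
  open ≤-Reasoning
  lem₁ : ∀ n → (193 * n) * (193 * n) ≡ 37249 * (n * n)
  lem₁ = solve-∀
  lem₂ : ∀ M n → 2 * (n * (3 * (16 * M)) + n * (3 * (16 * M))) ≡ M * (192 * n)
  lem₂ = solve-∀
  root : isqrt d ≤ 192 * n₀
  root = *-cancelˡ-≤ M {{>-nonZero 1≤M}} (≤-trans low (≤-trans (*-monoʳ-≤ 2 up) (≤-reflexive (lem₂ M n₀))))
  root≤ : suc (isqrt d) ≤ 193 * n₀
  root≤ = ≤-trans (s≤s root) (+-monoˡ-≤ (192 * n₀) 1≤n₀)

scale : ℕ → ℕ
scale d = suc (isqrt d)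

scale-spec : ∀ d → d ≤ scale d * scale d × scale d * scale d ≤ 2 * suc d
scale-spec d = <⇒≤ (proj₂ (isqrt-spec d)) , ≤-trans (m≤m+n _ ((isqrt d ∸ 1) * (isqrt d ∸ 1))) (≤-trans (sq (isqrt d)) (*-monoʳ-≤ 2 (s≤s (proj₁ (isqrt-spec d)))))
  where
  sq : ∀ s → suc s * suc s + (s ∸ 1) * (s ∸ 1) ≤ 2 * suc (s * s)
  sq zero    = s≤s z≤n
  sq (suc s) = ≤-reflexive (lem s)
    where lem : ∀ s → suc (suc s) * suc (suc s) + s * s ≡ 2 * suc (suc s * suc s)
          lem = solve-∀

-- The union bound

∑-sumTo : ∀ n k (f : List Bool → ℕ → ℕ) → ∑ n (λ l → sumTo k (f l)) ≡ sumTo k (λ i → ∑ n (λ l → f l i))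
∑-sumTo n zero    f = trans (∑-const n 0) (*-zeroʳ (2 ^ n))
∑-sumTo n (suc k) f = trans (∑-+ n (λ l → f l 0) (λ l → sumTo k (f l ∘ suc))) (cong (∑ n (λ l → f l 0) +_) (∑-sumTo n k (λ l → f l ∘ suc)))

gap-prefix : ∀ q x y l l' → q ≤ length l → gap q x y (l ++ l') ≡ gap q x y l
gap-prefix q x y l l' q≤ = cong₂ ∣_-_∣ (same x) (same y)
  where
  same : ∀ x → sketch q x (l ++ l') ≡ sketch q x l
  same x = sumTo-cong q (λ h h< → cong (signed (x h)) (nth-++ l l' (<-≤-trans h< q≤)))

drop-prefix : ∀ q (l l' : List Bool) → q ≤ length l → List.drop q (l ++ l') ≡ List.drop q l ++ l'
drop-prefix zero    l       l' q≤       = refl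
drop-prefix (suc q) (b ∷ l) l' (s≤s q≤) = drop-prefix q l l' q≤

gaps-prefix : ∀ m q x y l l' → m * q ≤ length l → gaps m q x y (l ++ l') ≡ gaps m q x y l
gaps-prefix zero    q x y l l' _  = refl
gaps-prefix (suc m) q x y l l' le = cong₂ _+_ (gap-prefix q x y l l' q≤)
  (trans (cong (rowSum m q (gap q x y)) (drop-prefix q l l' q≤)) (gaps-prefix m q x y (List.drop q l) l'
    (subst (m * q ≤_) (sym (List.length-drop q l)) (≤-trans (≤-reflexive (sym (m+n∸m≡n q (m * q)))) (∸-monoˡ-≤ q le)))))
  where
  q≤ : q ≤ length l
  q≤ = ≤-trans (m≤m+n q (m * q)) le

∑-prefix : ∀ a b (E : List Bool → ℕ) → (∀ l l' → length l ≡ a → E (l ++ l') ≡ E l) → ∑ (a + b) E ≡ ∑ a E * 2 ^ b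
∑-prefix a b E local = trans (∑-++ a b E) (trans (∑-cong a (λ l eq → trans (∑-cong b (λ l' _ → local l l' eq)) (∑-const b (E l))))
  (trans (∑-* a (2 ^ b) E) (*-comm (2 ^ b) _)))

module Events (q N M T : ℕ) (mq≤T : 16 * M * q ≤ T) (pt target : ℕ → Point) (sc : ℕ → ℕ)
              (1≤sc : ∀ g → 1 ≤ sc g) (target≤ : ∀ g → g < N → dist q (pt g) (target g) ≤ sc g * sc g) where

  tooClose : ℕ → ℕ → List Bool → Bool
  tooClose g g' l = 2 * gaps (16 * M) q (pt g) (pt g') l <ᵇ M * isqrt (dist q (pt g) (pt g'))

  tooFar : ℕ → List Bool → Bool
  tooFar g l = sc g * (3 * (16 * M)) ≤ᵇ gaps (16 * M) q (pt g) (target g) l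

  bad : List Bool → ℕ
  bad l = sumTo N (λ g → sumTo N (λ g' → bit (tooClose g g' l))) + sumTo N (λ g → bit (tooFar g l))

  extend : (E : List Bool → Bool) → (∀ l l' → length l ≡ 16 * M * q → E (l ++ l') ≡ E l) →
           ∑ (16 * M * q) (bit ∘ E) * 2 ^ M ≤ 2 ^ (16 * M * q) → ∑ T (bit ∘ E) * 2 ^ M ≤ 2 ^ T
  extend E local le = subst (λ T → ∑ T (bit ∘ E) * 2 ^ M ≤ 2 ^ T) (m+[n∸m]≡n mq≤T) (begin
    ∑ (16 * M * q + rest) (bit ∘ E) * 2 ^ M   ≡⟨ cong (_* 2 ^ M) (∑-prefix (16 * M * q) rest (bit ∘ E) (λ l l' eq → cong bit (local l l' eq))) ⟩
    ∑ (16 * M * q) (bit ∘ E) * 2 ^ rest * 2 ^ M ≡⟨ lem (∑ (16 * M * q) (bit ∘ E)) (2 ^ rest) (2 ^ M) ⟩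
    ∑ (16 * M * q) (bit ∘ E) * 2 ^ M * 2 ^ rest ≤⟨ *-monoˡ-≤ (2 ^ rest) le ⟩
    2 ^ (16 * M * q) * 2 ^ rest               ≡⟨ ^-distribˡ-+-* 2 (16 * M * q) rest ⟨
    2 ^ (16 * M * q + rest)                   ∎)
    where
    open ≤-Reasoning
    rest = T ∸ 16 * M * q
    lem : ∀ a b c → a * b * c ≡ a * c * b
    lem = solve-∀

  tooClose-rare : ∀ g g' → ∑ T (bit ∘ tooClose g g') * 2 ^ M ≤ 2 ^ T
  tooClose-rare g g' = extend (tooClose g g')
    (λ l l' eq → cong (λ z → 2 * z <ᵇ M * isqrt d) (gaps-prefix (16 * M) q (pt g) (pt g') l l' (≤-reflexive (sym eq)))) (go (d ≟ 0))
    where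
    d = dist q (pt g) (pt g')
    go : Dec (d ≡ 0) → ∑ (16 * M * q) (bit ∘ tooClose g g') * 2 ^ M ≤ 2 ^ (16 * M * q)
    go (no d≢0) = Lower.tail q (pt g) (pt g') (n≢0⇒n>0 d≢0) M (isqrt d) (proj₁ (isqrt-spec d))
    go (yes d≡0) = ≤-trans (≤-reflexive (cong (_* 2 ^ M) (trans (∑-cong (16 * M * q) (λ l _ → cong bit (never l)))
        (trans (∑-const (16 * M * q) 0) (*-zeroʳ (2 ^ (16 * M * q))))))) z≤n
      where
      never : ∀ l → tooClose g g' l ≡ false
      never l = trans (cong (λ z → 2 * gaps (16 * M) q (pt g) (pt g') l <ᵇ z) (trans (cong (λ d → M * isqrt d) d≡0) (*-zeroʳ M)))
        (n<ᵇ0 (2 * gaps (16 * M) q (pt g) (pt g') l))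
        where
        n<ᵇ0 : ∀ n → (n <ᵇ 0) ≡ false
        n<ᵇ0 zero    = refl
        n<ᵇ0 (suc n) = refl

  tooFar-rare : ∀ g → g < N → ∑ T (bit ∘ tooFar g) * 2 ^ M ≤ 2 ^ T
  tooFar-rare g g< = extend (tooFar g)
    (λ l l' eq → cong (λ z → sc g * (3 * (16 * M)) ≤ᵇ z) (gaps-prefix (16 * M) q (pt g) (target g) l l' (≤-reflexive (sym eq))))
    (≤-trans (*-monoʳ-≤ (∑ (16 * M * q) (bit ∘ tooFar g)) (^-monoʳ-≤ 2 (≤-trans (≤-reflexive (sym (*-identityˡ M))) (*-monoˡ-≤ M (s≤s {0} {15} z≤n)))))
      (Upper.tail q (pt g) (target g) (sc g) (1≤sc g) (target≤ g g<) (16 * M)))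

  sumTo-rare : ∀ n {f : ℕ → ℕ} {K} → (∀ i → i < n → f i * 2 ^ M ≤ K) → sumTo n f * 2 ^ M ≤ n * K
  sumTo-rare zero    le = z≤n
  sumTo-rare (suc n) {f} le = ≤-trans (≤-reflexive (*-distribʳ-+ (2 ^ M) (f 0) _)) (+-mono-≤ (le 0 (s≤s z≤n)) (sumTo-rare n (λ i i< → le (suc i) (s≤s i<))))

  bad-rare : ∑ T bad * 2 ^ M ≤ (N * N + N) * 2 ^ T
  bad-rare = begin
    ∑ T bad * 2 ^ M ≡⟨ cong (_* 2 ^ M) (trans (∑-+ T _ _) (cong₂ _+_
       (trans (∑-sumTo T N _) (sumTo-cong N (λ g _ → ∑-sumTo T N _))) (∑-sumTo T N _))) ⟩
    (sumTo N (λ g → sumTo N (λ g' → ∑ T (bit ∘ tooClose g g'))) + sumTo N (λ g → ∑ T (bit ∘ tooFar g))) * 2 ^ M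
      ≡⟨ *-distribʳ-+ (2 ^ M) (sumTo N (λ g → sumTo N (λ g' → ∑ T (bit ∘ tooClose g g')))) _ ⟩
    sumTo N (λ g → sumTo N (λ g' → ∑ T (bit ∘ tooClose g g'))) * 2 ^ M + sumTo N (λ g → ∑ T (bit ∘ tooFar g)) * 2 ^ M
      ≤⟨ +-mono-≤ (sumTo-rare N (λ g _ → sumTo-rare N (λ g' _ → tooClose-rare g g'))) (sumTo-rare N tooFar-rare) ⟩
    N * (N * 2 ^ T) + N * 2 ^ T ≡⟨ lem N (2 ^ T) ⟩
    (N * N + N) * 2 ^ T ∎
    where
    open ≤-Reasoning
    lem : ∀ n t → n * (n * t) + n * t ≡ (n * n + n) * t
    lem = solve-∀

  sumTo≡0 : ∀ n f → sumTo n f ≡ 0 → ∀ i → i < n → f i ≡ 0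
  sumTo≡0 (suc n) f eq zero    i<       = m+n≡0⇒m≡0 (f 0) eq
  sumTo≡0 (suc n) f eq (suc i) (s≤s i<) = sumTo≡0 n (f ∘ suc) (m+n≡0⇒n≡0 (f 0) eq) i i<

  good-far : ∀ {l} → bad l ≡ 0 → ∀ g g' → g < N → g' < N → M * isqrt (dist q (pt g) (pt g')) ≤ 2 * gaps (16 * M) q (pt g) (pt g') l
  good-far {l} eq g g' g< g'< = ≮⇒≥ λ lt → no-event (tooClose g g' l)
    (sumTo≡0 N _ (sumTo≡0 N _ (m+n≡0⇒m≡0 _ eq) g g<) g' g'<) (<⇒<ᵇ lt)
    where
    no-event : ∀ b → bit b ≡ 0 → Bool.T b → ⊥
    no-event true () _

  good-near : ∀ {l} → bad l ≡ 0 → ∀ g → g < N → gaps (16 * M) q (pt g) (target g) l ≤ sc g * (3 * (16 * M))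
  good-near {l} eq g g< = ≮⇒≥ λ lt → no-event (tooFar g l)
    (sumTo≡0 N _ (m+n≡0⇒n≡0 (sumTo N (λ g → sumTo N (λ g' → bit (tooClose g g' l)))) eq) g g<) (≤⇒≤ᵇ (<⇒≤ lt))
    where
    no-event : ∀ b → bit b ≡ 0 → Bool.T b → ⊥
    no-event true () _

-- Assembling the bounds

length-filter-map : ∀ {X Y : Set} {P : Y → Set} (P? : ∀ y → Dec (P y)) (f : X → Y) xs →
  length (List.filter P? (List.map f xs)) ≡ length (List.filter (P? ∘ f) xs)
length-filter-map P? f []       = refl
length-filter-map P? f (x ∷ xs) with does (P? (f x))
... | true  = cong suc (length-filter-map P? f xs)
... | false = length-filter-map P? f xs

count≡∑ : ∀ m {E : List Bool → Set} (E? : ∀ l → Dec (E l)) →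
          length (List.filter (E? ∘ toList) (bitVectors m)) ≡ ∑ m (λ l → bit (does (E? l)))
count≡∑ zero    E? with does (E? [])
... | true  = refl
... | false = refl
count≡∑ (suc m) E? = trans (cong length (List.filter-++ (E? ∘ toList) (List.map (false Vec.∷_) (bitVectors m)) _))
  (trans (List.length-++ (List.filter (E? ∘ toList) (List.map (false Vec.∷_) (bitVectors m))))
    (cong₂ _+_ (half false) (half true)))
  where
  half : ∀ b → length (List.filter (E? ∘ toList) (List.map (b Vec.∷_) (bitVectors m))) ≡ ∑ m (λ l → bit (does (E? (b ∷ l))))
  half b = trans (length-filter-map (E? ∘ toList) (b Vec.∷_) (bitVectors m)) (count≡∑ m (λ l → E? (b ∷ l)))

1-recip≤ : ∀ n a E .{{_ : NonZero E}} → 1 ≤ n → E * n ≤ a * n + E → 1ℚ ℚ.- recip n ℚ.≤ ℤ.+_ a ℚ./ E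
1-recip≤ (suc k) a (suc E) _ le = begin
  1ℚ ℚ.- x             ≤⟨ ℚ.+-monoˡ-≤ (ℚ.- x) sum≥1 ⟩
  y ℚ.+ x ℚ.+ (ℚ.- x)  ≡⟨ ℚ.+-assoc y x (ℚ.- x) ⟩
  y ℚ.+ (x ℚ.+ ℚ.- x)  ≡⟨ cong (y ℚ.+_) (ℚ.+-inverseʳ x) ⟩
  y ℚ.+ ℚ.0ℚ           ≡⟨ ℚ.+-identityʳ y ⟩
  y                    ∎
  where
  open ℚ.≤-Reasoning
  x = recip (suc k)
  y = ℤ.+_ a ℚ./ suc E
  sum≃ : ℚ.toℚᵘ (y ℚ.+ x) ℚᵘ.≃ mkℚᵘ (ℤ.+_ a) E ℚᵘ.+ mkℚᵘ (ℤ.+_ 1) k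
  sum≃ = ℚᵘ.≃-trans (ℚ.toℚᵘ-homo-+ y x) (ℚᵘ.+-cong (ℚ.toℚᵘ-fromℚᵘ (mkℚᵘ (ℤ.+_ a) E)) (ℚ.toℚᵘ-fromℚᵘ (mkℚᵘ (ℤ.+_ 1) k)))
  cross : ℤ.+_ 1 ℤ.* ℤ.+_ (suc E * suc k) ℤ.≤ (ℤ._+_ (ℤ.+_ a ℤ.* ℤ.+_ (suc k)) (ℤ.+_ 1 ℤ.* ℤ.+_ (suc E))) ℤ.* ℤ.+_ 1
  cross = subst₂ ℤ._≤_ (sym (ℤ.*-identityˡ (ℤ.+_ (suc E * suc k))))
    (sym (trans (ℤ.*-identityʳ _) (cong₂ ℤ._+_ (sym (ℤ.pos-* a (suc k))) (ℤ.*-identityˡ (ℤ.+_ (suc E)))))) (ℤ.+≤+ le)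
  sum≥1 : 1ℚ ℚ.≤ y ℚ.+ x
  sum≥1 = ℚ.toℚᵘ-cancel-≤ (ℚᵘ.≤-trans (*≤* cross) (ℚᵘ.≤-reflexive (ℚᵘ.≃-sym sum≃)))

okSize : ℕ → Size → Bool
okSize E (small d) = (1 ≤ᵇ d) ∧ (d ≤ᵇ E)
okSize E (large n) = n ≡ᵇ 0

allSizes : (Size → Bool) → List Size → Bool
allSizes f []       = true
allSizes f (s ∷ ss) = f s ∧ allSizes f ss

fetch-end : ∀ P n → length P ≡ n → fetch P n ≡ nothing
fetch-end []      n refl = refl
fetch-end (i ∷ P) n refl = fetch-end P (length P) refl

module Fitting (Γ : Ctx) (B : ℕ) (16≤B : 16 ≤ B) (1≤top : 1 ≤ Ctx.maxDeg Γ) where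
  open Ctx Γ
  open Typing Γ
  open Bounds B 16≤B

  B≤G : B ≤ G
  B≤G = ≤-trans (≤-reflexive (sym (*-identityʳ B))) (^-monoʳ-≤ B 1≤top)

  ok-fits : ∀ {W} s {v} → 32 * G ≤ W → T (okSize maxDeg s) → v ≤ B → Fits W s v
  ok-fits (small d) _ ok v≤B = let (a , b) = Equivalence.to T-∧ ok in
    ≤-trans v≤B (≤-trans (≤-reflexive (sym (*-identityʳ B))) (^-monoʳ-≤ B (≤ᵇ⇒≤ 1 d a))) , ≤ᵇ⇒≤ d maxDeg b
  ok-fits {W} (large n) 32G≤W ok v≤B =
    ≤-trans v≤B (≤-trans (≤-trans B≤G (m≤n*m G 32)) (≤-trans 32G≤W (m≤m+n W (n * G))))

  ok-declared : ∀ s → T (okSize maxDeg s) → declared s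
  ok-declared (small d) _  = refl
  ok-declared (large n) ok = ≡ᵇ⇒≡ n 0 ok

  AllOK : Set
  AllOK = (∀ x → T (okSize maxDeg (varSize x))) × (∀ a → T (okSize maxDeg (arrSize a)))

  all-declared : AllOK → Declared
  all-declared (v , a) = (λ x → ok-declared (varSize x) (v x)) , (λ x → ok-declared (arrSize x) (a x))

  all-bounded : AllOK → ∀ {σ} → (∀ x → V σ x ≤ B) → (∀ a y → A σ a y ≤ B) → Bounded (32 * G) σ
  all-bounded (v , a) v≤ a≤ = record
    { var-fits = λ x → ok-fits (varSize x) ≤-refl (v x) (v≤ x)
    ; arr-fits = λ b y → ok-fits (arrSize b) ≤-refl (a b) (a≤ b y)
    ; 32G≤W = ≤-refl }

  array-word : AllOK → ∀ {W σ} → Bounded W σ → ∀ a y → A σ a y ≤ W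
  array-word (_ , ok) {W} bd a y = ≤-trans (word {W} {arrSize a} (32G≤W bd) (arr-fits bd a y))
    (≤-reflexive (trans (cong (λ n → W + n * G) (ok-declared (arrSize a) (ok a))) (+-identityʳ W)))

sizes-ok : ∀ {f : Size → Bool} → T (f (small 1)) → ∀ ss → T (allSizes f ss) → ∀ x → T (f (sizes ss x))
sizes-ok base []       _  x       = base
sizes-ok base (s ∷ ss) ok zero    = proj₁ (Equivalence.to T-∧ ok)
sizes-ok base (s ∷ ss) ok (suc x) = sizes-ok base ss (proj₂ (Equivalence.to T-∧ ok)) x

cells≤ : ∀ {B l} → All (_≤ B) l → ∀ x → cells l x ≤ B
cells≤ []         x       = z≤n
cells≤ (le ∷ les) zero    = le
cells≤ (le ∷ les) (suc x) = cells≤ les x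

affine≤ : ∀ K m {x b} → 1 ≤ b → x ≤ b + b → K + m * x ≤ (K + (m + m)) * b
affine≤ K m {x} {b} 1≤b x≤ = ≤-trans (+-mono-≤ (≤-trans (≤-reflexive (sym (*-identityʳ K))) (*-monoʳ-≤ K 1≤b)) (*-monoʳ-≤ m x≤)) (≤-reflexive (lem K m b))
  where lem : ∀ K m b → K * b + m * (b + b) ≡ (K + (m + m)) * b
        lem = solve-∀

prologue : ℕ → List Instr
prologue C = const 5 C ∷ []

compile : List Instr → Cmd → Program
compile pre c = pre ++ compC (length pre) 0 c

preprocessProgram : ℕ → Program
preprocessProgram C = compile (prologue C) preprocess

queryProgram : Program
queryProgram = compile [] query

module Compiled (Γ : Ctx) (B : ℕ) (16≤B : 16 ≤ B) (decl : Typing.Bounds.Declared Γ B 16≤B)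
                (w : ℕ) (pre : List Instr) (c : Cmd) where
  open Ctx Γ
  open Typing Γ
  open Bounds B 16≤B
  open Exec w (compile pre c) public
  open Simulation Γ B 16≤B decl w (compile pre c)

  record Halts (W K n : ℕ) (Q : Env → Set) (σ : Env) (s₀ : State) : Set where
    field
      final   : State
      halts   : ∀ t → n + K ≤ t → exec w (compile pre c) t s₀ ≡ just final
      σ'      : Env
      vars    : ∀ x → x < 32 → reg final x ≡ V σ' x
      arrays  : ∀ a y → a < 16 → mem final (y * 16 + a) ≡ A σ' a y
      frames  : Frame c σ σ'
      correct : Q σ'
      bounded : Bounded (W + cost c σ * G) σ'

  -- Abstract: a projection from the result must not unfold the simulation.
  abstract
    exec-compiled : ∀ {W σ R M n s₀ K Q} → ⊢ c → Bounded W σ → W + cost c σ * G < 2 ^ w →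
      (coinFlips ≡ true → cost c σ ≤ length (ωs σ)) → (∀ x → x < 32 → R x ≡ V σ x) → (∀ a y → a < 16 → M (y * 16 + a) ≡ A σ a y) →
      Steps n s₀ (mkState (length pre) R M (ωs σ)) → Outcome c σ K Q → Halts W K n Q σ s₀
    exec-compiled {σ = σ} {n = n} tc bd W< fl rv rm st₀ o
      with sim-C tc bd W< fl rv rm (At-suffix pre (compC (length pre) 0 c))
    ... | n' , R' , M' , n'≤ , st , rv' , rm' , _ = record
      { halts = λ t le → exec-steps (st₀ ++ₛ st)
          (fetch-end (compile pre c) (length pre + lenC c) (trans (List.length-++ pre) (cong (length pre +_) (length-compC (length pre) 0 c))))
          (≤-trans (+-monoʳ-≤ n (≤-trans n'≤ (within o))) le)
      ; σ' = run c σ ; vars = rv' ; arrays = rm' ; frames = run-frame c σ ; correct = holds o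
      ; bounded = run-bounded decl tc bd }

memView : (ℕ → ℕ) → ℕ → ℕ → ℕ
memView M a y = M (y * 16 + a)

view-raw : ∀ M x → memView M (x % 16) (x / 16) ≡ M x
view-raw M x = cong M (trans (+-comm (x / 16 * 16) (x % 16)) (sym (m≡m%n+[m/n]*n x 16)))

-- With b = p + q + r: B bounds the input, B' the memory after preprocessing, and
-- b ^ κ all words.
module Growth (b C c : ℕ) (2≤b : 2 ≤ b) where

  instance
    b≢0 : NonZero b
    b≢0 = >-nonZero (≤-trans (s≤s z≤n) 2≤b)

  B e κ B' : ℕ
  B  = b ^ (4 + C)
  e  = (c + 7) + (4 + C) * 10
  κ  = 15 + e * 6
  B' = b ^ e

  const≤ : ∀ n → n ≤ b ^ n
  const≤ n = ≤-trans (n≤2^n n) (^-monoˡ-≤ n 2≤b)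

  2^≤ : ∀ n → 2 ^ n ≤ b ^ n
  2^≤ n = ^-monoˡ-≤ n 2≤b

  up : ∀ {x i j} → x ≤ b ^ i → i ≤ j → x ≤ b ^ j
  up le i≤j = ≤-trans le (^-monoʳ-≤ b i≤j)

  b≤ : b ≤ b ^ 1
  b≤ = ≤-reflexive (sym (*-identityʳ b))

  16≤B : 16 ≤ B
  16≤B = up {i = 4} {4 + C} (2^≤ 4) (m≤m+n 4 C)

  C≤B : C ≤ B
  C≤B = up {i = C} {4 + C} (const≤ C) (m≤n+m C 4)

  b≤B : b ≤ B
  b≤B = up {i = 1} {4 + C} b≤ (s≤s z≤n)

  16≤B' : 16 ≤ B'
  16≤B' = up {i = 4} (2^≤ 4) (≤-trans (m≤m+n 4 3) (≤-trans (m≤n+m 7 c) (m≤m+n (c + 7) _)))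

  b≤B' : b ≤ B'
  b≤B' = up {i = 1} b≤ (≤-trans (s≤s z≤n) (≤-trans (m≤n+m 7 c) (m≤m+n (c + 7) _)))

  double : ∀ {x y i} → x ≤ b ^ i → y ≤ b ^ i → x + y ≤ b ^ suc i
  double {i = i} x≤ y≤ = ≤-trans (+-mono-≤ x≤ y≤) (≤-trans (≤-reflexive (cong (λ z → b ^ i + z) (sym (+-identityʳ (b ^ i))))) (*-monoˡ-≤ (b ^ i) 2≤b))

  preprocess-word : ∀ {cost t} → cost ≤ c * t → t ≤ b ^ 6 → 32 * B ^ 10 + cost * B ^ 10 ≤ B'
  preprocess-word {cost} {t} le t≤ = begin
    32 * B ^ 10 + cost * B ^ 10   ≡⟨ *-distribʳ-+ (B ^ 10) 32 cost ⟨
    (32 + cost) * B ^ 10          ≤⟨ *-mono-≤ (double {i = c + 6} (up {i = 5} (2^≤ 5) (≤-trans (n≤1+n 5) (m≤n+m 6 c)))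
                                       (≤-trans le (≤-trans (*-mono-≤ (const≤ c) t≤) (≤-reflexive (sym (^-distribˡ-+-* b c 6))))))
                                     (≤-reflexive (^-*-assoc b (4 + C) 10)) ⟩
    b ^ suc (c + 6) * b ^ ((4 + C) * 10) ≡⟨ cong (λ z → b ^ z * b ^ ((4 + C) * 10)) (sym (+-suc c 6)) ⟩
    b ^ (c + 7) * b ^ ((4 + C) * 10) ≡⟨ ^-distribˡ-+-* b (c + 7) ((4 + C) * 10) ⟨
    B'                            ∎
    where open ≤-Reasoning

  query-word : ∀ {cost} → 32 + cost ≤ 4096 * b → 32 * B' ^ 6 + cost * B' ^ 6 < b ^ κ
  query-word {cost} le = ≤-<-trans (begin
    32 * B' ^ 6 + cost * B' ^ 6 ≡⟨ *-distribʳ-+ (B' ^ 6) 32 cost ⟨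
    (32 + cost) * B' ^ 6        ≤⟨ *-mono-≤ (≤-trans le 4096b≤) (≤-reflexive (^-*-assoc b e 6)) ⟩
    b ^ 13 * b ^ (e * 6)        ≡⟨ ^-distribˡ-+-* b 13 (e * 6) ⟨
    b ^ (13 + e * 6)            ∎) (^-monoʳ-< b 2≤b (s≤s (n≤1+n (13 + e * 6))))
    where
    open ≤-Reasoning
    4096b≤ : 4096 * b ≤ b ^ 13
    4096b≤ = begin
      4096 * b                ≤⟨ *-mono-≤ (2^≤ 12) b≤ ⟩
      b ^ 12 * b ^ 1          ≡⟨ ^-distribˡ-+-* b 12 1 ⟨
      b ^ 13                  ∎

  B'<κ : B' < b ^ κ
  B'<κ = ^-monoʳ-< b 2≤b (≤-trans (s≤s (m≤m*n e 6)) (m≤n+m (suc (e * 6)) 14))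

module Run (C c : ℕ) {p q r ℓ k : ℕ} (A₀ : Matrix01 p q) (B₀ : Matrix01 q r)
           (1≤ℓ : 1 ≤ ℓ) (ℓ≤p : ℓ ≤ p) (1≤k : 1 ≤ k) (k≤r : k ≤ r) (1≤C : 1 ≤ C) 
           (c-steps : ∀ t → 1 ≤ t → suc (200000 * C * t) ≤ c * t) (c-flips : ∀ t → 64 * C * t ≤ c * t)
           (w : ℕ) (b : ℕ) (b≡ : b ≡ p + q + r) (2≤b : 2 ≤ b) where
  open Growth b C c 2≤b
  open Time {p} {q} {r} {ℓ} {k} 1≤ℓ ℓ≤p 1≤k k≤r using (tc; L; 1≤pr; 1≤p; 1≤r; 1≤L)
  open CostBound {p} {q} {r} {ℓ} {k} {C} 1≤ℓ ℓ≤p 1≤k k≤r 1≤C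
  open Phases p q r ℓ k C
  open Traversal p q r ℓ k C
  open Tables p q r ℓ k C
  open Correctness p q r ℓ k C

  p≤b : p ≤ b
  p≤b = ≤-trans (≤-trans (m≤m+n p q) (m≤m+n (p + q) r)) (≤-reflexive (sym b≡))
  q≤b : q ≤ b
  q≤b = ≤-trans (≤-trans (m≤n+m q p) (m≤m+n (p + q) r)) (≤-reflexive (sym b≡))
  r≤b : r ≤ b
  r≤b = ≤-trans (m≤n+m r (p + q)) (≤-reflexive (sym b≡))
  ℓ≤b : ℓ ≤ b
  ℓ≤b = ≤-trans ℓ≤p p≤b
  k≤b : k ≤ b
  k≤b = ≤-trans k≤r r≤b

  tc≤ : tc ≤ b ^ 6
  tc≤ = begin
    tc                                  ≤⟨ +-mono-≤ (+-mono-≤ (+-mono-≤ (three p≤b ℓ≤b) (three r≤b k≤b))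
                                             (≤-trans (*-mono-≤ (*-mono-≤ ℓ≤b q≤b) k≤b) (≤-trans (≤-reflexive (cube b)) (^-monoʳ-≤ b (m≤m+n 3 1)))))
                                             (≤-trans (*-mono-≤ p≤b r≤b) (≤-trans (≤-reflexive (square b)) (^-monoʳ-≤ b (m≤m+n 2 2)))) ⟩
    b ^ 4 + b ^ 4 + b ^ 4 + b ^ 4       ≡⟨ four (b ^ 4) ⟩
    4 * b ^ 4                           ≤⟨ *-monoˡ-≤ (b ^ 4) (*-mono-≤ 2≤b 2≤b) ⟩
    b * b * b ^ 4                       ≡⟨ *-assoc b b (b ^ 4) ⟩
    b ^ 6                               ∎
    where
    open ≤-Reasoning
    cube : ∀ b → b * b * b ≡ b ^ 3
    cube b = trans (*-assoc b b b) (cong (λ z → b * (b * z)) (sym (*-identityʳ b)))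
    square : ∀ b → b * b ≡ b ^ 2
    square b = cong (b *_) (sym (*-identityʳ b))
    four : ∀ x → x + x + x + x ≡ 4 * x
    four = solve-∀
    three : ∀ {n l} → n ≤ b → l ≤ b → n * ⌈log₂ n ⌉ * (q + l) ≤ b ^ 4
    three {n} {l} n≤ l≤ = begin
      n * ⌈log₂ n ⌉ * (q + l) ≤⟨ *-mono-≤ (*-mono-≤ n≤ (≤-trans (⌈log₂n⌉≤n n) n≤)) (+-mono-≤ q≤b l≤) ⟩
      b * b * (b + b)         ≤⟨ *-monoʳ-≤ (b * b) (≤-trans (≤-reflexive (cong (b +_) (sym (+-identityʳ b)))) (*-monoˡ-≤ b 2≤b)) ⟩
      b * b * (b * b)         ≡⟨ trans (*-assoc b b (b * b)) (cong (λ z → b * (b * z)) (square b)) ⟩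
      b ^ 4                   ∎

  1≤tc : 1 ≤ tc
  1≤tc = ≤-trans 1≤pr (m≤n+m (p * r) _)

  budget : ℕ
  budget = c * tc

  steps≤ : suc preprocessCost ≤ budget
  steps≤ = ≤-trans (s≤s preprocessCost≤) (c-steps tc 1≤tc)

  mq≤budget : 16 * (C * L) * q ≤ budget
  mq≤budget = ≤-trans mq≤ (c-flips tc)

  B₀ᵗ : Vec (Vec Bool q) r
  B₀ᵗ = transpose B₀

  pt : ℕ → Point
  pt = rowAt (A₀ Vec.++ B₀ᵗ)

  inputBits : List Bool
  inputBits = toList (concat A₀) ++ toList (concat B₀)

  M₀ : ℕ → ℕ
  M₀ = cells (List.map bit inputBits)

  pt-row : ∀ {g} → g < p → ∀ h → pt g h ≡ rowAt A₀ g h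
  pt-row = rowAt-++ˡ A₀ B₀ᵗ

  pt-col : ∀ g h → pt (p + g) h ≡ rowAt B₀ᵗ g h
  pt-col = rowAt-++ʳ A₀ B₀ᵗ

  length-concat : ∀ {m n} (X : Matrix01 m n) → length (toList (concat X)) ≡ m * n
  length-concat X = Vec.length-toList (concat X)

  row-input : ∀ g h → g < p → h < q → M₀ (g * q + h) ≡ bit (pt g h)
  row-input g h g< h< = trans (cells-bits inputBits _) (cong bit (trans
    (nth-++ (toList (concat A₀)) (toList (concat B₀)) (subst (g * q + h <_) (sym (length-concat A₀))
      (<-≤-trans (cell-mono {q} {p} {g} {0} g< h<) (≤-reflexive (+-identityʳ (p * q))))))
    (trans (nth-concat A₀ g h g< h<) (sym (pt-row g< h)))))

  col-input : ∀ g h → g < r → h < q → M₀ (p * q + (h * r + g)) ≡ bit (pt (p + g) h)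
  col-input g h g< h< = trans (cells-bits inputBits _) (cong bit (trans
    (cong (λ n → nth inputBits (n + (h * r + g))) (sym (length-concat A₀)))
    (trans (nth-++ʳ (toList (concat A₀)) (toList (concat B₀)) (h * r + g))
      (trans (nth-concat B₀ h g h< g<) (trans (sym (rowAt-transpose B₀ g< h<)) (sym (pt-col g h)))))))

  V₀ : ℕ → ℕ
  V₀ = cells (p ∷ q ∷ r ∷ ℓ ∷ k ∷ []) [ 5 ≔ C ]

  σ₀ : List Bool → Env
  σ₀ ω = env V₀ (memView M₀) ω

  preprocessed : ∀ ω → Outcome preprocess (σ₀ ω) preprocessCost (Prepared pt ω)
  preprocessed ω = preprocess-spec {σ₀ ω} pt
    (record { par₀ = refl ; par₁ = refl ; par₂ = refl ; par₃ = refl ; par₄ = refl ; par₅ = refl })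
    1≤ℓ ℓ≤p 1≤k k≤r
    (λ x _ → ≤-trans (≤-reflexive (trans (view-raw M₀ x) (cells-bits inputBits x))) (bit≤1 _))
    (λ g h g< h< → trans (view-raw M₀ _) (row-input g h g< h<))
    (λ g h g< h< → trans (view-raw M₀ _) (col-input g h g< h<))

  module Pre = Fitting preCtx B 16≤B (s≤s z≤n)
  module Qry = Fitting queryCtx B' 16≤B' (s≤s z≤n)

  pre-ok : Pre.AllOK
  pre-ok = sizes-ok {okSize 10} tt preVarSizes tt , sizes-ok {okSize 10} tt preArrSizes tt

  query-ok : Qry.AllOK
  query-ok = sizes-ok {okSize 6} tt queryVarSizes tt , λ _ → tt

  open Typing.Bounds using () renaming (Bounded to BoundedBy)

  pre-bounded : ∀ ω → BoundedBy preCtx B 16≤B (32 * B ^ 10) (σ₀ ω)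
  pre-bounded ω = Pre.all-bounded pre-ok vars (λ a y → ≤-trans (≤-reflexive (cells-bits inputBits (y * 16 + a)))
    (≤-trans (bit≤1 _) (≤-trans (s≤s z≤n) 16≤B)))
    where
    params : All (_≤ B) (p ∷ q ∷ r ∷ ℓ ∷ k ∷ [])
    params = ≤-trans p≤b b≤B ∷ ≤-trans q≤b b≤B ∷ ≤-trans r≤b b≤B ∷ ≤-trans ℓ≤b b≤B ∷ ≤-trans k≤b b≤B ∷ []
    vars : ∀ x → V₀ x ≤ B
    vars x with x ≡ᵇ 5
    ... | true  = C≤B
    ... | false = cells≤ params x

  Memory : List Bool → (ℕ → ℕ) → Env → Set
  Memory ω M σ = Prepared pt ω σ × (∀ a y → a < 16 → M (y * 16 + a) ≡ A σ a y) × (∀ a y → A σ a y ≤ B')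

  query-cost≤ : ∀ {x y cost} → cost ≤ queryCost x y → x ≤ b → y ≤ b → 32 + cost ≤ (32 + (2000 + (207 + 207))) * b
  query-cost≤ {x} {y} le x≤ y≤ = ≤-trans (+-mono-≤ (≤-trans (≤-reflexive (sym (*-identityʳ 32))) (*-monoʳ-≤ 32 1≤b))
      (≤-trans le (≤-trans (queryCost≤ x y) (affine≤ 2000 207 1≤b (+-mono-≤ x≤ y≤)))))
    (≤-reflexive (sym (*-distribʳ-+ b 32 (2000 + (207 + 207)))))
    where
    1≤b : 1 ≤ b
    1≤b = ≤-trans (s≤s z≤n) 2≤b

  module _ (word : b ^ κ ≤ 2 ^ w) where

    run-preprocess : ∀ ω → length ω ≡ budget →
      Σ[ s ∈ State ] exec w (preprocessProgram C) budget (inputState ℓ k A₀ B₀ ω) ≡ just s × Σ[ σ ∈ Env ] Memory ω (mem s) σ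
    run-preprocess ω len = final , halts budget (≤-trans (s≤s ≤-refl) steps≤) , σ' , correct , arrays
      , λ a y → ≤-trans (Pre.array-word pre-ok bounded a y) total≤
      where
      open Compiled preCtx B 16≤B (Pre.all-declared pre-ok) w (prologue C) preprocess
      o = preprocessed ω
      total≤ : 32 * B ^ 10 + cost preprocess (σ₀ ω) * B ^ 10 ≤ B'
      total≤ = preprocess-word {cost preprocess (σ₀ ω)} (≤-trans (within o) (≤-trans (n≤1+n _) steps≤)) tc≤
      total< : 32 * B ^ 10 + cost preprocess (σ₀ ω) * B ^ 10 < 2 ^ w
      total< = ≤-<-trans total≤ (<-≤-trans B'<κ word)
      C< : C < 2 ^ w
      C< = ≤-<-trans C≤B (≤-<-trans (≤-trans Pre.B≤G (m≤n*m (B ^ 10) 32)) (≤-<-trans (m≤m+n (32 * B ^ 10) _) total<))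
      open Halts (exec-compiled {σ = σ₀ ω} {R = cells (p ∷ q ∷ r ∷ ℓ ∷ k ∷ []) [ 5 ≔ wrap w C ]} {M₀} {1} {inputState ℓ k A₀ B₀ ω}
        preprocess-typed (pre-bounded ω) total<
        (λ _ → ≤-trans (within o) (≤-trans (≤-trans (n≤1+n _) steps≤) (≤-reflexive (sym len))))
        (λ x _ → cong (λ v → (cells (p ∷ q ∷ r ∷ ℓ ∷ k ∷ []) [ 5 ≔ v ]) x) (wrap-id w C<)) (λ a y _ → refl)
        ((refl , refl) ∙ done) o)

    run-query : ∀ {ω M σ} → Memory ω M σ → ∀ (i : Fin p) (j : Fin r) →
      Σ[ s ∈ State ] (∀ t → queryCost (A σ cnt (toℕ i)) (A σ cnt (p + toℕ j)) ≤ t → exec w queryProgram t (queryState M i j) ≡ just s)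
                   × reg s 0 ≡ productEntry A₀ B₀ i j × (∀ a → mem s a ≡ M a)
    run-query {ω} {M} {σ} (pr , rm₀ , A≤) i j =
      final , halts
      , trans (vars 0 (s≤s z≤n)) (trans correct (sym (trans (productEntry≡ A₀ B₀ i j)
            (sumTo-cong q (λ h _ → cong₂ (λ a b → bit a * bit b) (sym (pt-row i< h)) (sym (pt-col (toℕ j) h)))))))
      , λ a → trans (cong (mem final) (sym (split a))) (trans (arrays (a % 16) (a / 16) (m%n<n a 16))
            (trans (cong-app (sameA frames (a % 16) refl) (a / 16)) (trans (sym (rm₀ (a % 16) (a / 16) (m%n<n a 16))) (cong M (split a)))))
      where
      open Compiled queryCtx B' 16≤B' (Qry.all-declared query-ok) w [] query
      split : ∀ a → a / 16 * 16 + a % 16 ≡ a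
      split a = trans (+-comm (a / 16 * 16) (a % 16)) (sym (m≡m%n+[m/n]*n a 16))
      τ : Env
      τ = env (cells (toℕ i ∷ toℕ j ∷ [])) (A σ) []
      pr' : Prepared pt ω τ
      pr' = record { hd₀ = hd₀ ; hd₁ = hd₁ ; hd₂ = hd₂ ; points = points ; sketched = sketched
        ; rowClusters = record { center = center rowClusters ; nearest = nearest rowClusters }
        ; colClusters = record { center = center colClusters ; nearest = nearest colClusters }
        ; cp< = cp< ; diffs = diffs ; grams = grams }
        where open Prepared pr
      i< = Fin.toℕ<n i
      j< = Fin.toℕ<n j
      o = query-spec {τ} (toℕ i) (toℕ j) refl refl i< j< pr'
      cnt≤ : ∀ g → g < N → A σ cnt g ≤ b
      cnt≤ g g< = ≤-trans (≤-reflexive (proj₁ (Prepared.diffs pr g g<))) (≤-trans (dist≤ q (pt g) (pt (A σ cp g))) q≤b)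
      cost≤ : 32 + cost query τ ≤ 4096 * b
      cost≤ = ≤-trans (query-cost≤ {A σ cnt (toℕ i)} {A σ cnt (p + toℕ j)} {cost query τ} (within o) (cnt≤ (toℕ i) (<-≤-trans i< (m≤m+n p r))) (cnt≤ (p + toℕ j) (+-monoʳ-< p j<)))
        (*-monoˡ-≤ b (≤ᵇ⇒≤ (32 + (2000 + (207 + 207))) 4096 tt))
      bd : BoundedBy queryCtx B' 16≤B' (32 * B' ^ 6) τ
      bd = Qry.all-bounded query-ok (cells≤ (≤-trans (<⇒≤ i<) (≤-trans p≤b b≤B') ∷ ≤-trans (<⇒≤ j<) (≤-trans r≤b b≤B') ∷ [])) A≤
      total< : 32 * B' ^ 6 + cost query τ * B' ^ 6 < 2 ^ w
      total< = <-≤-trans (query-word {cost query τ} cost≤) word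
      open Halts (exec-compiled {σ = τ} {R = V τ} {M} {0} {queryState M i j} query-typed bd total< (λ ()) (λ _ _ → refl) rm₀ done o)

totalise : ∀ {n q ℓ X U ρ} → Covers {n} q ℓ X U ρ →
           Σ[ a ∈ (ℕ → ℕ) ] (∀ i → i < n → a i < ℓ × dist q (rowAt X i) (U (a i)) ≤ ρ)
totalise {n} {q} {ℓ} {X} {U} {ρ} cov = a , spec
  where
  index : ∀ i → Dec (i < n) → ℕ
  index i (yes i<) = proj₁ (cov i i<)
  index i (no _)   = 0
  a : ℕ → ℕ
  a i = index i (i <? n)
  spec : ∀ i → i < n → a i < ℓ × dist q (rowAt X i) (U (a i)) ≤ ρ
  spec i i< with i <? n
  ... | yes i<' = proj₂ (cov i i<')
  ... | no i≮   = ⊥-elim (i≮ i<)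

if-below : ∀ {X : Set} {p i} (x y : X) → i < p → (if i <ᵇ p then x else y) ≡ x
if-below x y i< rewrite Equivalence.to T-≡ (<⇒<ᵇ i<) = refl

if-above : ∀ {X : Set} p j (x y : X) → (if p + j <ᵇ p then x else y) ≡ y
if-above p j x y with p + j <ᵇ p in eq
... | false = refl
... | true  = ⊥-elim (<⇒≱ (<ᵇ⇒< (p + j) p (Equivalence.from T-≡ eq)) (m≤m+n p j))

if-elim : ∀ {X : Set} (P : X → Set) b {x y} → P x → P y → P (if b then x else y)
if-elim P true  px py = px
if-elim P false px py = py

certain : ∀ {E : Set} (E? : Dec E) n → (n ≡ 0 → E) → 1 ≤ bit (does E?) + n
certain E? zero    f = ≤-trans (≤-reflexive (cong bit (sym (dec-true E? (f refl))))) (m≤m+n _ 0)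
certain E? (suc n) f = ≤-trans (s≤s z≤n) (m≤n+m (suc n) (bit (does E?)))

module Success (C c : ℕ) {p q r ℓ k : ℕ} (A₀ : Matrix01 p q) (B₀ : Matrix01 q r)
               (1≤ℓ : 1 ≤ ℓ) (ℓ≤p : ℓ ≤ p) (1≤k : 1 ≤ k) (k≤r : k ≤ r) (1≤C : 1 ≤ C)
               (c-steps : ∀ t → 1 ≤ t → suc (200000 * C * t) ≤ c * t) (c-flips : ∀ t → 64 * C * t ≤ c * t)
               (c-query : ∀ {x y} λ₁ λ₂ → x ≤ 74498 * suc λ₁ → y ≤ 74498 * suc λ₂ → 2000 + 207 * (x + y) ≤ c * suc (λ₁ + λ₂))
               (w b : ℕ) (b≡ : b ≡ p + q + r) (2≤b : 2 ≤ b)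
               (word : b ^ Growth.κ b C c 2≤b ≤ 2 ^ w) where
  open Run C c A₀ B₀ 1≤ℓ ℓ≤p 1≤k k≤r 1≤C c-steps c-flips w b b≡ 2≤b
  open Phases p q r ℓ k C using (N; m)
  open Tables p q r ℓ k C using (Prepared)
  open Correctness p q r ℓ k C using (split-point; queryCost)
  open Quality p q r ℓ k C using (traversal-quality)
  open CostBound {p} {q} {r} {ℓ} {k} {C} 1≤ℓ ℓ≤p 1≤k k≤r 1≤C using (queryCost≤)
  open Time {p} {q} {r} {ℓ} {k} 1≤ℓ ℓ≤p 1≤k k≤r using (1≤L; 1≤p)

  M = C * ⌈log₂ N ⌉

  1≤M : 1 ≤ M
  1≤M = *-mono-≤ 1≤C 1≤L

  λr λc : ℕ
  λr = Λrow A₀ ℓ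
  λc = Λcol B₀ k

  rowCover = coveringRadius-covers ℓ A₀ 1≤ℓ
  colCover = coveringRadius-covers k B₀ᵗ 1≤k
  Ur = proj₁ rowCover
  Uc = proj₁ colCover
  rowIndex = totalise {X = A₀} (proj₂ rowCover)
  colIndex = totalise {X = B₀ᵗ} (proj₂ colCover)

  target : ℕ → Point
  target g = if g <ᵇ p then Ur (proj₁ rowIndex g) else Uc (proj₁ colIndex (g ∸ p))

  sc : ℕ → ℕ
  sc g = if g <ᵇ p then scale λr else scale λc

  target-row : ∀ {i} → i < p → target i ≡ Ur (proj₁ rowIndex i)
  target-row {i} = if-below (Ur (proj₁ rowIndex i)) (Uc (proj₁ colIndex (i ∸ p)))

  target-col : ∀ j → target (p + j) ≡ Uc (proj₁ colIndex j)
  target-col j = trans (if-above p j (Ur (proj₁ rowIndex (p + j))) (Uc (proj₁ colIndex (p + j ∸ p))))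
    (cong (λ z → Uc (proj₁ colIndex z)) (m+n∸m≡n p j))

  sc-row : ∀ {i} → i < p → sc i ≡ scale λr
  sc-row = if-below (scale λr) (scale λc)

  sc-col : ∀ j → sc (p + j) ≡ scale λc
  sc-col j = if-above p j (scale λr) (scale λc)

  1≤sc : ∀ g → 1 ≤ sc g
  1≤sc g = if-elim (1 ≤_) (g <ᵇ p) {scale λr} {scale λc} (s≤s z≤n) (s≤s z≤n)

  dist-congˡ : ∀ {x x' : Point} y → (∀ h → x h ≡ x' h) → dist q x y ≡ dist q x' y
  dist-congˡ y eq = sumTo-cong q (λ h _ → cong (λ b → bit (b xor y h)) (eq h))

  target≤ : ∀ g → g < N → dist q (pt g) (target g) ≤ sc g * sc g
  target≤ = split-point
    (λ i i< → subst₂ (λ t s → dist q (pt i) t ≤ s * s) (sym (target-row i<)) (sym (sc-row i<))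
      (≤-trans (≤-reflexive (dist-congˡ (Ur (proj₁ rowIndex i)) (pt-row i<))) (≤-trans (proj₂ (proj₂ rowIndex i i<)) (proj₁ (scale-spec λr)))))
    (λ j j< → subst₂ (λ t s → dist q (pt (p + j)) t ≤ s * s) (sym (target-col j)) (sym (sc-col j))
      (≤-trans (≤-reflexive (dist-congˡ (Uc (proj₁ colIndex j)) (pt-col j))) (≤-trans (proj₂ (proj₂ colIndex j j<)) (proj₁ (scale-spec λc)))))

  open Events q N M budget mq≤budget pt target sc 1≤sc target≤

  module Good {ω : List Bool} {mem₁ : ℕ → ℕ} {σ : Env} (memory : Memory ω mem₁ σ) (good : bad ω ≡ 0) where
    pr = proj₁ memory
    open Prepared pr

    gap-bound : ∀ {λ*} g → g < N → gaps m q (pt g) (pt (A σ cp g)) ω ≤ scale λ* * (3 * (16 * M)) + scale λ* * (3 * (16 * M)) →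
                A σ cnt g ≤ 74498 * suc λ*
    gap-bound {λ*} g g< up = ≤-trans (≤-reflexive (proj₁ (diffs g g<)))
      (distance-bound {M} {scale λ*} {λ* = λ*} 1≤M (s≤s z≤n) (proj₂ (scale-spec λ*)) (good-far good g (A σ cp g) g< (cp< g g<)) up)

    row-count : ∀ i → i < p → A σ cnt i ≤ 74498 * suc λr
    row-count i i< = gap-bound i (<-≤-trans i< (m≤m+n p r))
      (traversal-quality Ur pr rowClusters 1≤ℓ (m≤m+n p r) (λ j j< → cp< j (<-≤-trans j< (m≤m+n p r)))
        (λ j j< → proj₁ rowIndex j , proj₁ (proj₂ rowIndex j j<) ,
          subst₂ (λ t s → gaps m q (pt j) t ω ≤ s * (3 * (16 * M))) (target-row j<) (sc-row j<) (good-near good j (<-≤-trans j< (m≤m+n p r)))) i i<)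

    col-count : ∀ j → j < r → A σ cnt (p + j) ≤ 74498 * suc λc
    col-count i i< = gap-bound (p + i) (+-monoʳ-< p i<)
      (traversal-quality Uc pr colClusters 1≤k ≤-refl (λ j j< → cp< (p + j) (+-monoʳ-< p j<))
        (λ j j< → proj₁ colIndex j , proj₁ (proj₂ colIndex j j<) ,
          subst₂ (λ t s → gaps m q (pt (p + j)) t ω ≤ s * (3 * (16 * M))) (target-col j) (sc-col j) (good-near good (p + j) (+-monoʳ-< p j<))) i i<)

    answers : AnswersAllWithin w queryProgram (c * suc (λr + λc)) A₀ B₀ mem₁
    answers i j = let (s , halts , eq , _) = run-query word memory i j in
      trans (cong (Maybe.map (λ s → reg s 0)) (halts (c * suc (λr + λc)) (≤-trans (queryCost≤ _ _)
        (c-query λr λc (row-count (toℕ i) (Fin.toℕ<n i)) (col-count (toℕ j) (Fin.toℕ<n j)))))) (cong just eq)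

  answers-all : ∀ {ω M σ} → Memory ω M σ → AnswersAll w queryProgram A₀ B₀ M
  answers-all {σ = σ} memory i j = let (s , halts , eq , same) = run-query word memory i j
                                       t = queryCost (A σ cnt (toℕ i)) (A σ cnt (p + toℕ j))
    in t , s , halts t ≤-refl , eq , same

  Fast : List Bool → Set
  Fast ω = MaybeAny.Any (λ s → AnswersAllWithin w queryProgram (c * suc (λr + λc)) A₀ B₀ (mem s))
                        (exec w (preprocessProgram C) budget (inputState ℓ k A₀ B₀ ω))

  Fast? : ∀ ω → Dec (Fast ω)
  Fast? ω = MaybeAny.dec (λ s → answersAllWithin? w queryProgram (c * suc (λr + λc)) A₀ B₀ (mem s))
                         (exec w (preprocessProgram C) budget (inputState ℓ k A₀ B₀ ω))

  good⇒fast : ∀ ω → length ω ≡ budget → bad ω ≡ 0 → Fast ω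
  good⇒fast ω len good = let (s , eq , σ , memory) = run-preprocess word ω len in
    subst (MaybeAny.Any (λ s → AnswersAllWithin w queryProgram (c * suc (λr + λc)) A₀ B₀ (mem s))) (sym eq)
      (MaybeAny.just (Good.answers memory good))

  fast-or-bad : ∀ ω → length ω ≡ budget → 1 ≤ bit (does (Fast? ω)) + bad ω
  fast-or-bad ω len = certain (Fast? ω) (bad ω) (good⇒fast ω len)

  fast-mostly : 2 ^ budget ≤ ∑ budget (λ ω → bit (does (Fast? ω))) + ∑ budget bad
  fast-mostly = ≤-trans (≤-reflexive (trans (sym (*-identityʳ (2 ^ budget))) (sym (∑-const budget 1))))
    (≤-trans (∑-mono budget fast-or-bad) (≤-reflexive (∑-+ budget _ bad)))

  success : ∀ α → C ≡ α + 3 → 1ℚ ℚ.- recip (N ^ α) ℚ.≤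
            ℚ._/_ (ℤ.+_ (∑ budget (λ ω → bit (does (Fast? ω))))) (2 ^ budget) {{m^n≢0 2 budget}}
  success α refl = 1-recip≤ (N ^ α) F (2 ^ budget) {{m^n≢0 2 budget}} (m^n>0 N {{>-nonZero 1≤N}} α) (begin
    2 ^ budget * N ^ α               ≤⟨ *-monoˡ-≤ (N ^ α) fast-mostly ⟩
    (F + ∑ budget bad) * N ^ α       ≡⟨ *-distribʳ-+ (N ^ α) F (∑ budget bad) ⟩
    F * N ^ α + ∑ budget bad * N ^ α ≤⟨ +-monoʳ-≤ (F * N ^ α) bad≤ ⟩
    F * N ^ α + 2 ^ budget           ∎)
    where
    open ≤-Reasoning
    F = ∑ budget (λ ω → bit (does (Fast? ω)))
    2≤N : 2 ≤ N
    2≤N = +-mono-≤ 1≤p (≤-trans 1≤k k≤r)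
    1≤N : 1 ≤ N
    1≤N = ≤-trans (s≤s z≤n) 2≤N
    pairs≤ : N ^ α * (N * N + N) ≤ 2 ^ M
    pairs≤ = begin
      N ^ α * (N * N + N)          ≤⟨ *-monoʳ-≤ (N ^ α) (begin
        N * N + N                  ≤⟨ +-monoʳ-≤ (N * N) (≤-trans (≤-reflexive (sym (*-identityʳ N))) (*-monoʳ-≤ N 1≤N)) ⟩
        N * N + N * N              ≡⟨ cong (N * N +_) (sym (+-identityʳ (N * N))) ⟩
        2 * (N * N)                ≤⟨ *-monoˡ-≤ (N * N) 2≤N ⟩
        N * (N * N)                ≡⟨ cong (λ z → N * (N * z)) (sym (*-identityʳ N)) ⟩
        N ^ 3                      ∎) ⟩
      N ^ α * N ^ 3                ≡⟨ ^-distribˡ-+-* N α 3 ⟨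
      N ^ (α + 3)                  ≤⟨ ^-monoˡ-≤ (α + 3) (n≤2^⌈log₂n⌉ N) ⟩
      (2 ^ ⌈log₂ N ⌉) ^ (α + 3)    ≡⟨ ^-*-assoc 2 ⌈log₂ N ⌉ (α + 3) ⟩
      2 ^ (⌈log₂ N ⌉ * (α + 3))    ≡⟨ cong (2 ^_) (*-comm ⌈log₂ N ⌉ (α + 3)) ⟩
      2 ^ M                        ∎
    bad≤ : ∑ budget bad * N ^ α ≤ 2 ^ budget
    bad≤ = *-cancelʳ-≤ _ _ (N * N + N) {{>-nonZero (≤-trans 1≤N (m≤n+m N (N * N)))}} (begin
      ∑ budget bad * N ^ α * (N * N + N)   ≡⟨ *-assoc (∑ budget bad) (N ^ α) (N * N + N) ⟩
      ∑ budget bad * (N ^ α * (N * N + N)) ≤⟨ *-monoʳ-≤ (∑ budget bad) pairs≤ ⟩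
      ∑ budget bad * 2 ^ M                 ≤⟨ bad-rare ⟩
      (N * N + N) * 2 ^ budget             ≡⟨ *-comm (N * N + N) (2 ^ budget) ⟩
      2 ^ budget * (N * N + N)             ∎)

timeConstant : ℕ → ℕ → ℕ → ℕ → ℕ
timeConstant K C K₁ K₂ = K * C + suc (K₁ + K₂)

timeConstant-steps : ∀ K C K₁ K₂ t → 1 ≤ t → suc (K * C * t) ≤ timeConstant K C K₁ K₂ * t
timeConstant-steps K C K₁ K₂ t 1≤t = ≤-trans (≤-reflexive (+-comm 1 (K * C * t)))
  (≤-trans (+-monoʳ-≤ (K * C * t) (≤-trans 1≤t (m≤m+n t ((K₁ + K₂) * t)))) (≤-reflexive (sym (*-distribʳ-+ t (K * C) (suc (K₁ + K₂))))))

timeConstant-flips : ∀ {J} K C K₁ K₂ t → J ≤ K → J * C * t ≤ timeConstant K C K₁ K₂ * t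
timeConstant-flips K C K₁ K₂ t J≤K = *-monoˡ-≤ t (≤-trans (*-monoˡ-≤ C J≤K) (m≤m+n (K * C) _))

timeConstant-query : ∀ K C K₁ m J {x y} λ₁ λ₂ → x ≤ J * suc λ₁ → y ≤ J * suc λ₂ →
                     K₁ + m * (x + y) ≤ timeConstant K C K₁ (2 * (m * J)) * suc (λ₁ + λ₂)
timeConstant-query K C K₁ m J {x} {y} λ₁ λ₂ x≤ y≤ = begin
  K₁ + m * (x + y)                             ≤⟨ +-monoʳ-≤ K₁ (*-monoʳ-≤ m (+-mono-≤ x≤ y≤)) ⟩
  K₁ + m * (J * suc λ₁ + J * suc λ₂)           ≤⟨ m≤m+n _ (K₁ * (λ₁ + λ₂) + m * J * (λ₁ + λ₂)) ⟩
  K₁ + m * (J * suc λ₁ + J * suc λ₂) + (K₁ * (λ₁ + λ₂) + m * J * (λ₁ + λ₂)) ≡⟨ lem K₁ m J λ₁ λ₂ ⟩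
  (K₁ + 2 * (m * J)) * suc (λ₁ + λ₂)           ≤⟨ *-monoˡ-≤ (suc (λ₁ + λ₂)) (≤-trans (n≤1+n _) (m≤n+m (suc (K₁ + 2 * (m * J))) (K * C))) ⟩
  timeConstant K C K₁ (2 * (m * J)) * suc (λ₁ + λ₂) ∎
  where
  open ≤-Reasoning
  lem : ∀ K m J a b → K + m * (J * suc a + J * suc b) + (K * (a + b) + m * J * (a + b)) ≡ (K + 2 * (m * J)) * suc (a + b)
  lem = solve-∀

theorem4 : ∀ (α : ℕ) → 1 ≤ α →
    Σ[ P ∈ Program ] Σ[ Q ∈ Program ] Σ[ c ∈ ℕ ] Σ[ κ ∈ ℕ ]
    (∀ (p q r ℓ k : ℕ) (A : Matrix01 p q) (B : Matrix01 q r) →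
    1 ≤ ℓ → ℓ ≤ p → 1 ≤ k → k ≤ r →
    ∀ (w : ℕ) → κ * ⌈log₂ (p + q + r) ⌉ ≤ w →
    let T = c * preprocessingCost p q r ℓ k
        t = c * suc (Λrow A ℓ + Λcol B k)
    in
    (∀ (ω : Vec Bool T) →
    ∃[ s ] (exec w P T (inputState ℓ k A B (toList ω)) ≡ just s
    × AnswersAll w Q A B (mem s)))
    × (1ℚ ℚ.- recip ((p + r) ^ α) ℚ.≤ Pr (fastQueries? w P Q T t ℓ k A B)))
theorem4 α 1≤α = preprocessProgram C , queryProgram , c , κ , λ p q r ℓ k A B 1≤ℓ ℓ≤p 1≤k k≤r w κlog≤w →
  let 2≤b : 2 ≤ p + q + r
      2≤b = +-mono-≤ (≤-trans (≤-trans 1≤ℓ ℓ≤p) (m≤m+n p q)) (≤-trans 1≤k k≤r)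
      word = word≤ (p + q + r) κ κlog≤w
      module R = Run C c A B 1≤ℓ ℓ≤p 1≤k k≤r 1≤C steps flips w (p + q + r) refl 2≤b
      module S' = Success C c A B 1≤ℓ ℓ≤p 1≤k k≤r 1≤C steps flips queries w (p + q + r) refl 2≤b word
  in (λ ω → let (s , eq , σ , memory) = R.run-preprocess word (toList ω) (Vec.length-toList ω) in
        s , eq , S'.answers-all memory)
   , subst (λ n → 1ℚ ℚ.- recip ((p + r) ^ α) ℚ.≤ ℚ._/_ (ℤ.+_ n) (2 ^ (c * preprocessingCost p q r ℓ k)) {{m^n≢0 2 (c * preprocessingCost p q r ℓ k)}})
       (sym (count≡∑ (c * preprocessingCost p q r ℓ k) S'.Fast?)) (S'.success α refl)
  where
  C = α + 3
  c = timeConstant 200000 C 2000 (2 * (207 * 74498))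
  κ = 15 + ((c + 7) + (4 + C) * 10) * 6
  1≤C : 1 ≤ C
  1≤C = ≤-trans 1≤α (m≤m+n α 3)
  steps : ∀ t → 1 ≤ t → suc (200000 * C * t) ≤ c * t
  steps = timeConstant-steps 200000 C 2000 (2 * (207 * 74498))
  flips : ∀ t → 64 * C * t ≤ c * t
  flips t = timeConstant-flips 200000 C 2000 (2 * (207 * 74498)) t (≤ᵇ⇒≤ 64 200000 tt)
  queries : ∀ {x y} λ₁ λ₂ → x ≤ 74498 * suc λ₁ → y ≤ 74498 * suc λ₂ → 2000 + 207 * (x + y) ≤ c * suc (λ₁ + λ₂)
  queries = timeConstant-query 200000 C 2000 207 74498
  word≤ : ∀ b κ {w} → κ * ⌈log₂ b ⌉ ≤ w → b ^ κ ≤ 2 ^ w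
  word≤ b κ {w} le = ≤-trans (^-monoˡ-≤ κ (n≤2^⌈log₂n⌉ b)) (≤-trans (≤-reflexive (trans (^-*-assoc 2 ⌈log₂ b ⌉ κ)
    (cong (2 ^_) (*-comm ⌈log₂ b ⌉ κ)))) (^-monoʳ-≤ 2 le))
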